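{- Suppose that there is an $\varepsilon>0$ such that at least one of the following holds: (i) the longest common subsequence (LCS) problem on two sequences of length $n$ over an alphabet of size $7$ can be solved in $O(n^{2-\varepsilon})$ time; or (ii) the dynamic time warping distance (DTWD) problem over symbols, on two sequences of length $n$ over an alphabet of size $5$, can be solved in $O(n^{2-\varepsilon})$ time. Then the following conjecture is false: given two sets $A,B$ of $n$ vectors each in $\{0,1\}^d$ and an integer $r\ge 0$, there is no $\varepsilon'>0$ and an algorithm that can decide whether there is a pair $a\in A$, $b\in B$ with $\sum_{i=1}^d a_ib_i\le r$ in $O(n^{2-\varepsilon'}\cdot \mathrm{poly}(d))$ time. (That is, such an $\varepsilon'>0$ and such an algorithm exist.)
   Context: LCS problem: given two sequences $P_1,P_2$ over an alphabet $\Sigma$, output the length $LCS(P_1,P_2)$ of the longest sequence that appears as a subsequence of both. DTWD problem over symbols: given two sequences $x,y$ over an alphabet $\Sigma$, with $d(s,t)=0$ if $s=t$ and $d(s,t)=1$ if $s\ne t$, output $\mathrm{DTWD}(x,y)$, the minimum cost of a traversal of $x$ and $y$. A traversal uses two markers, initially placed at the first symbols of $x$ and of $y$. At every step one marker or both markers simultaneously move one symbol forward in their sequences; at the end both markers must be at the last symbols of their sequences. The cost of the traversal is the sum, over all configurations occurring in the traversal (the initial one included), of $d(s,t)$, where $s$ and $t$ are the symbols the two markers point at. Notation: $a_i$ is the $i$-th coordinate of $a$; $\mathrm{poly}(d)$ denotes a polynomially bounded function of $d$. -}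

module Defs where

open import Data.Bool using (Bool; true; false; if_then_else_; _∧_; _∨_; _xor_)
open import Data.Fin using (Fin; toℕ)
import Data.Fin as Fin
open import Data.Integer using (∣_∣)
open import Data.List using (List; []; _∷_; _++_; length)
open import Data.List.Relation.Binary.Sublist.Propositional using (_⊆_)
open import Data.List.Relation.Unary.All using (All)
open import Data.Nat
  using (ℕ; zero; suc; _+_; _*_; _∸_; _^_; _/_; _%_; _≤_; _<_; _<ᵇ_; _≡ᵇ_; NonZero)
open import Data.Nat.Properties using (m^n≢0)
open import Data.Product using (_×_; _,_; ∃-syntax)
open import Data.Rational using (ℚ; ↥_; ↧ₙ_)
open import Data.Sum using (_⊎_)
open import Data.Vec using (Vec; lookup; map; toList; concat; zipWith; sum)
open import Data.Vec.Membership.Propositional using (_∈_)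
open import Data.Vec.Relation.Unary.Unique.Propositional using (Unique)
open import Relation.Binary.PropositionalEquality using (_≡_; _≢_)
open import Relation.Nullary using (¬_; does)

-- Time is measured on a unit-cost word RAM with w-bit words: a random
-- access memory of 2 ^ w words and finitely many registers per program.
-- Programs are structured rather than lists of jumps; the two forms
-- simulate each other with constant overhead.

Reg : Set
Reg = ℕ

data Op : Set where
  add sub mul div mod and or xor shl shr lt eq : Op

infix  6 _≔_ _≔_⟨_⟩_ _≔[_] [_]≔_
infixr 5 _⨾_

data Program : Set where
  skip            : Program
  _≔_             : Reg → ℕ → Program
  _≔_⟨_⟩_         : Reg → Reg → Op → Reg → Program
  _≔[_]           : Reg → Reg → Program
  [_]≔_           : Reg → Reg → Program
  _⨾_             : Program → Program → Program
  when_then_else_ : Reg → Program → Program → Program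
  while_loop_     : Reg → Program → Program

wrap : ℕ → ℕ → ℕ
wrap w v = _%_ v (2 ^ w) {{m^n≢0 2 w}}

bit : Bool → ℕ
bit b = if b then 1 else 0

bitwise : (Bool → Bool → Bool) → ℕ → ℕ → ℕ → ℕ
bitwise f zero    a b = 0
bitwise f (suc w) a b =
  bit (f (a % 2 ≡ᵇ 1) (b % 2 ≡ᵇ 1)) + 2 * bitwise f w (a / 2) (b / 2)

-- Results are reduced modulo 2 ^ w afterwards, so that `sub` is
-- subtraction modulo 2 ^ w.  Division by zero returns zero.
⟦_⟧ : Op → ℕ → ℕ → ℕ → ℕ
⟦ add ⟧ w a b       = a + b
⟦ sub ⟧ w a b       = a + (2 ^ w ∸ b)
⟦ mul ⟧ w a b       = a * b
⟦ div ⟧ w a zero    = 0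
⟦ div ⟧ w a (suc b) = a / suc b
⟦ mod ⟧ w a zero    = 0
⟦ mod ⟧ w a (suc b) = a % suc b
⟦ and ⟧ w a b       = bitwise _∧_ w a b
⟦ or  ⟧ w a b       = bitwise _∨_ w a b
⟦ xor ⟧ w a b       = bitwise _xor_ w a b
⟦ shl ⟧ w a b       = a * 2 ^ b
⟦ shr ⟧ w a b       = _/_ a (2 ^ b) {{m^n≢0 2 b}}
⟦ lt  ⟧ w a b       = bit (a <ᵇ b)
⟦ eq  ⟧ w a b       = bit (a ≡ᵇ b)

record State : Set where
  constructor ⟪_,_⟫
  field
    reg : Reg → ℕ
    mem : ℕ → ℕ

open State public

_[_↦_] : (ℕ → ℕ) → ℕ → ℕ → (ℕ → ℕ)
(f [ i ↦ v ]) j = if j ≡ᵇ i then v else f j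

infix 3 _⊢_,_⇓_,_

-- w ⊢ p , s ⇓ t , s′ : with word size w, the program p started in state s
-- halts in state s′ after t steps.
data _⊢_,_⇓_,_ (w : ℕ) : Program → State → ℕ → State → Set where
  ⇓skip  : ∀ {s} → w ⊢ skip , s ⇓ 1 , s
  ⇓const : ∀ {s x v} →
           w ⊢ x ≔ v , s ⇓ 1 , ⟪ reg s [ x ↦ wrap w v ] , mem s ⟫
  ⇓op    : ∀ {s x y o z} →
           w ⊢ x ≔ y ⟨ o ⟩ z , s ⇓ 1 ,
             ⟪ reg s [ x ↦ wrap w (⟦ o ⟧ w (reg s y) (reg s z)) ] , mem s ⟫
  ⇓load  : ∀ {s x y} →
           w ⊢ x ≔[ y ] , s ⇓ 1 , ⟪ reg s [ x ↦ mem s (reg s y) ] , mem s ⟫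
  ⇓store : ∀ {s x y} →
           w ⊢ [ x ]≔ y , s ⇓ 1 , ⟪ reg s , mem s [ reg s x ↦ reg s y ] ⟫
  ⇓seq   : ∀ {p q s s′ s″ t t′} →
           w ⊢ p , s ⇓ t , s′ → w ⊢ q , s′ ⇓ t′ , s″ →
           w ⊢ p ⨾ q , s ⇓ t + t′ , s″
  ⇓then  : ∀ {x p q s s′ t} → reg s x ≢ 0 →
           w ⊢ p , s ⇓ t , s′ →
           w ⊢ when x then p else q , s ⇓ suc t , s′
  ⇓else  : ∀ {x p q s s′ t} → reg s x ≡ 0 →
           w ⊢ q , s ⇓ t , s′ →
           w ⊢ when x then p else q , s ⇓ suc t , s′
  ⇓stop  : ∀ {x p s} → reg s x ≡ 0 →
           w ⊢ while x loop p , s ⇓ 1 , s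
  ⇓loop  : ∀ {x p s s′ s″ t t′} → reg s x ≢ 0 →
           w ⊢ p , s ⇓ t , s′ → w ⊢ while x loop p , s′ ⇓ t′ , s″ →
           w ⊢ while x loop p , s ⇓ suc (t + t′) , s″

record Problem : Set₁ where
  field
    Instance  : Set
    size      : Instance → ℕ
    registers : Instance → List ℕ
    memory    : Instance → List ℕ
    Answer    : Instance → ℕ → Set

contents : List ℕ → (ℕ → ℕ)
contents []       _       = 0
contents (v ∷ vs) zero    = v
contents (v ∷ vs) (suc i) = contents vs i

module _ (P : Problem) where
  open Problem P

  -- The word size is Ω(log size), with a constant k of the algorithm's
  -- choice, and every number of the input fits into a word.
  Admissible : ℕ → ℕ → Instance → Set
  Admissible k w I =
    (2 + size I) ^ k ≤ 2 ^ w ×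
    All (_< 2 ^ w) (registers I) ×
    All (_< 2 ^ w) (memory I)

  initial : Instance → State
  initial I = ⟪ contents (registers I) , contents (memory I) ⟫

  -- One program handles all instances and all admissible word sizes, and
  -- leaves the answer in register 0.
  SolvableWithin : (Instance → ℕ → Set) → Set
  SolvableWithin Bound =
    ∃[ p ] ∃[ k ] ∀ w I → Admissible k w I →
    ∃[ t ] ∃[ s ] (w ⊢ p , initial I ⇓ t , s) × Answer I (reg s 0) × Bound I t

-- t ≤ K · n ^ (2 - ε) for n ≥ 1 and ε = a / b > 0, in the form
-- t ^ b · n ^ a ≤ K ^ b · n ^ 2b, which avoids irrational powers.
_≤_·_^[2-_] : ℕ → ℕ → ℕ → ℚ → Set
t ≤ K · n ^[2- ε ] =
  t ^ (↧ₙ ε) * n ^ ∣ ↥ ε ∣ ≤ K ^ (↧ₙ ε) * n ^ (2 * ↧ₙ ε)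

PolynomiallyBounded : (ℕ → ℕ) → Set
PolynomiallyBounded f = ∃[ C ] ∃[ c ] ∀ d → f d ≤ C * suc d ^ c

record SequencePair (σ : ℕ) : Set where
  field
    n       : ℕ
    nonZero : NonZero n
    x y     : Vec (Fin σ) n

sequenceProblem : ∀ σ → (SequencePair σ → ℕ → Set) → Problem
sequenceProblem σ Answer = record
  { Instance  = SequencePair σ
  ; size      = n
  ; registers = λ I → n I ∷ []
  ; memory    = λ I → toList (map toℕ (x I)) ++ toList (map toℕ (y I))
  ; Answer    = Answer
  }
  where open SequencePair

IsLCS : {A : Set} → List A → List A → ℕ → Set
IsLCS x y ℓ =
  (∃[ z ] z ⊆ x × z ⊆ y × length z ≡ ℓ) ×
  (∀ z → z ⊆ x → z ⊆ y → length z ≤ ℓ)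

LCS : ℕ → Problem
LCS σ = sequenceProblem σ λ I → IsLCS (toList (x I)) (toList (y I))
  where open SequencePair

dist : ∀ {σ} → Fin σ → Fin σ → ℕ
dist s t = if does (s Fin.≟ t) then 0 else 1

data Move {m n : ℕ} : Fin m × Fin n → Fin m × Fin n → Set where
  left  : ∀ {i i′ j} → toℕ i′ ≡ suc (toℕ i) → Move (i , j) (i′ , j)
  right : ∀ {i j j′} → toℕ j′ ≡ suc (toℕ j) → Move (i , j) (i , j′)
  both  : ∀ {i i′ j j′} → toℕ i′ ≡ suc (toℕ i) → toℕ j′ ≡ suc (toℕ j) →
          Move (i , j) (i′ , j′)

-- Partial traversals, indexed by the current markers and the cost so far.
data Reaches {σ m n} (x : Vec (Fin σ) m) (y : Vec (Fin σ) n) :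
             Fin m × Fin n → ℕ → Set where
  start : ∀ {i j} → toℕ i ≡ 0 → toℕ j ≡ 0 →
          Reaches x y (i , j) (dist (lookup x i) (lookup y j))
  step  : ∀ {p i j c} → Reaches x y p c → Move p (i , j) →
          Reaches x y (i , j) (c + dist (lookup x i) (lookup y j))

TraversalCost : ∀ {σ m n} → Vec (Fin σ) m → Vec (Fin σ) n → ℕ → Set
TraversalCost {m = m} {n} x y c =
  ∃[ i ] ∃[ j ] suc (toℕ i) ≡ m × suc (toℕ j) ≡ n × Reaches x y (i , j) c

IsDTWD : ∀ {σ m n} → Vec (Fin σ) m → Vec (Fin σ) n → ℕ → Set
IsDTWD x y c = TraversalCost x y c × (∀ c′ → TraversalCost x y c′ → c ≤ c′)

DTWD : ℕ → Problem
DTWD σ = sequenceProblem σ λ I → IsDTWD (x I) (y I)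
  where open SequencePair

SubquadraticTime : ∀ {σ} → ℚ → ℕ → SequencePair σ → ℕ → Set
SubquadraticTime ε C I t = t ≤ C · SequencePair.n I ^[2- ε ]

infix 7 _∙_

_∙_ : ∀ {d} → Vec (Fin 2) d → Vec (Fin 2) d → ℕ
a ∙ b = sum (zipWith (λ s t → toℕ s * toℕ t) a b)

record VectorSets : Set where
  field
    n d r    : ℕ
    nonZero  : NonZero n
    A B      : Vec (Vec (Fin 2) d) n
    A-unique : Unique A
    B-unique : Unique B

  HasPair : Set
  HasPair = ∃[ a ] ∃[ b ] a ∈ A × b ∈ B × a ∙ b ≤ r

MostOrthogonalVectors : Problem
MostOrthogonalVectors = record
  { Instance  = VectorSets
  ; size      = λ I → n I + d I
  ; registers = λ I → n I ∷ d I ∷ r I ∷ []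
  ; memory    = λ I → toList (map toℕ (concat (A I))) ++
                      toList (map toℕ (concat (B I)))
  ; Answer    = λ I v → (v ≡ 1 × HasPair I) ⊎ (v ≡ 0 × ¬ HasPair I)
  }
  where open VectorSets

LCS-Subquadratic : ℕ → ℚ → Set
LCS-Subquadratic σ ε = ∃[ C ] SolvableWithin (LCS σ) (SubquadraticTime ε C)

DTWD-Subquadratic : ℕ → ℚ → Set
DTWD-Subquadratic σ ε = ∃[ C ] SolvableWithin (DTWD σ) (SubquadraticTime ε C)

MostOrthogonalVectors-Subquadratic : ℚ → Set
MostOrthogonalVectors-Subquadratic ε =
  ∃[ poly ] PolynomiallyBounded poly × (∃[ C ]
    SolvableWithin MostOrthogonalVectors
      (λ I t → t ≤ C * poly (VectorSets.d I) · VectorSets.n I ^[2- ε ]))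

{-# OPTIONS --safe #-}

-- Every coordinate of a vector becomes four bits, in such a way that the codes of
-- a and b have Hamming distance d + 2 (a ∙ b), and the bits of a code are spelled
-- out with long runs α … α β … β between them.  The runs force an optimal common
-- subsequence, or an optimal traversal, of two codes to match the k-th bit with the
-- k-th bit, so that its value is an affine function of the Hamming distance.
--
-- The codes of A, and those of B, are concatenated with runs of a symbol # between
-- them, each run at least twice as long as a block.  Matching a block across a whole
-- run costs more than it can gain, so only the values of pairs of blocks count.
-- For LCS a block of x is ^ … ^ followed by a code and a block of y a code followed
-- by ^ … ^.  Every pair of blocks then has at least the value E of the carets, and
-- more only if a ∙ b ≤ r.  The codes of A are repeated cyclically, so that for each
-- pair some shift matches all blocks of y and in particular this pair.
-- For DTWD the codes of A stand between copies of a code whose distance to every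
-- code of B is the least one exceeding the distance of the pairs with a ∙ b ≤ r.
--
-- The symbol at a given position is an arithmetic expression in n, d, r, the position
-- and the input cells, so a single loop writes the sequences, and the given algorithm
-- runs on them.  Their length is O(n d²), and for ε = a / b the exponent 2 - 1 / b is
-- achieved.
module Submission where

open import Defs
open import Data.Bool using (Bool; true; false; if_then_else_; T)
open import Data.Fin using (Fin; toℕ; fromℕ<)
import Data.Fin as Fin
open import Data.Fin.Properties using (toℕ<n; toℕ-fromℕ<; any?)
import Data.Integer as ℤ
open import Data.List using (List; []; _∷_; _++_; length; replicate; applyUpTo; drop)
open import Data.List.Properties
  using (length-++; length-replicate; length-applyUpTo; ++-assoc; ++-identityʳ; ∷-injective)
open import Data.List.Relation.Binary.Sublist.Propositional
  using (_⊆_; []; _∷_; _∷ʳ_; ⊆-refl; ⊆-trans; minimum)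
open import Data.List.Relation.Binary.Sublist.Propositional.Properties
  using (++⁺; ++⁺ˡ; ++⁺ʳ; length-mono-≤; All-resp-⊆; ∷ˡ⁻)
open import Data.List.Relation.Unary.All using (All; []; _∷_)
import Data.List.Relation.Unary.All as All
import Data.List.Relation.Unary.All.Properties as AllP
open import Data.Nat
open import Data.Nat.Coprimality using (1-coprimeTo)
open import Data.Nat.Divisibility using (divides)
open import Data.Nat.DivMod hiding (_mod_; _div_)
open import Data.Nat.Properties
open import Data.Nat.Tactic.RingSolver using (solve-∀)
open import Data.Product using (_×_; _,_; ∃-syntax; proj₁; proj₂)
open import Data.Rational as ℚ using (mkℚ; 0ℚ; ↥_)
open import Data.Sum using (_⊎_; inj₁; inj₂)
open import Data.Unit using (tt)
open import Data.Vec using (Vec; []; _∷_; lookup; toList; tabulate; map; concat)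
open import Data.Vec.Membership.Propositional.Properties using (∈-lookup)
open import Data.Vec.Properties using (length-toList; toList-++; map-++)
open import Data.Vec.Relation.Unary.Any using (here; index)
open import Data.Vec.Relation.Unary.Any.Properties using (lookup-index)
open import Function using (_∘_)
open import Relation.Binary.PropositionalEquality
open import Relation.Nullary using (Dec; ¬_; yes; no; contradiction)

-- Arithmetic expressions and their compilation

-- A sum over n pairs of blocks reveals a single good pair only if bad pairs cannot make up for it.
-- So a bad pair must do no better than E, while E must be available to every block of B. In LCS the
-- carets offer this alternative inside each block; DTWD has none there, and the tuned code, at the
-- same distance from all codes of B, takes their place.
--
-- Both problems ask for sequences of equal length. The sequence of A needs 3 n blocks to leave room
-- for every alignment, so that of B is padded with `#`; the padding also takes up the runs around
-- those blocks of A that remain without a partner.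
--
-- Instances with r ≥ d are answered at once, since a ∙ b ≤ d. In the others 0 < d, and there is a
-- vector with r + 1 ones, from which the tuned code is made.
--
-- The exponent 2 - 1 / b is never below 1, so the time for writing the sequences, linear in their
-- length, stays within the bound however large ε is. All intermediate numbers are polynomial in n +
-- d, and the constant k of the word size is chosen so large that none of them wraps.

update-same : ∀ f i v → (f [ i ↦ v ]) i ≡ v
update-same f i v with i ≡ᵇ i | ≡⇒≡ᵇ i i refl
... | true | _ = refl

update-other : ∀ f i v {j} → j ≢ i → (f [ i ↦ v ]) j ≡ f j
update-other f i v {j} j≢i with j ≡ᵇ i in eq
... | false = refl
... | true = contradiction (≡ᵇ⇒≡ j i (subst T (sym eq) tt)) j≢i

wrap-small : ∀ {w v} → v < 2 ^ w → wrap w v ≡ v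
wrap-small {w} v<2^w = m<n⇒m%n≡m {{m^n≢0 2 w}} v<2^w

data Arith : Set where
  plus times monus quot rem less same : Arith

arith : Arith → ℕ → ℕ → ℕ
arith plus  a b = a + b
arith times a b = a * b
arith monus a b = a ∸ b
arith quot  a b = ⟦ div ⟧ 0 a b
arith rem   a b = ⟦ mod ⟧ 0 a b
arith less  a b = bit (a <ᵇ b)
arith same  a b = bit (a ≡ᵇ b)

infixl 5 _‹_›_

-- The variables 0, 1, 2, 3 are n, d, r and a loop counter.
data Expr : Set where
  lit   : ℕ → Expr
  var   : Fin 4 → Expr
  _‹_›_ : Expr → Arith → Expr → Expr
  load  : Expr → Expr

Env : Set
Env = Vec ℕ 4

eval : Env → (ℕ → ℕ) → Expr → ℕ
eval ρ m (lit c)     = c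
eval ρ m (var v)     = lookup ρ v
eval ρ m (e ‹ o › f) = arith o (eval ρ m e) (eval ρ m f)
eval ρ m (load e)    = m (eval ρ m e)

-- A value computed by e from numbers below V is below V ^ deg e.
deg : Expr → ℕ
deg (lit c)     = suc c
deg (var v)     = 1
deg (e ‹ o › f) = deg e + deg f
deg (load e)    = suc (deg e)

deg>0 : ∀ e → 0 < deg e
deg>0 (lit c)     = z<s
deg>0 (var v)     = z<s
deg>0 (e ‹ o › f) = m≤n⇒m≤n+o (deg f) (deg>0 e)
deg>0 (load e)    = z<s

Bounded : ℕ → Env → (ℕ → ℕ) → Set
Bounded V ρ m = 2 ≤ V × (∀ v → lookup ρ v < V) × (∀ a → m a < V)

m≤m*n′ : ∀ m {n} → 1 ≤ n → m ≤ m * n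
m≤m*n′ m {suc n} _ = m≤m*n m (suc n)

m≤n*m′ : ∀ m {n} → 1 ≤ n → m ≤ n * m
m≤n*m′ m {suc n} _ = m≤n*m m (suc n)

m+n≤m*n : ∀ {m n} → 2 ≤ m → 2 ≤ n → m + n ≤ m * n
m+n≤m*n {suc (suc m)} {suc (suc n)} (s≤s (s≤s _)) (s≤s (s≤s _)) =
  subst (2 + m + (2 + n) ≤_) (lemma m n) (m≤m+n _ _)
  where
  lemma : ∀ m n → 2 + m + (2 + n) + (m + n + m * n) ≡ (2 + m) * (2 + n)
  lemma = solve-∀

bit≤1 : ∀ b → bit b ≤ 1
bit≤1 true  = ≤-refl
bit≤1 false = z≤n

arith-< : ∀ o {a b P Q} → 2 ≤ P → 2 ≤ Q → a < P → b < Q → arith o a b < P * Q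
arith-< plus  2≤P 2≤Q a<P b<Q = <-≤-trans (+-mono-< a<P b<Q) (m+n≤m*n 2≤P 2≤Q)
arith-< times 2≤P 2≤Q a<P b<Q = *-mono-< a<P b<Q
arith-< monus {a} {b} {P} 2≤P 2≤Q a<P b<Q =
  ≤-<-trans (m∸n≤m a b) (<-≤-trans a<P (m≤m*n′ P (<⇒≤ 2≤Q)))
arith-< quot {a} {zero} 2≤P 2≤Q a<P b<Q = *-mono-< (<⇒≤ 2≤P) (<⇒≤ 2≤Q)
arith-< quot {a} {suc b} {P} 2≤P 2≤Q a<P b<Q =
  ≤-<-trans (m/n≤m a (suc b)) (<-≤-trans a<P (m≤m*n′ P (<⇒≤ 2≤Q)))
arith-< rem {a} {zero} 2≤P 2≤Q a<P b<Q = *-mono-< (<⇒≤ 2≤P) (<⇒≤ 2≤Q)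
arith-< rem {a} {suc b} {P} 2≤P 2≤Q a<P b<Q =
  ≤-<-trans (m%n≤m a (suc b)) (<-≤-trans a<P (m≤m*n′ P (<⇒≤ 2≤Q)))
arith-< less {a} {b} 2≤P 2≤Q a<P b<Q = ≤-<-trans (bit≤1 (a <ᵇ b)) (*-mono-≤ 2≤P (<⇒≤ 2≤Q))
arith-< same {a} {b} 2≤P 2≤Q a<P b<Q = ≤-<-trans (bit≤1 (a ≡ᵇ b)) (*-mono-≤ 2≤P (<⇒≤ 2≤Q))

n<m^1+n : ∀ {m} n → 2 ≤ m → n < m ^ suc n
n<m^1+n {m} zero    2≤m = subst (0 <_) (sym (*-identityʳ m)) (<⇒≤ 2≤m)
n<m^1+n {m} (suc n) 2≤m = begin-strict
  suc n               ≤⟨ n<m^1+n n 2≤m ⟩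
  m ^ suc n           <⟨ m<n+m (m ^ suc n) (≤-trans (s≤s z≤n) (n<m^1+n n 2≤m)) ⟩
  m ^ suc n + m ^ suc n ≡⟨ cong (m ^ suc n +_) (+-identityʳ _) ⟨
  2 * m ^ suc n       ≤⟨ *-monoˡ-≤ (m ^ suc n) 2≤m ⟩
  m * m ^ suc n       ∎
  where open ≤-Reasoning

2≤m^n : ∀ {m n} → 2 ≤ m → 0 < n → 2 ≤ m ^ n
2≤m^n {m} {suc n} 2≤m _ = ≤-trans (s≤s (s≤s z≤n)) (≤-trans 2≤m (m≤m*n′ m (m^n>0 m {{>-nonZero (<⇒≤ 2≤m)}} n)))

eval-< : ∀ {V ρ m} → Bounded V ρ m → ∀ e → eval ρ m e < V ^ deg e
eval-< (2≤V , _ , _) (lit c) = n<m^1+n c 2≤V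
eval-< {V} (_ , ρ<V , _) (var v) = subst (_ <_) (sym (*-identityʳ V)) (ρ<V v)
eval-< {V} {ρ} {m} bd@(2≤V , _ , _) (e ‹ o › f) =
  subst (eval ρ m (e ‹ o › f) <_) (sym (^-distribˡ-+-* V (deg e) (deg f)))
    (arith-< o (2≤m^n 2≤V (deg>0 e)) (2≤m^n 2≤V (deg>0 f)) (eval-< bd e) (eval-< bd f))
eval-< {V} (2≤V , _ , m<V) (load e) =
  <-≤-trans (m<V _) (m≤m*n′ V (m^n>0 V {{>-nonZero (<⇒≤ 2≤V)}} (deg e)))

^-mono : ∀ {V i j} → 2 ≤ V → i ≤ j → V ^ i ≤ V ^ j
^-mono {V} 2≤V = ^-monoʳ-≤ V {{>-nonZero (<⇒≤ 2≤V)}}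

-- Registers are used like a stack: a computation with target x may overwrite x and everything above
-- it, but nothing below. A left operand at x therefore survives the evaluation of the right one at
-- `suc x`.
record Sets (w : ℕ) (p : Program) (s : State) (t : ℕ) (x : Reg) (v : ℕ) : Set where
  constructor sets
  field
    {out} : State
    run   : w ⊢ p , s ⇓ t , out
    hit   : reg out x ≡ v
    below : ∀ {y} → y < x → reg out y ≡ reg s y
    memory≡ : mem out ≡ mem s

-- `sub` works modulo 2 ^ w, so truncated subtraction multiplies the wrapped difference by the flag
-- b < a, which is computed beforehand in `2 + x`.
arithCode : Arith → Reg → Program
arithCode plus  x = x ≔ x ⟨ add ⟩ suc x
arithCode times x = x ≔ x ⟨ mul ⟩ suc x
arithCode monus x =
  ((2 + x) ≔ suc x ⟨ lt ⟩ x) ⨾ (x ≔ x ⟨ sub ⟩ suc x) ⨾ (x ≔ x ⟨ mul ⟩ (2 + x))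
arithCode quot  x = x ≔ x ⟨ div ⟩ suc x
arithCode rem   x = x ≔ x ⟨ mod ⟩ suc x
arithCode less  x = x ≔ x ⟨ lt ⟩ suc x
arithCode same  x = x ≔ x ⟨ eq ⟩ suc x

arithTime : Arith → ℕ
arithTime monus = 3
arithTime _     = 1

setOp : ∀ {w s x y o z v} → ⟦ o ⟧ w (reg s y) (reg s z) ≡ v → v < 2 ^ w →
        Sets w (x ≔ y ⟨ o ⟩ z) s 1 x v
setOp {w} {s} {x} {y} {o} {z} refl v<2^w =
  sets ⇓op (trans (update-same (reg s) x _) (wrap-small {w} v<2^w))
    (λ y<x → update-other (reg s) x _ (<⇒≢ y<x)) refl

monus-value : ∀ w {a b} → a < 2 ^ w → b < 2 ^ w →
  wrap w (a + (2 ^ w ∸ b)) * bit (b <ᵇ a) ≡ a ∸ b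
monus-value w {a} {b} a<2^w b<2^w with b <ᵇ a in eq
... | false = trans (*-zeroʳ (wrap w (a + (2 ^ w ∸ b)))) (sym (m≤n⇒m∸n≡0 (≮⇒≥ {b} {a} (λ b<a → subst T eq (<⇒<ᵇ b<a)))))
... | true  = begin
  wrap w (a + (2 ^ w ∸ b)) * 1 ≡⟨ *-identityʳ _ ⟩
  wrap w (a + (2 ^ w ∸ b))     ≡⟨ cong (wrap w) lemma ⟩
  wrap w (a ∸ b + 2 ^ w)       ≡⟨ [m+n]%n≡m%n (a ∸ b) (2 ^ w) {{m^n≢0 2 w}} ⟩
  wrap w (a ∸ b)               ≡⟨ wrap-small {w} (≤-<-trans (m∸n≤m a b) a<2^w) ⟩
  a ∸ b                        ∎
  where
  open ≡-Reasoning
  b≤a : b ≤ a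
  b≤a = <⇒≤ (<ᵇ⇒< b a (subst T (sym eq) tt))
  lemma : a + (2 ^ w ∸ b) ≡ a ∸ b + 2 ^ w
  lemma = begin
    a + (2 ^ w ∸ b)           ≡⟨ cong (_+ (2 ^ w ∸ b)) (m∸n+n≡m b≤a) ⟨
    a ∸ b + b + (2 ^ w ∸ b)   ≡⟨ +-assoc (a ∸ b) b _ ⟩
    a ∸ b + (b + (2 ^ w ∸ b)) ≡⟨ cong (a ∸ b +_) (m+[n∸m]≡n (<⇒≤ b<2^w)) ⟩
    a ∸ b + 2 ^ w             ∎

x≢1+x : ∀ x → x ≢ suc x
x≢1+x x = <⇒≢ (n<1+n x)

x≢2+x : ∀ x → x ≢ 2 + x
x≢2+x x = <⇒≢ (m≤n⇒m≤1+n (n<1+n x))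

arithCode-sets : ∀ o {w s x a b} → reg s x ≡ a → reg s (suc x) ≡ b →
  a < 2 ^ w → b < 2 ^ w → arith o a b < 2 ^ w →
  Sets w (arithCode o x) s (arithTime o) x (arith o a b)
arithCode-sets plus  refl refl _ _ v< = setOp {o = add} refl v<
arithCode-sets times refl refl _ _ v< = setOp {o = mul} refl v<
arithCode-sets quot {w} {s} {x} refl refl _ _ v< = setOp {o = div} (agree (reg s (suc x))) v<
  where
  agree : ∀ b → ⟦ div ⟧ w (reg s x) b ≡ ⟦ div ⟧ 0 (reg s x) b
  agree zero    = refl
  agree (suc _) = refl
arithCode-sets rem {w} {s} {x} refl refl _ _ v< = setOp {o = mod} (agree (reg s (suc x))) v<
  where
  agree : ∀ b → ⟦ mod ⟧ w (reg s x) b ≡ ⟦ mod ⟧ 0 (reg s x) b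
  agree zero    = refl
  agree (suc _) = refl
arithCode-sets less refl refl _ _ v< = setOp {o = lt} refl v<
arithCode-sets same refl refl _ _ v< = setOp {o = eq} refl v<
arithCode-sets monus {w} {s} {x} {a} {b} refl refl a<2^w b<2^w v< =
  sets (⇓seq ⇓op (⇓seq ⇓op ⇓op)) value
    (λ {y} y<x → trans (update-other r₂ x _ (<⇒≢ y<x))
      (trans (update-other r₁ x _ (<⇒≢ y<x))
        (update-other (reg s) (2 + x) _ (<⇒≢ (m≤n⇒m≤1+n (m≤n⇒m≤1+n y<x))))))
    refl
  where
  c : ℕ
  c = wrap w (bit (b <ᵇ a))
  r₁ r₂ : Reg → ℕ
  r₁ = reg s [ 2 + x ↦ c ]
  r₂ = r₁ [ x ↦ wrap w (r₁ x + (2 ^ w ∸ r₁ (suc x))) ]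
  c≡ : c ≡ bit (b <ᵇ a)
  c≡ with b <ᵇ a in eq
  ... | false = wrap-small {w} (m^n>0 2 w)
  ... | true  = wrap-small {w} (≤-<-trans (≤-trans (s≤s z≤n) (<ᵇ⇒< b a (subst T (sym eq) tt))) a<2^w)
  r₁x : r₁ x ≡ a
  r₁x = update-other (reg s) (2 + x) c (x≢2+x x)
  r₁1+x : r₁ (suc x) ≡ b
  r₁1+x = update-other (reg s) (2 + x) c (x≢1+x (suc x))
  product : r₂ x * r₂ (2 + x) ≡ a ∸ b
  product = trans (cong₂ _*_
    (trans (update-same r₁ x _) (cong₂ (λ u v → wrap w (u + (2 ^ w ∸ v))) r₁x r₁1+x))
    (trans (update-other r₁ x _ (x≢2+x x ∘ sym)) (trans (update-same (reg s) (2 + x) c) c≡)))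
    (monus-value w a<2^w b<2^w)
  value : (r₂ [ x ↦ wrap w (r₂ x * r₂ (2 + x)) ]) x ≡ a ∸ b
  value = trans (update-same r₂ x _) (trans (cong (wrap w) product) (wrap-small {w} v<))

code : Reg → Expr → Reg → Program
code base (lit c)     x = x ≔ c
-- Copying a register is done by adding it to a cleared one.
code base (var v)     x = (x ≔ 0) ⨾ (x ≔ x ⟨ add ⟩ (base + toℕ v))
code base (e ‹ o › f) x = code base e x ⨾ code base f (suc x) ⨾ arithCode o x
code base (load e)    x = code base e x ⨾ (x ≔[ x ])

time : Expr → ℕ
time (lit c)     = 1
time (var v)     = 2
time (e ‹ o › f) = time e + (time f + arithTime o)
time (load e)    = time e + 1

Holds : Reg → Env → State → Set
Holds base ρ s = ∀ v → reg s (base + toℕ v) ≡ lookup ρ v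

var<  : ∀ {base x} → base + 4 ≤ x → (v : Fin 4) → base + toℕ v < x
var< {base} b+4≤x v = <-≤-trans (+-monoʳ-< base (toℕ<n v)) b+4≤x

holds-below : ∀ {base ρ s x s′} → base + 4 ≤ x → (∀ {y} → y < x → reg s′ y ≡ reg s y) →
  Holds base ρ s → Holds base ρ s′
holds-below b≤x kept h v = trans (kept (var< b≤x v)) (h v)

-- The degree of an expression dominates those of its subexpressions, addresses of loads included.
-- The single hypothesis `V ^ deg e ≤ 2 ^ w` thus excludes wrapping in every intermediate result.
code-sets : ∀ {w base V ρ} e {s x} → Bounded V ρ (mem s) → Holds base ρ s →
  base + 4 ≤ x → V ^ deg e ≤ 2 ^ w →
  Sets w (code base e x) s (time e) x (eval ρ (mem s) e)
code-sets {w} {V = V} (lit c) {s} {x} bd h b≤x V≤ =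
  sets ⇓const (trans (update-same (reg s) x _) (wrap-small {w} (<-≤-trans (n<m^1+n c (proj₁ bd)) V≤)))
    (λ y<x → update-other (reg s) x _ (<⇒≢ y<x)) refl
code-sets {w} {base} {V} {ρ} (var v) {s} {x} bd h b≤x V≤ =
  sets (⇓seq ⇓const ⇓op)
    (trans (update-same r₁ x _) (trans (cong (wrap w) value) (wrap-small {w} (<-≤-trans (eval-< {ρ = ρ} bd (var v)) V≤))))
    (λ y<x → trans (update-other r₁ x _ (<⇒≢ y<x)) (update-other (reg s) x _ (<⇒≢ y<x))) refl
  where
  r₁ : Reg → ℕ
  r₁ = reg s [ x ↦ wrap w 0 ]
  value : r₁ x + r₁ (base + toℕ v) ≡ lookup ρ v
  value = cong₂ _+_ (trans (update-same (reg s) x _) (wrap-small {w} (m^n>0 2 w)))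
    (trans (update-other (reg s) x _ (<⇒≢ (var< b≤x v))) (h v))
code-sets {w} {base} {V} {ρ} (e ‹ o › f) {s} {x} bd@(2≤V , _ , _) h b≤x V≤
  with code-sets {w} {base} {V} {ρ} e {s} {x} bd h b≤x
         (≤-trans (^-mono 2≤V (m≤m+n (deg e) (deg f))) V≤)
... | sets {s₁} run₁ hit₁ below₁ refl
  with code-sets {w} {base} {V} {ρ} f {s₁} {suc x} bd
         (holds-below {base} {ρ} {s} {x} {s₁} b≤x below₁ h) (m≤n⇒m≤1+n b≤x)
         (≤-trans (^-mono 2≤V (m≤n+m (deg f) (deg e))) V≤)
... | sets {s₂} run₂ hit₂ below₂ refl
  with arithCode-sets o {w} {s₂} {x} (trans (below₂ (n<1+n x)) hit₁) hit₂
         (<-≤-trans (eval-< {ρ = ρ} bd e) (≤-trans (^-mono 2≤V (m≤m+n (deg e) (deg f))) V≤))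
         (<-≤-trans (eval-< {ρ = ρ} bd f) (≤-trans (^-mono 2≤V (m≤n+m (deg f) (deg e))) V≤))
         (<-≤-trans (eval-< {ρ = ρ} bd (e ‹ o › f)) V≤)
... | sets run₃ hit₃ below₃ m₃ =
  sets (⇓seq run₁ (⇓seq run₂ run₃)) hit₃
    (λ y<x → trans (below₃ y<x) (trans (below₂ (m≤n⇒m≤1+n y<x)) (below₁ y<x))) m₃
code-sets {w} {base} {V} {ρ} (load e) {s} {x} bd@(2≤V , _ , _) h b≤x V≤
  with code-sets {w} {base} {V} {ρ} e {s} {x} bd h b≤x
         (≤-trans (^-mono 2≤V (n≤1+n (deg e))) V≤)
... | sets {s₁} run₁ hit₁ below₁ refl =
  sets (⇓seq run₁ ⇓load) (trans (update-same (reg s₁) x _) (cong (mem s₁) hit₁))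
    (λ y<x → trans (update-other (reg s₁) x _ (<⇒≢ y<x)) (below₁ y<x)) refl

-- Filling an interval of the memory

<ᵇ-true : ∀ {m n} → m < n → (m <ᵇ n) ≡ true
<ᵇ-true {m} {n} m<n with m <ᵇ n | <⇒<ᵇ m<n
... | true | _ = refl

<ᵇ-false : ∀ {m n} → n ≤ m → (m <ᵇ n) ≡ false
<ᵇ-false {m} {n} n≤m with m <ᵇ n in eq
... | false = refl
... | true  = contradiction n≤m (<⇒≱ (<ᵇ⇒< m n (subst T (sym eq) tt)))

env : ℕ → ℕ → ℕ → ℕ → Env
env n d r i = n ∷ d ∷ r ∷ i ∷ []

counter : Expr
counter = var (Fin.suc (Fin.suc (Fin.suc Fin.zero)))

-- The variables n, d, r and the counter occupy `base` to `3 + base`. Once the store is done,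
-- `5 + base` is reused for the increment 1 and `4 + base` for the loop flag.
fillBody : Reg → Expr → Expr → Expr → Program
fillBody base cnt addr val =
  code base addr (4 + base) ⨾ code base val (5 + base) ⨾ ([ (4 + base) ]≔ (5 + base)) ⨾
  ((5 + base) ≔ 1) ⨾ ((3 + base) ≔ (3 + base) ⟨ add ⟩ (5 + base)) ⨾
  code base (counter ‹ less › cnt) (4 + base)

fill : Reg → Expr → Expr → Expr → Program
fill base cnt addr val =
  ((3 + base) ≔ 0) ⨾ code base (counter ‹ less › cnt) (4 + base) ⨾
  (while (4 + base) loop fillBody base cnt addr val)

bodyTime : Expr → Expr → Expr → ℕ
bodyTime cnt addr val =
  time addr + (time val + (1 + (1 + (1 + time (counter ‹ less › cnt)))))

fillTime : Expr → Expr → Expr → ℕ → ℕ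
fillTime cnt addr val c =
  1 + (time (counter ‹ less › cnt) + (c * suc (bodyTime cnt addr val) + 1))

Outside : ℕ → ℕ → ℕ → Set
Outside b c a = ∀ k → k < c → a ≢ b + k

record Filled (base n d r b : ℕ) (v : ℕ → ℕ) (s₀ : State) (i : ℕ) (s : State) : Set where
  field
    holds   : Holds base (env n d r i) s
    frame   : ∀ {y} → y < base → reg s y ≡ reg s₀ y
    outside : ∀ a → Outside b i a → mem s a ≡ mem s₀ a
    inside  : ∀ k → k < i → mem s (b + k) ≡ v k

filled-< : ∀ {base n d r b v s₀ i s V} → Filled base n d r b v s₀ i s → (∀ a → mem s₀ a < V) →
  (∀ k → k < i → v k < V) → ∀ a → mem s a < V
filled-< {b = b} {i = i} {s} {V} F m<V v<V a with b ≤? a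
... | no b≰a = subst (_< V) (sym (Filled.outside F a (λ { k _ refl → b≰a (m≤m+n b k) }))) (m<V a)
... | yes b≤a with (a ∸ b) <? i
... | yes k<i = subst (λ z → mem s z < V) (m+[n∸m]≡n b≤a) (subst (_< V) (sym (Filled.inside F _ k<i)) (v<V _ k<i))
... | no k≮i = subst (_< V)
  (sym (Filled.outside F a (λ { k k<i refl → k≮i (subst (_< i) (sym (m+n∸m≡n b k)) k<i) }))) (m<V a)

env-< : ∀ {V n d r i} → n < V → d < V → r < V → i < V → ∀ v → lookup (env n d r i) v < V
env-< n< d< r< i< Fin.zero = n<
env-< n< d< r< i< (Fin.suc Fin.zero) = d<
env-< n< d< r< i< (Fin.suc (Fin.suc Fin.zero)) = r<
env-< n< d< r< i< (Fin.suc (Fin.suc (Fin.suc Fin.zero))) = i<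

b+4≤ : ∀ base → base + 4 ≤ 4 + base
b+4≤ base = ≤-reflexive (+-comm base 4)

holds-with : ∀ {base n d r i j s s′} → (∀ {y} → y < 3 + base → reg s′ y ≡ reg s y) → reg s′ (3 + base) ≡ i →
  Holds base (env n d r j) s → Holds base (env n d r i) s′
holds-with {base} kept counter≡ h Fin.zero =
  trans (kept (subst (_< 3 + base) (sym (+-identityʳ base)) (m≤n+m (suc base) 2))) (h Fin.zero)
holds-with {base} kept counter≡ h (Fin.suc Fin.zero) =
  trans (kept (subst (_< 3 + base) (+-comm 1 base) (m≤n+m (2 + base) 1))) (h (Fin.suc Fin.zero))
holds-with {base} kept counter≡ h (Fin.suc (Fin.suc Fin.zero)) =
  trans (kept (subst (_< 3 + base) (+-comm 2 base) ≤-refl)) (h (Fin.suc (Fin.suc Fin.zero)))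
holds-with {base} {s′ = s′} kept counter≡ h (Fin.suc (Fin.suc (Fin.suc Fin.zero))) =
  trans (cong (reg s′) (+-comm base 3)) counter≡

-- The memory changes during the loop, so `val≡` speaks of every memory that agrees with the initial
-- one outside the target interval: `val` may read anything except the cells being written.
module Fill
  {w base V n d r c b : ℕ} {cnt addr val : Expr} {v : ℕ → ℕ} {s₀ : State}
  (2≤V : 2 ≤ V) (n<V : n < V) (d<V : d < V) (r<V : r < V) (c<V : c < V)
  (v<V : ∀ i → i < c → v i < V) (m<V : ∀ a → mem s₀ a < V)
  (cond≤ : V ^ deg (counter ‹ less › cnt) ≤ 2 ^ w)
  (addr≤ : V ^ deg addr ≤ 2 ^ w) (val≤ : V ^ deg val ≤ 2 ^ w)
  (cnt≡ : ∀ i m → eval (env n d r i) m cnt ≡ c)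
  (addr≡ : ∀ i m → eval (env n d r i) m addr ≡ b + i)
  (val≡ : ∀ m → (∀ a → Outside b c a → m a ≡ mem s₀ a) →
          ∀ i → i < c → eval (env n d r i) m val ≡ v i)
  where

  cond : Expr
  cond = counter ‹ less › cnt

  Partial : ℕ → State → Set
  Partial = Filled base n d r b v s₀

  env<V : ∀ {i} → i ≤ c → ∀ v → lookup (env n d r i) v < V
  env<V i≤c = env-< n<V d<V r<V (≤-<-trans i≤c c<V)

  mem<V : ∀ {i s} → i ≤ c → Partial i s → ∀ a → mem s a < V
  mem<V i≤c P = filled-< P m<V (λ k k<i → v<V k (<-≤-trans k<i i≤c))

  module Step {i s s₂} (i<c : i < c) (P : Partial i s)
    (a≡ : reg s₂ (4 + base) ≡ b + i) (v≡ : reg s₂ (5 + base) ≡ v i)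
    (kept : ∀ {y} → y < 4 + base → y ≢ 4 + base → reg s₂ y ≡ reg s y)
    (mem≡ : mem s₂ ≡ mem s) where
    open Filled P

    m₃ : ℕ → ℕ
    m₃ = mem s₂ [ reg s₂ (4 + base) ↦ reg s₂ (5 + base) ]

    outside₃ : ∀ a → Outside b (suc i) a → m₃ a ≡ mem s₀ a
    outside₃ a o = trans (update-other (mem s₂) _ _ (λ a≡′ → o i ≤-refl (trans a≡′ a≡)))
      (trans (cong (λ m → m a) mem≡) (outside a (λ k k<i → o k (m≤n⇒m≤1+n k<i))))

    inside₃ : ∀ k → k < suc i → m₃ (b + k) ≡ v k
    inside₃ k k<1+i with k ≟ i
    ... | yes refl = trans (trans (cong m₃ (sym a≡)) (update-same (mem s₂) (reg s₂ (4 + base)) _)) v≡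
    ... | no k≢i = trans (update-other (mem s₂) _ _ (λ b+k≡ → k≢i (+-cancelˡ-≡ b k i (trans b+k≡ a≡))))
                     (trans (cong (λ m → m (b + k)) mem≡) (inside k (≤∧≢⇒< (s≤s⁻¹ k<1+i) k≢i)))

    s₃ s₄ : State
    s₃ = ⟪ reg s₂ [ 5 + base ↦ wrap w 1 ] , m₃ ⟫
    s₄ = ⟪ reg s₃ [ 3 + base ↦ wrap w (reg s₃ (3 + base) + reg s₃ (5 + base)) ] , m₃ ⟫

    old : ∀ {y} → y < 4 + base → reg s₃ y ≡ reg s y
    old y< = trans (update-other (reg s₂) (5 + base) _ (<⇒≢ (m≤n⇒m≤1+n y<)))
      (kept y< (<⇒≢ y<))

    old₄ : ∀ {y} → y < 3 + base → reg s₄ y ≡ reg s y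
    old₄ y< = trans (update-other (reg s₃) (3 + base) _ (<⇒≢ y<)) (old (m≤n⇒m≤1+n y<))

    1<2^w : 1 < 2 ^ w
    1<2^w = ≤-trans (2≤m^n 2≤V (deg>0 cond)) cond≤

    i+1 : reg s₃ (3 + base) + reg s₃ (5 + base) ≡ suc i
    i+1 = trans (cong₂ _+_ (trans (old ≤-refl) (trans (cong (reg s) (+-comm 3 base)) (holds (Fin.suc (Fin.suc (Fin.suc Fin.zero))))))
                  (trans (update-same (reg s₂) (5 + base) _) (wrap-small {w} 1<2^w)))
                (+-comm i 1)

    1+i<2^w : suc i < 2 ^ w
    1+i<2^w = ≤-<-trans i<c (<-≤-trans c<V (≤-trans (≤-trans (≤-reflexive (sym (*-identityʳ V)))
        (^-mono 2≤V (deg>0 cond))) cond≤))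

    holds₄ : Holds base (env n d r (suc i)) s₄
    holds₄ = holds-with {base} {n} {d} {r} {suc i} {i} {s} {s₄} old₄
      (trans (update-same (reg s₃) (3 + base) _) (trans (cong (wrap w) i+1) (wrap-small {w} 1+i<2^w))) holds

    filled : Partial (suc i) s₄
    filled = record
      { holds = holds₄
      ; frame = λ y<base → trans (old₄ (m≤n⇒m≤o+n 3 y<base)) (frame y<base)
      ; outside = outside₃
      ; inside = inside₃
      }

    after : Sets w (code base cond (4 + base)) s₄ (time cond) (4 + base) (bit (suc i <ᵇ c))
    after with code-sets {w} {base} {V} {env n d r (suc i)} cond {s₄} {4 + base}
           (2≤V , env<V i<c , filled-< filled m<V (λ k k< → v<V k (<-≤-trans k< i<c))) holds₄ (b+4≤ base) cond≤
    ... | sets run hit below m≡ = sets run (trans hit (cong (λ z → bit (suc i <ᵇ z)) (cnt≡ (suc i) _))) below m≡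

    end : State
    end = Sets.out after

    advance : ∃[ s′ ] (w ⊢ ([ (4 + base) ]≔ (5 + base)) ⨾ ((5 + base) ≔ 1) ⨾
                         ((3 + base) ≔ (3 + base) ⟨ add ⟩ (5 + base)) ⨾ code base cond (4 + base) , s₂
                         ⇓ 1 + (1 + (1 + time cond)) , s′) ×
              Partial (suc i) s′ × reg s′ (4 + base) ≡ bit (suc i <ᵇ c)
    advance with after
    ... | sets {s₅} run₅ hit₅ below₅ refl =
      s₅ , ⇓seq ⇓store (⇓seq ⇓const (⇓seq ⇓op run₅)) , record
        { holds = holds-below {base} {env n d r (suc i)} {s₄} {4 + base} {s₅} (b+4≤ base) below₅ holds₄
        ; frame = λ y<base → trans (below₅ (m≤n⇒m≤o+n 4 y<base)) (trans (old₄ (m≤n⇒m≤o+n 3 y<base)) (frame y<base))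
        ; outside = outside₃
        ; inside = inside₃
        } , hit₅

  body-run : ∀ {i s} → i < c → Partial i s →
    ∃[ s′ ] (w ⊢ fillBody base cnt addr val , s ⇓ bodyTime cnt addr val , s′) ×
            Partial (suc i) s′ × reg s′ (4 + base) ≡ bit (suc i <ᵇ c)
  body-run {i} {s} i<c P
    with code-sets {w} {base} {V} {env n d r i} addr {s} {4 + base}
           (2≤V , env<V (<⇒≤ i<c) , mem<V (<⇒≤ i<c) P)
           (Filled.holds P) (b+4≤ base) addr≤
  ... | sets {s₁} run₁ hit₁ below₁ refl
    with code-sets {w} {base} {V} {env n d r i} val {s₁} {5 + base}
           (2≤V , env<V (<⇒≤ i<c) , mem<V (<⇒≤ i<c) P)
           (holds-below {base} {env n d r i} {s} {4 + base} {s₁} (b+4≤ base) below₁ (Filled.holds P))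
           (m≤n⇒m≤1+n (b+4≤ base)) val≤
  ... | sets {s₂} run₂ hit₂ below₂ refl
    with Step.advance {i} {s} {s₂} i<c P
           (trans (below₂ ≤-refl) (trans hit₁ (addr≡ i _)))
           (trans hit₂ (val≡ (mem s) (λ a o → Filled.outside P a (λ k k<i → o k (<-trans k<i i<c))) i i<c))
           (λ y< _ → trans (below₂ (m≤n⇒m≤1+n y<)) (below₁ y<)) refl
  ... | s′ , run₃ , P′ , hit′ = s′ , ⇓seq run₁ (⇓seq run₂ run₃) , P′ , hit′

  iterate : ∀ k {i s} → i + k ≡ c → Partial i s → reg s (4 + base) ≡ bit (i <ᵇ c) →
    ∃[ s′ ] (w ⊢ while (4 + base) loop fillBody base cnt addr val , s
               ⇓ k * suc (bodyTime cnt addr val) + 1 , s′) × Partial c s′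
  iterate zero {i} {s} i+0≡c P flag =
    s , ⇓stop (trans flag (cong bit (<ᵇ-false (≤-reflexive (sym i≡c))))) , subst (λ i → Partial i s) i≡c P
    where
    i≡c : i ≡ c
    i≡c = trans (sym (+-identityʳ i)) i+0≡c
  iterate (suc k) {i} {s} i+1+k≡c P flag with body-run i<c P
    where
    i<c : i < c
    i<c = subst (i <_) i+1+k≡c (m<m+n i z<s)
  ... | s₁ , run₁ , P₁ , flag₁ with iterate k (trans (sym (+-suc i k)) i+1+k≡c) P₁ flag₁
  ... | s₂ , run₂ , P₂ =
    s₂ , subst (λ t → w ⊢ while (4 + base) loop fillBody base cnt addr val , s ⇓ t , s₂) (cong suc (sym (+-assoc (bodyTime cnt addr val) _ 1)))
           (⇓loop (λ z → 0≢1+n (trans (sym z) (trans flag (cong bit (<ᵇ-true (subst (i <_) i+1+k≡c (m<m+n i z<s))))))) run₁ run₂) , P₂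

  reset : State
  reset = ⟪ reg s₀ [ 3 + base ↦ wrap w 0 ] , mem s₀ ⟫

  reset-holds : ∀ {i} → Holds base (env n d r i) s₀ → Holds base (env n d r 0) reset
  reset-holds {i} = holds-with {base} {n} {d} {r} {0} {i} {s₀} {reset}
    (λ y< → update-other (reg s₀) (3 + base) _ (<⇒≢ y<))
    (trans (update-same (reg s₀) (3 + base) (wrap w 0)) (wrap-small {w} (m^n>0 2 w)))

  fill-run : ∀ {i} → Holds base (env n d r i) s₀ →
    ∃[ s′ ] (w ⊢ fill base cnt addr val , s₀ ⇓ fillTime cnt addr val c , s′) × Partial c s′
  fill-run {i} h
    with code-sets {w} {base} {V} {env n d r 0} cond {reset} {4 + base}
           (2≤V , env<V z≤n , m<V) (reset-holds {i} h) (b+4≤ base) cond≤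
  ... | sets {s₂} run₂ hit₂ below₂ refl
    with iterate c {0} {s₂} refl (record
           { holds = holds-below {base} {env n d r 0} {reset} {4 + base} {s₂} (b+4≤ base) below₂ (reset-holds {i} h)
           ; frame = λ y<base → trans (below₂ (m≤n⇒m≤o+n 4 y<base))
                                  (update-other (reg s₀) (3 + base) _ (<⇒≢ (m≤n⇒m≤o+n 3 y<base)))
           ; outside = λ _ _ → refl
           ; inside = λ _ ()
           }) (trans hit₂ (cong (λ z → bit (0 <ᵇ z)) (cnt≡ 0 _)))
  ... | s₃ , run₃ , P₃ = s₃ , ⇓seq ⇓const (⇓seq run₂ run₃) , P₃

-- Running the given algorithm on a transformed input

-- p only mentions registers below width p.
width : Program → ℕ
width skip                     = 0
width (x ≔ v)                  = suc x
width (x ≔ y ⟨ o ⟩ z)          = suc (x + (y + z))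
width (x ≔[ y ])               = suc (x + y)
width ([ x ]≔ y)               = suc (x + y)
width (p ⨾ q)                  = width p + width q
width (when x then p else q)   = suc x + (width p + width q)
width (while x loop p)         = suc x + width p

Agree : Reg → State → State → Set
Agree b s s′ = (∀ {y} → y < b → reg s y ≡ reg s′ y) × (∀ a → mem s a ≡ mem s′ a)

update-agree : ∀ {P : ℕ → Set} {f g : ℕ → ℕ} i {u v} → u ≡ v →
  (∀ {j} → P j → f j ≡ g j) → ∀ {j} → P j → (f [ i ↦ u ]) j ≡ (g [ i ↦ v ]) j
update-agree i refl f≈g {j} Pj with j ≡ᵇ i
... | true  = refl
... | false = f≈g Pj

-- The given algorithm is run in a state that matches its prescribed initial state only in the
-- registers below b, since the higher ones hold data of the reduction. Memory has to agree
-- everywhere, because addresses are computed at run time. That the higher registers survive is what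
-- preserves the threshold.
simulate : ∀ {w p s t s₁ b s′} → w ⊢ p , s ⇓ t , s₁ → width p ≤ b → Agree b s s′ →
  ∃[ s₁′ ] (w ⊢ p , s′ ⇓ t , s₁′) × Agree b s₁ s₁′ × (∀ {y} → b ≤ y → reg s₁′ y ≡ reg s′ y)
simulate ⇓skip _ A = _ , ⇓skip , A , λ _ → refl
simulate {s = s} {b = b} {s′} (⇓const {x = x}) x< (R , M) =
  _ , ⇓const , (update-agree {_< b} x refl R , M) , λ b≤y → update-other (reg s′) x _ (>⇒≢ (<-≤-trans x< b≤y))
simulate {w = w} {s = s} {b = b} {s′} (⇓op {x = x} {y} {o} {z}) x< (R , M) =
  _ , ⇓op , (update-agree {_< b} x (cong₂ (λ u v → wrap w (⟦ o ⟧ w u v)) (R y<) (R z<)) R , M) ,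
  λ b≤y → update-other (reg s′) x _ (>⇒≢ (<-≤-trans (≤-<-trans (m≤m+n x (y + z)) x<) b≤y))
  where
  y< : y < b
  y< = ≤-<-trans (≤-trans (m≤m+n y z) (m≤n+m (y + z) x)) x<
  z< : z < b
  z< = ≤-<-trans (≤-trans (m≤n+m z y) (m≤n+m (y + z) x)) x<
simulate {s = s} {b = b} {s′} (⇓load {x = x} {y}) x< (R , M) =
  _ , ⇓load , (update-agree {_< b} x (trans (M _) (cong (mem s′) (R (≤-<-trans (m≤n+m y x) x<)))) R , M) ,
  λ b≤y → update-other (reg s′) x _ (>⇒≢ (<-≤-trans (≤-<-trans (m≤m+n x y) x<) b≤y))
simulate {s = s} {s₁ = s₁} {b = b} {s′} (⇓store {x = x} {y}) x< (R , M) =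
  _ , ⇓store , (R , λ a → subst (λ i → mem s₁ a ≡ (mem s′ [ i ↦ reg s′ y ]) a) (R x<′)
    (update-agree {λ _ → 0 ≤ 0} (reg s x) (R y<) (λ {j} _ → M j) {a} z≤n)) ,
  λ _ → refl
  where
  x<′ : x < b
  x<′ = ≤-<-trans (m≤m+n x y) x<
  y< : y < b
  y< = ≤-<-trans (m≤n+m y x) x<
simulate {p = p ⨾ q} (⇓seq e f) ≤b A
  with simulate e (m+n≤o⇒m≤o (width p) ≤b) A
... | _ , e′ , A₁ , K₁ with simulate f (m+n≤o⇒n≤o (width p) ≤b) A₁
... | _ , f′ , A₂ , K₂ = _ , ⇓seq e′ f′ , A₂ , λ b≤y → trans (K₂ b≤y) (K₁ b≤y)
simulate {p = when x then p else q} (⇓then x≢0 e) ≤b A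
  with simulate e (m+n≤o⇒m≤o (width p) (m+n≤o⇒n≤o (suc x) ≤b)) A
... | _ , e′ , A₁ , K₁ =
  _ , ⇓then (λ z → x≢0 (trans (proj₁ A (m+n≤o⇒m≤o (suc x) ≤b)) z)) e′ , A₁ , K₁
simulate {p = when x then p else q} (⇓else x≡0 e) ≤b A
  with simulate e (m+n≤o⇒n≤o (width p) (m+n≤o⇒n≤o (suc x) ≤b)) A
... | _ , e′ , A₁ , K₁ =
  _ , ⇓else (trans (sym (proj₁ A (m+n≤o⇒m≤o (suc x) ≤b))) x≡0) e′ , A₁ , K₁
simulate {p = while x loop p} (⇓stop x≡0) ≤b A =
  _ , ⇓stop (trans (sym (proj₁ A (m+n≤o⇒m≤o (suc x) ≤b))) x≡0) , A , λ _ → refl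
simulate {p = while x loop p} (⇓loop x≢0 e f) ≤b A
  with simulate e (m+n≤o⇒n≤o (suc x) ≤b) A
... | _ , e′ , A₁ , K₁ with simulate f ≤b A₁
... | _ , f′ , A₂ , K₂ =
  _ , ⇓loop (λ z → x≢0 (trans (proj₁ A (m+n≤o⇒m≤o (suc x) ≤b)) z)) e′ f′ , A₂ ,
  λ b≤y → trans (K₂ b≤y) (K₁ b≤y)

-- An initial state has zero in every register except register 0, whereas n, d and r are still in
-- the lowest registers.
clear : Reg → Program
clear zero    = skip
clear (suc y) = (y ≔ 0) ⨾ clear y

clear-run : ∀ w b s → ∃[ s′ ] (w ⊢ clear b , s ⇓ suc b , s′) ×
  (∀ {y} → y < b → reg s′ y ≡ 0) × (∀ {y} → b ≤ y → reg s′ y ≡ reg s y) × mem s′ ≡ mem s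
clear-run w zero s = s , ⇓skip , (λ ()) , (λ _ → refl) , refl
clear-run w (suc b) s with clear-run w b ⟪ reg s [ b ↦ wrap w 0 ] , mem s ⟫
... | s′ , run , low , high , m≡ =
  s′ , ⇓seq ⇓const run , low′ ,
  (λ b<y → trans (high (<⇒≤ b<y)) (update-other (reg s) b _ (>⇒≢ b<y))) , m≡
  where
  low′ : ∀ {y} → y < suc b → reg s′ y ≡ 0
  low′ {y} y<1+b with y ≟ b
  ... | yes refl = trans (high ≤-refl) (trans (update-same (reg s) b _) (wrap-small {w} (m^n>0 2 w)))
  ... | no y≢b = low (≤∧≢⇒< (s≤s⁻¹ y<1+b) y≢b)

contents-++ˡ : ∀ xs ys {i} → i < length xs → contents (xs ++ ys) i ≡ contents xs i
contents-++ˡ (x ∷ xs) ys {zero}  _ = refl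
contents-++ˡ (x ∷ xs) ys {suc i} (s≤s i<) = contents-++ˡ xs ys i<

contents-++ʳ : ∀ xs ys i → contents (xs ++ ys) (length xs + i) ≡ contents ys i
contents-++ʳ []       ys i = refl
contents-++ʳ (x ∷ xs) ys i = contents-++ʳ xs ys i

contents-beyond : ∀ xs {i} → length xs ≤ i → contents xs i ≡ 0
contents-beyond []       _ = refl
contents-beyond (x ∷ xs) (s≤s ≤i) = contents-beyond xs ≤i

contents-< : ∀ {b} xs → 0 < b → All (_< b) xs → ∀ i → contents xs i < b
contents-< []       0<b _          i       = 0<b
contents-< (x ∷ xs) 0<b (x< ∷ _)   zero    = x<
contents-< (x ∷ xs) 0<b (_ ∷ xs<)  (suc i) = contents-< xs 0<b xs< i

contents-applyUpTo : ∀ (f : ℕ → ℕ) {n i} → i < n → contents (applyUpTo f n) i ≡ f i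
contents-applyUpTo f {suc n} {zero}  _ = refl
contents-applyUpTo f {suc n} {suc i} (s≤s i<) = contents-applyUpTo (f ∘ suc) i<

double offset : Expr → Expr
double sizeE = sizeE ‹ plus › sizeE
offset sizeE = double sizeE ‹ plus › counter

-- The new input is assembled above address 2N, then moved down over the old one.
transform : Reg → Expr → Expr → Expr → Program
transform base sizeE symE thrE =
  fill base (double sizeE) (offset sizeE) symE ⨾
  fill base (double sizeE) counter (load (offset sizeE)) ⨾
  fill base (double sizeE) (offset sizeE) (lit 0) ⨾ clear base ⨾
  code base sizeE (4 + base) ⨾ (0 ≔ 0 ⟨ add ⟩ (4 + base)) ⨾ code base thrE (4 + base)

transformTime : Reg → Expr → Expr → Expr → ℕ → ℕ
transformTime base sizeE symE thrE c =
  fillTime (double sizeE) (offset sizeE) symE c +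
  (fillTime (double sizeE) counter (load (offset sizeE)) c +
  (fillTime (double sizeE) (offset sizeE) (lit 0) c +
  (suc base + (time sizeE + (1 + time thrE)))))

module Transform
  {w base V n d r N thr : ℕ} {sizeE symE thrE : Expr} {v : ℕ → ℕ} {s₀ : State}
  (2≤V : 2 ≤ V) (n<V : n < V) (d<V : d < V) (r<V : r < V) (2N<V : N + N < V)
  (v<V : ∀ i → v i < V) (m<V : ∀ a → mem s₀ a < V)
  (D : ℕ) (V^D≤ : V ^ D ≤ 2 ^ w) (0<base : 0 < base)
  (size-deg : (deg sizeE + deg sizeE) + 2 ≤ D) (sym-deg : deg symE ≤ D) (thr-deg : deg thrE ≤ D)
  (size≡ : ∀ i m → eval (env n d r i) m sizeE ≡ N)
  (thr≡ : ∀ i m → eval (env n d r i) m thrE ≡ thr)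
  (sym≡ : ∀ m → (∀ a → a < N + N → m a ≡ mem s₀ a) →
          ∀ i → i < N + N → eval (env n d r i) m symE ≡ v i)
  (zero-beyond : ∀ a → N + N ≤ a → mem s₀ a ≡ 0)
  where

  c : ℕ
  c = N + N

  cnt shifted : Expr
  cnt     = double sizeE
  shifted = offset sizeE

  fits : ∀ {k} → k ≤ D → V ^ k ≤ 2 ^ w
  fits k≤D = ≤-trans (^-mono 2≤V k≤D) V^D≤

  cond-deg : suc (deg cnt) ≤ D
  cond-deg = ≤-trans (≤-trans (n≤1+n _) (≤-reflexive (+-comm 2 _))) size-deg
  shifted-deg : deg shifted ≤ D
  shifted-deg = ≤-trans (+-monoʳ-≤ (deg cnt) (s≤s z≤n)) size-deg
  load-deg : deg (load shifted) ≤ D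
  load-deg = ≤-trans (≤-reflexive (sym (+-suc (deg cnt) 1))) size-deg
  one-deg : 1 ≤ D
  one-deg = ≤-trans (s≤s z≤n) cond-deg
  sizeE-deg : deg sizeE ≤ D
  sizeE-deg = ≤-trans (≤-trans (m≤m+n _ (deg sizeE)) (m≤m+n _ 2)) size-deg

  cnt≡ : ∀ i m → eval (env n d r i) m cnt ≡ c
  cnt≡ i m = cong₂ _+_ (size≡ i m) (size≡ i m)

  shifted≡ : ∀ i m → eval (env n d r i) m shifted ≡ c + i
  shifted≡ i m = cong (_+ i) (cnt≡ i m)

  fill₁ : Holds base (env n d r 0) s₀ →
    ∃[ s₁ ] (w ⊢ fill base cnt shifted symE , s₀ ⇓ fillTime cnt shifted symE c , s₁) × Filled base n d r c v s₀ c s₁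
  fill₁ = Fill.fill-run {w} {base} {V} {n} {d} {r} {c} {c} {cnt} {shifted} {symE} {v} {s₀}
    2≤V n<V d<V r<V 2N<V (λ i _ → v<V i) m<V (fits cond-deg) (fits shifted-deg) (fits sym-deg)
    cnt≡ shifted≡ (λ m out → sym≡ m (λ a a<c → out a (λ k _ a≡c+k → <⇒≱ a<c (subst (c ≤_) (sym a≡c+k) (m≤m+n c k))))) {0}

  fill₂ : ∀ {s₁} → Filled base n d r c v s₀ c s₁ →
    ∃[ s₂ ] (w ⊢ fill base cnt counter (load shifted) , s₁ ⇓ fillTime cnt counter (load shifted) c , s₂) × Filled base n d r 0 v s₁ c s₂
  fill₂ {s₁} P₁ = Fill.fill-run {w} {base} {V} {n} {d} {r} {c} {0} {cnt} {counter} {load shifted} {v} {s₁}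
    2≤V n<V d<V r<V 2N<V (λ i _ → v<V i) (filled-< P₁ m<V (λ k _ → v<V k)) (fits cond-deg) (fits one-deg) (fits load-deg)
    cnt≡ (λ _ _ → refl)
    (λ m out i i<c → trans (cong m (shifted≡ i m))
      (trans (out (c + i) (λ k k<c c+i≡k → <⇒≱ k<c (subst (c ≤_) c+i≡k (m≤m+n c i)))) (Filled.inside P₁ i i<c)))
    {c} (Filled.holds P₁)

  -- An initial memory is zero beyond the input, so the copy assembled in the cells from 2N to 4N
  -- has to be erased.
  fill₃ : ∀ {s₁ s₂} → Filled base n d r c v s₀ c s₁ → Filled base n d r 0 v s₁ c s₂ →
    ∃[ s₃ ] (w ⊢ fill base cnt shifted (lit 0) , s₂ ⇓ fillTime cnt shifted (lit 0) c , s₃) × Filled base n d r c (λ _ → 0) s₂ c s₃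
  fill₃ {s₁} {s₂} P₁ P₂ = Fill.fill-run {w} {base} {V} {n} {d} {r} {c} {c} {cnt} {shifted} {lit 0} {λ _ → 0} {s₂}
    2≤V n<V d<V r<V 2N<V (λ i _ → <⇒≤ 2≤V) (filled-< P₂ (filled-< P₁ m<V (λ k _ → v<V k)) (λ k _ → v<V k))
    (fits cond-deg) (fits shifted-deg) (fits one-deg)
    cnt≡ shifted≡ (λ _ _ _ _ → refl) {c} (Filled.holds P₂)

  module _ {s₁ s₂ s₃} (P₁ : Filled base n d r c v s₀ c s₁) (P₂ : Filled base n d r 0 v s₁ c s₂)
           (P₃ : Filled base n d r c (λ _ → 0) s₂ c s₃) where

    mem-<₃ : ∀ a → mem s₃ a < V
    mem-<₃ = filled-< P₃ (filled-< P₂ (filled-< P₁ m<V (λ k _ → v<V k)) (λ k _ → v<V k)) (λ k _ → <⇒≤ 2≤V)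

    final-inside : ∀ a → a < c → mem s₃ a ≡ v a
    final-inside a a<c = trans
      (Filled.outside P₃ a (λ k _ a≡c+k → <⇒≱ a<c (subst (c ≤_) (sym a≡c+k) (m≤m+n c k))))
      (Filled.inside P₂ a a<c)

    final-outside : ∀ a → c ≤ a → mem s₃ a ≡ 0
    final-outside a c≤a with (a ∸ c) <? c
    ... | yes k<c = subst (λ z → mem s₃ z ≡ 0) (m+[n∸m]≡n c≤a) (Filled.inside P₃ (a ∸ c) k<c)
    ... | no k≮c = trans (Filled.outside P₃ a far) (trans (Filled.outside P₂ a (λ k k<c a≡k → <⇒≱ k<c (subst (c ≤_) a≡k c≤a)))
                     (trans (Filled.outside P₁ a far) (zero-beyond a c≤a)))
      where
      far : Outside c c a
      far k k<c refl = k≮c (subst (_< c) (sym (m+n∸m≡n c k)) k<c)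

  N<2^w : N < 2 ^ w
  N<2^w = <-≤-trans (≤-<-trans (m≤m+n N N) 2N<V) (subst (_≤ 2 ^ w) (*-identityʳ V) (fits one-deg))

  env<V : ∀ v → lookup (env n d r c) v < V
  env<V = env-< n<V d<V r<V 2N<V

  transform-run : Holds base (env n d r 0) s₀ →
    ∃[ s′ ] (w ⊢ transform base sizeE symE thrE , s₀ ⇓ transformTime base sizeE symE thrE c , s′) ×
      (∀ {y} → y < base → reg s′ y ≡ contents (N ∷ []) y) × reg s′ (4 + base) ≡ thr ×
      (∀ a → a < c → mem s′ a ≡ v a) × (∀ a → c ≤ a → mem s′ a ≡ 0)
  transform-run h with fill₁ h
  ... | s₁ , run₁ , P₁ with fill₂ P₁
  ... | s₂ , run₂ , P₂ with fill₃ P₁ P₂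
  ... | s₃ , run₃ , P₃ with clear-run w base s₃
  ... | s₄ , run₄ , low₄ , high₄ , refl
    with code-sets {w} {base} {V} {env n d r c} sizeE {s₄} {4 + base}
           (2≤V , env<V , mem-<₃ P₁ P₂ P₃)
           (λ x → trans (high₄ (m≤m+n base _)) (Filled.holds P₃ x)) (b+4≤ base) (fits sizeE-deg)
  ... | sets {s₅} run₅ hit₅ below₅ refl
    with code-sets {w} {base} {V} {env n d r c} thrE {⟪ reg s₅ [ 0 ↦ wrap w (reg s₅ 0 + reg s₅ (4 + base)) ] , mem s₄ ⟫} {4 + base}
           (2≤V , env<V , mem-<₃ P₁ P₂ P₃)
           (λ x → trans (update-other (reg s₅) 0 _ (>⇒≢ (<-≤-trans 0<base (m≤m+n base (toℕ x)))))
             (trans (below₅ (var< (b+4≤ base) x)) (trans (high₄ (m≤m+n base _)) (Filled.holds P₃ x))))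
           (b+4≤ base) (fits thr-deg)
  ... | sets {s₆} run₆ hit₆ below₆ m₆ =
    s₆ , ⇓seq run₁ (⇓seq run₂ (⇓seq run₃ (⇓seq run₄ (⇓seq run₅ (⇓seq ⇓op run₆))))) ,
    low , trans hit₆ (thr≡ c (mem s₄)) ,
    (λ a a<c → trans (cong (λ m → m a) m₆) (final-inside P₁ P₂ P₃ a a<c)) ,
    (λ a c≤a → trans (cong (λ m → m a) m₆) (final-outside P₁ P₂ P₃ a c≤a))
    where
    low : ∀ {y} → y < base → reg s₆ y ≡ contents (N ∷ []) y
    low {zero} 0< = trans (below₆ z<s) (trans (update-same (reg s₅) 0 _)
      (trans (cong (wrap w) (cong₂ _+_ (trans (below₅ z<s) (low₄ 0<)) (trans hit₅ (size≡ c (mem s₄))))) (wrap-small {w} N<2^w)))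
    low {suc y} y< = trans (below₆ y<4) (trans (update-other (reg s₅) 0 (wrap w (reg s₅ 0 + reg s₅ (4 + base))) (λ ())) (trans (below₅ y<4) (low₄ y<)))
      where
      y<4 : suc y < 4 + base
      y<4 = m≤n⇒m≤o+n 4 y<

-- Running time with exponent 2 - 1 / b

^-distribʳ-* : ∀ o m n → (m * n) ^ o ≡ m ^ o * n ^ o
^-distribʳ-* zero    m n = refl
^-distribʳ-* (suc o) m n = trans (cong (m * n *_) (^-distribʳ-* o m n)) (regroup m n (m ^ o) (n ^ o))
  where
  regroup : ∀ m n p q → m * n * (p * q) ≡ m * p * (n * q)
  regroup = solve-∀

-- Since b + 1 ≤ 2 b, a saving of 1 / b in the exponent still admits every time linear in n.
linear-bound : ∀ b {t n X K} → 1 ≤ b → 1 ≤ n → t ≤ X * n → X ≤ K →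
  t ^ b * n ^ 1 ≤ K ^ b * n ^ (2 * b)
linear-bound b {t} {n} {X} {K} 1≤b 1≤n t≤ X≤K = begin
  t ^ b * n ^ 1           ≤⟨ *-monoˡ-≤ (n ^ 1) (^-monoˡ-≤ b t≤) ⟩
  (X * n) ^ b * n ^ 1     ≡⟨ cong (_* n ^ 1) (^-distribʳ-* b X n) ⟩
  X ^ b * n ^ b * n ^ 1   ≡⟨ *-assoc (X ^ b) _ _ ⟩
  X ^ b * (n ^ b * n ^ 1) ≡⟨ cong (X ^ b *_) (^-distribˡ-+-* n b 1) ⟨
  X ^ b * n ^ (b + 1)     ≤⟨ *-mono-≤ (^-monoˡ-≤ b X≤K) (^-monoʳ-≤ n {{>-nonZero 1≤n}} (+-monoʳ-≤ b (≤-trans 1≤b (m≤m+n b 0)))) ⟩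
  K ^ b * n ^ (2 * b)     ∎
  where open ≤-Reasoning

-- The conclusion asks for one factor n on the left, and N ^ a supplies it because 1 ≤ a and n ≤ N.
-- On the right N ^ 2b becomes (X n) ^ 2b, whose factor X ^ 2 is absorbed by K.
oracle-bound : ∀ a b {t u n N C X K} → 1 ≤ a → 1 ≤ n → n ≤ N → N ≤ X * n →
  u ^ b * N ^ a ≤ C ^ b * N ^ (2 * b) → t ≤ 2 * u → 2 * C * (X * X) ≤ K →
  t ^ b * n ^ 1 ≤ K ^ b * n ^ (2 * b)
oracle-bound a b {t} {u} {n} {N} {C} {X} {K} 1≤a 1≤n n≤N N≤ u≤ t≤ ≤K = begin
  t ^ b * n ^ 1                 ≤⟨ *-mono-≤ (^-monoˡ-≤ b t≤) (≤-trans (^-monoˡ-≤ 1 n≤N) (^-monoʳ-≤ N {{>-nonZero (≤-trans 1≤n n≤N)}} 1≤a)) ⟩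
  (2 * u) ^ b * N ^ a           ≡⟨ cong (_* N ^ a) (^-distribʳ-* b 2 u) ⟩
  2 ^ b * u ^ b * N ^ a         ≡⟨ *-assoc (2 ^ b) _ _ ⟩
  2 ^ b * (u ^ b * N ^ a)       ≤⟨ *-monoʳ-≤ (2 ^ b) u≤ ⟩
  2 ^ b * (C ^ b * N ^ (2 * b)) ≤⟨ *-monoʳ-≤ (2 ^ b) (*-monoʳ-≤ (C ^ b) (^-monoˡ-≤ (2 * b) N≤)) ⟩
  2 ^ b * (C ^ b * (X * n) ^ (2 * b)) ≡⟨ cong (λ z → 2 ^ b * (C ^ b * z)) (^-distribʳ-* (2 * b) X n) ⟩
  2 ^ b * (C ^ b * (X ^ (2 * b) * n ^ (2 * b))) ≡⟨ cong (λ z → 2 ^ b * (C ^ b * (z * n ^ (2 * b)))) (sym (^-*-assoc X 2 b)) ⟩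
  2 ^ b * (C ^ b * ((X ^ 2) ^ b * n ^ (2 * b))) ≡⟨ regroup (2 ^ b) (C ^ b) ((X ^ 2) ^ b) _ ⟩
  2 ^ b * C ^ b * (X ^ 2) ^ b * n ^ (2 * b) ≡⟨ cong (_* n ^ (2 * b)) (trans (cong (_* (X ^ 2) ^ b) (sym (^-distribʳ-* b 2 C))) (sym (^-distribʳ-* b (2 * C) (X ^ 2)))) ⟩
  (2 * C * X ^ 2) ^ b * n ^ (2 * b) ≤⟨ *-monoˡ-≤ (n ^ (2 * b)) (^-monoˡ-≤ b (subst (λ z → 2 * C * (X * z) ≤ K) (sym (*-identityʳ X)) ≤K)) ⟩
  K ^ b * n ^ (2 * b)           ∎
  where
  open ≤-Reasoning
  regroup : ∀ p q r s → p * (q * (r * s)) ≡ p * q * r * s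
  regroup = solve-∀

-- A b-th power does not split over a sum. The time is therefore bounded by twice the larger of the
-- two summands u and L * N, and each case has its own bound.
combined-bound : ∀ a b {t u n N C L X K} → 1 ≤ a → 1 ≤ b → 1 ≤ n → n ≤ N → N ≤ X * n →
  u ^ b * N ^ a ≤ C ^ b * N ^ (2 * b) → t ≤ u + L * N →
  2 * C * (X * X) ≤ K → 2 * L * X ≤ K → t ^ b * n ^ 1 ≤ K ^ b * n ^ (2 * b)
combined-bound a b {t} {u} {n} {N} {C} {L} {X} {K} 1≤a 1≤b 1≤n n≤N N≤ u≤ t≤ ≤K ≤K′ with L * N ≤? u
... | yes LN≤u = oracle-bound a b {t} {u} {n} {N} {C} {X} {K} 1≤a 1≤n n≤N N≤ u≤
      (≤-trans t≤ (≤-trans (+-monoʳ-≤ u LN≤u) (+-monoʳ-≤ u (m≤m+n u 0)))) ≤K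
... | no LN≰u = linear-bound b {t} {n} {2 * L * X} {K} 1≤b 1≤n (begin
  t             ≤⟨ t≤ ⟩
  u + L * N     ≤⟨ +-monoˡ-≤ (L * N) (<⇒≤ (≰⇒> LN≰u)) ⟩
  L * N + L * N ≡⟨ twice (L * N) ⟩
  2 * (L * N)   ≤⟨ *-monoʳ-≤ 2 (*-monoʳ-≤ L N≤) ⟩
  2 * (L * (X * n)) ≡⟨ regroup L X n ⟩
  2 * L * X * n ∎) ≤K′
  where
  open ≤-Reasoning
  twice : ∀ x → x + x ≡ 2 * x
  twice = solve-∀
  regroup : ∀ p q r → 2 * (p * (q * r)) ≡ 2 * p * q * r
  regroup = solve-∀

applyUpTo-++ : ∀ {A : Set} (f : ℕ → A) m n → applyUpTo f (m + n) ≡ applyUpTo f m ++ applyUpTo (f ∘ (m +_)) n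
applyUpTo-++ f zero    n = refl
applyUpTo-++ f (suc m) n = cong (f 0 ∷_) (applyUpTo-++ (f ∘ suc) m n)

toList-tabulate : ∀ {A : Set} n (f : ℕ → A) → toList (tabulate {n = n} (f ∘ toℕ)) ≡ applyUpTo f n
toList-tabulate zero    f = refl
toList-tabulate (suc n) f = cong (f 0 ∷_) (toList-tabulate n (f ∘ suc))

toList-map-tabulate : ∀ {σ} n (f : ℕ → Fin σ) →
  toList (map toℕ (tabulate {n = n} (f ∘ toℕ))) ≡ applyUpTo (toℕ ∘ f) n
toList-map-tabulate zero    f = refl
toList-map-tabulate (suc n) f = cong (toℕ (f 0) ∷_) (toList-map-tabulate n (f ∘ suc))

fillSlope : Expr → Expr → Expr → ℕ
fillSlope cnt addr val = 2 + time (counter ‹ less › cnt) + 2 * suc (bodyTime cnt addr val)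

fillTime-linear : ∀ cnt addr val {N} → 1 ≤ N → fillTime cnt addr val (N + N) ≤ fillSlope cnt addr val * N
fillTime-linear cnt addr val {N} 1≤N = begin
  1 + (x + ((N + N) * y + 1)) ≡⟨ regroup x y N ⟩
  2 + x + 2 * y * N           ≤⟨ +-monoˡ-≤ (2 * y * N) (m≤m*n′ (2 + x) 1≤N) ⟩
  (2 + x) * N + 2 * y * N     ≡⟨ *-distribʳ-+ N (2 + x) (2 * y) ⟨
  (2 + x + 2 * y) * N         ∎
  where
  open ≤-Reasoning
  x y : ℕ
  x = time (counter ‹ less › cnt)
  y = suc (bodyTime cnt addr val)
  regroup : ∀ x y N → 1 + (x + ((N + N) * y + 1)) ≡ 2 + x + 2 * y * N
  regroup = solve-∀

slope : Reg → Expr → Expr → Expr → ℕ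
slope base sizeE symE thrE =
  6 + (fillSlope (double sizeE) (offset sizeE) symE +
  (fillSlope (double sizeE) counter (load (offset sizeE)) +
  (fillSlope (double sizeE) (offset sizeE) (lit 0) +
  (suc base + (time sizeE + (1 + time thrE))))))

transformTime-linear : ∀ base sizeE symE thrE {N} → 1 ≤ N →
  6 + transformTime base sizeE symE thrE (N + N) ≤ slope base sizeE symE thrE * N
transformTime-linear base sizeE symE thrE {N} 1≤N = begin
  6 + transformTime base sizeE symE thrE (N + N)
    ≤⟨ +-mono-≤ (m≤m*n′ 6 1≤N) (+-mono-≤ (fillTime-linear (double sizeE) (offset sizeE) symE 1≤N)
        (+-mono-≤ (fillTime-linear (double sizeE) counter (load (offset sizeE)) 1≤N)
        (+-mono-≤ (fillTime-linear (double sizeE) (offset sizeE) (lit 0) 1≤N) (m≤m*n′ e 1≤N)))) ⟩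
  6 * N + (a * N + (b * N + (c * N + e * N))) ≡⟨ regroup a b c e N ⟩
  slope base sizeE symE thrE * N ∎
  where
  open ≤-Reasoning
  a b c e : ℕ
  a = fillSlope (double sizeE) (offset sizeE) symE
  b = fillSlope (double sizeE) counter (load (offset sizeE))
  c = fillSlope (double sizeE) (offset sizeE) (lit 0)
  e = suc base + (time sizeE + (1 + time thrE))
  regroup : ∀ a b c e N → 6 * N + (a * N + (b * N + (c * N + e * N))) ≡ (6 + (a + (b + (c + e)))) * N
  regroup = solve-∀

-- What a reduction provides, and the algorithm obtained from it

verdict : Bool → ℕ → ℕ → ℕ
verdict b thr ℓ = bit (if b then (thr <ᵇ ℓ) else (ℓ <ᵇ thr))

Decides : VectorSets → ℕ → Set
Decides I v = (v ≡ 1 × VectorSets.HasPair I) ⊎ (v ≡ 0 × ¬ VectorSets.HasPair I)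

module _ {σ : ℕ} (size : ℕ → ℕ → ℕ → ℕ) (n≤size : ∀ {n d r} → r < d → n ≤ size n d r)
         (symbol : VectorSets → ℕ → Fin σ) where

  sequencePair : (I : VectorSets) → VectorSets.r I < VectorSets.d I → SequencePair σ
  sequencePair I r<d = record
    { n = N
    ; nonZero = >-nonZero (≤-trans (>-nonZero⁻¹ (VectorSets.n I) {{VectorSets.nonZero I}}) (n≤size r<d))
    ; x = tabulate (symbol I ∘ toℕ)
    ; y = tabulate (symbol I ∘ (N +_) ∘ toℕ)
    }
    where
    N : ℕ
    N = size (VectorSets.n I) (VectorSets.d I) (VectorSets.r I)

-- `n*d≤size` puts the old input below address 2N, hence below the region where the new one is
-- assembled. Since that region is being written while symbols are evaluated, `symbol≡` may rely on
-- the cells below 2N only.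
record Reduction (σ : ℕ) (Answer : SequencePair σ → ℕ → Set) : Set where
  field
    sizeE symE thrE : Expr
    size threshold : ℕ → ℕ → ℕ → ℕ
    size≡ : ∀ {n d r i} m → eval (env n d r i) m sizeE ≡ size n d r
    threshold≡ : ∀ {n d r i} m → eval (env n d r i) m thrE ≡ threshold n d r
    factor : ℕ
    1≤factor : 1 ≤ factor
    n≤size : ∀ {n d r} → r < d → n ≤ size n d r
    n*d≤size : ∀ {n d r} → r < d → n * d ≤ size n d r
    size≤ : ∀ {n d r} → r < d → 1 ≤ n → size n d r ≤ factor * suc d ^ 2 * n
    symbol : VectorSets → ℕ → Fin σ
    symbol≡ : ∀ I → VectorSets.r I < VectorSets.d I → ∀ m →
      let N = size (VectorSets.n I) (VectorSets.d I) (VectorSets.r I) in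
      (∀ a → a < N + N → m a ≡ contents (Problem.memory MostOrthogonalVectors I) a) →
      ∀ i → i < N + N → eval (env (VectorSets.n I) (VectorSets.d I) (VectorSets.r I) i) m symE ≡ toℕ (symbol I i)
    -- A good pair pushes the value above the threshold (`true`, as in LCS) or below it (`false`, as
    -- in DTWD).
    increasing : Bool
    decides : ∀ I (r<d : VectorSets.r I < VectorSets.d I) ℓ →
      Answer (sequencePair size n≤size symbol I r<d) ℓ →
      Decides I (verdict increasing (threshold (VectorSets.n I) (VectorSets.d I) (VectorSets.r I)) ℓ)

toℕ-All< : ∀ {σ m} (v : Vec (Fin σ) m) → All (_< σ) (toList (map toℕ v))
toℕ-All< []      = []
toℕ-All< (i ∷ v) = toℕ<n i ∷ toℕ-All< v

memory-< : ∀ I → All (_< 2) (Problem.memory MostOrthogonalVectors I)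
memory-< I = AllP.++⁺ (toℕ-All< (concat (VectorSets.A I))) (toℕ-All< (concat (VectorSets.B I)))

length-memory : ∀ I → length (Problem.memory MostOrthogonalVectors I) ≡
  VectorSets.n I * VectorSets.d I + VectorSets.n I * VectorSets.d I
length-memory I = trans (length-++ (toList (map toℕ (concat (VectorSets.A I)))))
  (cong₂ _+_ (length-toList (map toℕ (concat (VectorSets.A I)))) (length-toList (map toℕ (concat (VectorSets.B I)))))

dot≤ : ∀ {d} (a b : Vec (Fin 2) d) → a ∙ b ≤ d
dot≤ []      []      = z≤n
dot≤ (x ∷ a) (y ∷ b) = +-mono-≤ (*-mono-≤ (s≤s⁻¹ (toℕ<n x)) (s≤s⁻¹ (toℕ<n y))) (dot≤ a b)

trivial-pair : ∀ I → 1 ≤ VectorSets.n I → VectorSets.d I ≤ VectorSets.r I → VectorSets.HasPair I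
trivial-pair record { n = suc n ; A = a ∷ A ; B = b ∷ B } _ d≤r =
  a , b , here refl , here refl , ≤-trans (dot≤ a b) d≤r

module Transfer {σ Answer} (R : Reduction σ Answer) (oracle : Program) (k : ℕ) where
  open Reduction R

  base : Reg
  -- The 3 keeps the copies of n, d and r, which start at `base`, clear of the input registers; the
  -- width keeps them clear of the registers of the given algorithm.
  base = 3 + width oracle

  judge : Bool → Program
  judge true  = 0 ≔ (4 + base) ⟨ lt ⟩ 0
  judge false = 0 ≔ 0 ⟨ lt ⟩ (4 + base)

  solve : Program
  solve = transform base sizeE symE thrE ⨾ oracle ⨾ judge increasing

  -- Additions act as copies here because all registers from 3 on are initially zero. The last
  -- instruction leaves the flag r < d in `4 + base`.
  prologue : Program → Program
  prologue p =
    (base ≔ base ⟨ add ⟩ 0) ⨾ ((1 + base) ≔ (1 + base) ⟨ add ⟩ 1) ⨾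
    ((2 + base) ≔ (2 + base) ⟨ add ⟩ 2) ⨾ ((4 + base) ≔ 2 ⟨ lt ⟩ 1) ⨾ p

  program : Program
  program = prologue (when (4 + base) then solve else (0 ≔ 1))

  -- Two levels of exponents. `V = (2 + n + d) ^ e` exceeds 2N, by the summand with `sizeE`, and
  -- every symbol, by `suc σ`. Then `V ^ D` exceeds all intermediate values, and also `(2 + N) ^ k`,
  -- which the given algorithm requires of its word size.
  D e : ℕ
  D = ((deg sizeE + deg sizeE) + 2) + (deg symE + (deg thrE + k))
  e = (deg sizeE + deg sizeE) + suc σ

  sizeE≤D : deg sizeE + deg sizeE + 2 ≤ D
  sizeE≤D = m≤m+n _ (deg symE + (deg thrE + k))

  symE≤D : deg symE ≤ D
  symE≤D = ≤-trans (m≤m+n (deg symE) (deg thrE + k)) (m≤n+m _ (deg sizeE + deg sizeE + 2))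

  thrE+k≤D : deg thrE + k ≤ D
  thrE+k≤D = ≤-trans (m≤n+m (deg thrE + k) (deg symE)) (m≤n+m _ (deg sizeE + deg sizeE + 2))

  pair : ∀ I → VectorSets.r I < VectorSets.d I → SequencePair σ
  pair = sequencePair size n≤size symbol

  judge-run : ∀ w b s → 1 < 2 ^ w →
    ∃[ s′ ] (w ⊢ judge b , s ⇓ 1 , s′) × reg s′ 0 ≡ verdict b (reg s (4 + base)) (reg s 0)
  judge-run w true  s 1<2^w = _ , ⇓op , wrap-small {w} (≤-<-trans (bit≤1 (reg s (4 + base) <ᵇ reg s 0)) 1<2^w)
  judge-run w false s 1<2^w = _ , ⇓op , wrap-small {w} (≤-<-trans (bit≤1 (reg s 0 <ᵇ reg s (4 + base))) 1<2^w)

  module Instance (w : ℕ) (I : VectorSets) (adm : Admissible MostOrthogonalVectors (e * D) w I) where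
    open VectorSets I

    cells : ℕ → ℕ
    cells = contents (Problem.memory MostOrthogonalVectors I)

    V₀ V N : ℕ
    V₀ = 2 + (n + d)
    V  = V₀ ^ e
    N  = size n d r

    V^D≤ : V ^ D ≤ 2 ^ w
    V^D≤ = subst (_≤ 2 ^ w) (sym (^-*-assoc V₀ e D)) (proj₁ adm)

    1≤e : 1 ≤ e
    1≤e = ≤-trans (s≤s z≤n) (m≤n+m (suc σ) _)

    1≤D : 1 ≤ D
    1≤D = ≤-trans (≤-trans (s≤s z≤n) (m≤n+m 2 (deg sizeE + deg sizeE))) (m≤m+n _ (deg symE + (deg thrE + k)))

    V₀^≤V : ∀ {i} → i ≤ e → V₀ ^ i ≤ V
    V₀^≤V = ^-monoʳ-≤ V₀

    V₀≤V : V₀ ≤ V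
    V₀≤V = subst (_≤ V) (*-identityʳ V₀) (V₀^≤V 1≤e)

    2≤V : 2 ≤ V
    2≤V = ≤-trans (s≤s (s≤s z≤n)) V₀≤V

    V^≤ : ∀ {i} → i ≤ D → V ^ i ≤ 2 ^ w
    V^≤ i≤D = ≤-trans (^-mono 2≤V i≤D) V^D≤

    V≤2^w : V ≤ 2 ^ w
    V≤2^w = subst (_≤ 2 ^ w) (*-identityʳ V) (V^≤ 1≤D)

    1<2^w : 1 < 2 ^ w
    1<2^w = ≤-trans 2≤V V≤2^w

    n<V₀ : n < V₀
    n<V₀ = s≤s (≤-trans (m≤m+n n d) (n≤1+n _))

    d<V₀ : d < V₀
    d<V₀ = s≤s (≤-trans (m≤n+m d n) (n≤1+n _))

    input< : n < 2 ^ w × d < 2 ^ w × r < 2 ^ w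
    input< with proj₁ (proj₂ adm)
    ... | n< ∷ d< ∷ r< ∷ [] = n< , d< , r<

    r₀ r₁ r₂ r₃ r₄ : Reg → ℕ
    r₀ = contents (n ∷ d ∷ r ∷ [])
    r₁ = r₀ [ base ↦ wrap w n ]
    r₂ = r₁ [ 1 + base ↦ wrap w (r₁ (1 + base) + d) ]
    r₃ = r₂ [ 2 + base ↦ wrap w (r₂ (2 + base) + r) ]
    r₄ = r₃ [ 4 + base ↦ wrap w (bit (r <ᵇ d)) ]

    s₄ : State
    s₄ = ⟪ r₄ , cells ⟫

    holds : Holds base (env n d r 0) s₄
    holds Fin.zero = trans (cong r₄ (+-identityʳ base))
      (trans (update-other r₃ (4 + base) _ (<⇒≢ (m<n+m base {4} z<s)))
      (trans (update-other r₂ (2 + base) _ (<⇒≢ (m<n+m base {2} z<s)))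
      (trans (update-other r₁ (1 + base) _ (<⇒≢ (m<n+m base {1} z<s)))
      (trans (update-same r₀ base _) (wrap-small {w} (proj₁ input<))))))
    holds (Fin.suc Fin.zero) = trans (cong r₄ (+-comm base 1))
      (trans (update-other r₃ (4 + base) _ (<⇒≢ (m<n+m (1 + base) {3} z<s)))
      (trans (update-other r₂ (2 + base) _ (<⇒≢ (m<n+m (1 + base) {1} z<s)))
      (trans (update-same r₁ (1 + base) _)
      (trans (cong (λ z → wrap w (z + d)) (update-other r₀ base _ (>⇒≢ (m<n+m base {1} z<s))))
        (wrap-small {w} (proj₁ (proj₂ input<)))))))
    holds (Fin.suc (Fin.suc Fin.zero)) = trans (cong r₄ (+-comm base 2))
      (trans (update-other r₃ (4 + base) _ (<⇒≢ (m<n+m (2 + base) {2} z<s)))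
      (trans (update-same r₂ (2 + base) _)
      (trans (cong (λ z → wrap w (z + r))
        (trans (update-other r₁ (1 + base) _ (>⇒≢ (m<n+m (1 + base) {1} z<s)))
          (update-other r₀ base _ (>⇒≢ (m<n+m base {2} z<s)))))
        (wrap-small {w} (proj₂ (proj₂ input<))))))
    holds (Fin.suc (Fin.suc (Fin.suc Fin.zero))) = trans (cong r₄ (+-comm base 3))
      (trans (update-other r₃ (4 + base) _ (<⇒≢ (m<n+m (3 + base) {1} z<s)))
      (trans (update-other r₂ (2 + base) _ (>⇒≢ (m<n+m (2 + base) {1} z<s)))
      (trans (update-other r₁ (1 + base) _ (>⇒≢ (m<n+m (1 + base) {2} z<s)))
        (update-other r₀ base _ (>⇒≢ (m<n+m base {3} z<s))))))

    flag : r₄ (4 + base) ≡ bit (r <ᵇ d)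
    flag = trans (update-same r₃ (4 + base) _) (wrap-small {w} (≤-<-trans (bit≤1 (r <ᵇ d)) 1<2^w))

    prologue-run : ∀ {p t s′} → w ⊢ p , s₄ ⇓ t , s′ →
      w ⊢ prologue p , initial MostOrthogonalVectors I ⇓ 4 + t , s′
    prologue-run run = ⇓seq ⇓op (⇓seq ⇓op (⇓seq ⇓op (⇓seq ⇓op run)))

    trivial-run : ¬ r < d →
      ∃[ s ] (w ⊢ program , initial MostOrthogonalVectors I ⇓ 6 , s) × reg s 0 ≡ 1
    trivial-run r≮d = _ , prologue-run (⇓else (trans flag (cong bit (<ᵇ-false (≮⇒≥ r≮d)))) ⇓const) ,
      wrap-small {w} 1<2^w

    module Nontrivial (r<d : r < d) where

      1≤n : 1 ≤ n
      1≤n = >-nonZero⁻¹ n {{VectorSets.nonZero I}}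

      1≤N : 1 ≤ N
      1≤N = ≤-trans 1≤n (n≤size r<d)

      2N<V : N + N < V
      2N<V = <-≤-trans (subst (_< V₀ ^ (deg sizeE + deg sizeE)) (cong₂ _+_ (size≡ _) (size≡ _))
        (eval-< {V₀} {env n d r 0} {λ _ → 0}
          (s≤s (s≤s z≤n) , small , (λ _ → s≤s z≤n)) (double sizeE)))
        (V₀^≤V (m≤m+n (deg sizeE + deg sizeE) (suc σ)))
        where
        small : ∀ v → lookup (env n d r 0) v < V₀
        small Fin.zero = n<V₀
        small (Fin.suc Fin.zero) = d<V₀
        small (Fin.suc (Fin.suc Fin.zero)) = <-trans r<d d<V₀
        small (Fin.suc (Fin.suc (Fin.suc Fin.zero))) = s≤s z≤n

      symbol< : ∀ i → toℕ (symbol I i) < V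
      symbol< i = <-trans (toℕ<n (symbol I i)) (<-≤-trans (n<m^1+n σ (s≤s (s≤s z≤n)))
        (V₀^≤V (m≤n+m (suc σ) (deg sizeE + deg sizeE))))

      assembled : ∃[ s′ ] (w ⊢ transform base sizeE symE thrE , s₄ ⇓ transformTime base sizeE symE thrE (N + N) , s′) ×
        (∀ {y} → y < base → reg s′ y ≡ contents (N ∷ []) y) × reg s′ (4 + base) ≡ threshold n d r ×
        (∀ a → a < N + N → mem s′ a ≡ toℕ (symbol I a)) × (∀ a → N + N ≤ a → mem s′ a ≡ 0)
      assembled = Transform.transform-run {w} {base} {V} {n} {d} {r} {N} {threshold n d r} {sizeE} {symE} {thrE}
        {λ i → toℕ (symbol I i)} {s₄}
        2≤V (<-≤-trans n<V₀ V₀≤V) (<-≤-trans d<V₀ V₀≤V) (<-trans r<d (<-≤-trans d<V₀ V₀≤V)) 2N<V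
        symbol< (λ a → <-≤-trans (contents-< (Problem.memory MostOrthogonalVectors I) (s≤s z≤n) (memory-< I) a) 2≤V)
        D V^D≤ (s≤s z≤n) sizeE≤D symE≤D (≤-trans (m≤m+n (deg thrE) k) thrE+k≤D)
        (λ i m → size≡ m) (λ i m → threshold≡ m)
        (λ m local i i< → symbol≡ I r<d m local i i<)
        (λ a 2N≤a → contents-beyond (Problem.memory MostOrthogonalVectors I) (subst (_≤ a) (sym (length-memory I)) (≤-trans (+-mono-≤ (n*d≤size r<d) (n*d≤size r<d)) 2N≤a)))
        holds

      pair-memory : Problem.memory (sequenceProblem σ Answer) (pair I r<d) ≡ applyUpTo (λ i → toℕ (symbol I i)) (N + N)
      pair-memory = trans (cong₂ _++_ (toList-map-tabulate N (symbol I)) (toList-map-tabulate N (symbol I ∘ (N +_))))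
        (sym (applyUpTo-++ (λ i → toℕ (symbol I i)) N N))

      pair-admissible : Admissible (sequenceProblem σ Answer) k w (pair I r<d)
      pair-admissible =
        ≤-trans (^-monoˡ-≤ k (≤-trans (s≤s (+-monoˡ-≤ N 1≤N)) 2N<V))
          (V^≤ (≤-trans (m≤n+m k (deg thrE)) thrE+k≤D)) ,
        <-≤-trans (≤-<-trans (m≤m+n N N) 2N<V) V≤2^w ∷ [] ,
        subst (All (_< 2 ^ w)) (sym pair-memory) (AllP.applyUpTo⁺₂ (λ i → toℕ (symbol I i)) (N + N) (λ i → <-≤-trans (symbol< i) V≤2^w))

      cells≡ : (m : ℕ → ℕ) → (∀ a → a < N + N → m a ≡ toℕ (symbol I a)) → (∀ a → N + N ≤ a → m a ≡ 0) →
        ∀ a → contents (Problem.memory (sequenceProblem σ Answer) (pair I r<d)) a ≡ m a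
      cells≡ m inside outside a with a <? N + N
      ... | yes a< = trans (cong (λ l → contents l a) pair-memory)
              (trans (contents-applyUpTo (λ i → toℕ (symbol I i)) a<) (sym (inside a a<)))
      ... | no a≮ = trans (cong (λ l → contents l a) pair-memory)
              (trans (contents-beyond (applyUpTo (λ i → toℕ (symbol I i)) (N + N)) (subst (_≤ a) (sym (length-applyUpTo (λ i → toℕ (symbol I i)) (N + N))) (≮⇒≥ a≮)))
                (sym (outside a (≮⇒≥ a≮))))

      solve-run : ∀ {t s} → w ⊢ oracle , initial (sequenceProblem σ Answer) (pair I r<d) ⇓ t , s →
        ∃[ s′ ] (w ⊢ program , initial MostOrthogonalVectors I
                   ⇓ 4 + suc (transformTime base sizeE symE thrE (N + N) + (t + 1)) , s′) ×
                reg s′ 0 ≡ verdict increasing (threshold n d r) (reg s 0)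
      solve-run {t} {s} run = after-transform assembled
        where
        After : Set
        After = ∃[ s′ ] (w ⊢ program , initial MostOrthogonalVectors I
                   ⇓ 4 + suc (transformTime base sizeE symE thrE (N + N) + (t + 1)) , s′) ×
                reg s′ 0 ≡ verdict increasing (threshold n d r) (reg s 0)
        branch : ∀ {t s′} → w ⊢ solve , s₄ ⇓ t , s′ → w ⊢ program , initial MostOrthogonalVectors I ⇓ 4 + suc t , s′
        branch run = prologue-run (⇓then (λ z → 0≢1+n (trans (sym z) (trans flag (cong bit (<ᵇ-true r<d))))) run)
        after-oracle : ∀ {s₅ s₆} → w ⊢ transform base sizeE symE thrE , s₄ ⇓ transformTime base sizeE symE thrE (N + N) , s₅ →
          reg s₅ (4 + base) ≡ threshold n d r → w ⊢ oracle , s₅ ⇓ t , s₆ → Agree base s s₆ →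
          (∀ {y} → base ≤ y → reg s₆ y ≡ reg s₅ y) → After
        after-oracle {s₅} {s₆} run₅ thr₅ run₆ agree₆ high₆ =
          let s₇ , run₇ , value = judge-run w increasing s₆ 1<2^w in
          s₇ , branch (⇓seq run₅ (⇓seq run₆ run₇)) ,
          trans value (cong₂ (verdict increasing) (trans (high₆ (m≤n+m base 4)) thr₅) (sym (proj₁ agree₆ z<s)))
        after-transform : ∃[ s′ ] (w ⊢ transform base sizeE symE thrE , s₄ ⇓ transformTime base sizeE symE thrE (N + N) , s′) ×
            (∀ {y} → y < base → reg s′ y ≡ contents (N ∷ []) y) × reg s′ (4 + base) ≡ threshold n d r ×
            (∀ a → a < N + N → mem s′ a ≡ toℕ (symbol I a)) × (∀ a → N + N ≤ a → mem s′ a ≡ 0) → After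
        after-transform (s₅ , run₅ , low₅ , thr₅ , in₅ , out₅) =
          let s₆ , run₆ , agree₆ , high₆ = simulate {b = base} {s′ = s₅} run (m≤n+m (width oracle) 3)
                                           ((λ y< → sym (low₅ y<)) , cells≡ (mem s₅) in₅ out₅)
          in after-oracle run₅ thr₅ run₆ agree₆ high₆

1≤∣↥∣ : ∀ {ε} → 0ℚ ℚ.< ε → 1 ≤ ℤ.∣ ↥ ε ∣
1≤∣↥∣ {mkℚ (ℤ.+ zero)  _ _} (ℚ.*<* (ℤ.+<+ ()))
1≤∣↥∣ {mkℚ (ℤ.+ suc _) _ _} _ = s≤s z≤n
1≤∣↥∣ {mkℚ ℤ.-[1+ _ ]  _ _} _ = s≤s z≤n

transfer : ∀ {σ Answer} → Reduction σ Answer → ∀ {ε} → 0ℚ ℚ.< ε →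
  ∃[ C ] SolvableWithin (sequenceProblem σ Answer) (SubquadraticTime ε C) →
  ∃[ ε′ ] 0ℚ ℚ.< ε′ × MostOrthogonalVectors-Subquadratic ε′
transfer {σ} {Answer} R {ε@(mkℚ _ b-1 _)} 0<ε (C , oracle , k , solves) =
  mkℚ (ℤ.+ 1) b-1 (1-coprimeTo (suc b-1)) , ℚ.*<* (ℤ.+<+ (s≤s z≤n)) ,
  -- The length is N ≤ factor (d + 1)² n, and it enters the running time with an exponent of at most
  -- two.
  (λ d → suc d ^ 4) , (1 , 4 , λ d → ≤-reflexive (sym (*-identityˡ _))) , K₀ ,
  program , e * D , answer
  where
  open Reduction R
  open Transfer R oracle k
  L K₀ b : ℕ
  L = slope base sizeE symE thrE
  -- One summand for the case in which the given algorithm dominates, one for the case in which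
  -- writing the sequences does.
  K₀ = 2 * C * (factor * factor) + 2 * L * factor
  b = suc b-1

  6≤L : 6 ≤ L
  6≤L = s≤s (s≤s (s≤s (s≤s (s≤s (s≤s z≤n)))))

  L≤ : ∀ d → L ≤ K₀ * suc d ^ 4
  L≤ d = ≤-trans (≤-trans (≤-trans (m≤n*m′ L {2} (s≤s z≤n)) (m≤m*n′ (2 * L) 1≤factor)) (m≤n+m _ (2 * C * (factor * factor))))
    (m≤m*n′ K₀ (m^n>0 (suc d) 4))

  K-oracle : ∀ d → 2 * C * (factor * suc d ^ 2 * (factor * suc d ^ 2)) ≤ K₀ * suc d ^ 4
  K-oracle d = begin
    2 * C * (factor * suc d ^ 2 * (factor * suc d ^ 2)) ≡⟨ regroup C factor (suc d) ⟩
    2 * C * (factor * factor) * suc d ^ 4 ≤⟨ *-monoˡ-≤ (suc d ^ 4) (m≤m+n (2 * C * (factor * factor)) (2 * L * factor)) ⟩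
    K₀ * suc d ^ 4 ∎
    where
    open ≤-Reasoning
    regroup : ∀ c f x → 2 * c * (f * (x * (x * 1)) * (f * (x * (x * 1)))) ≡ 2 * c * (f * f) * (x * (x * (x * (x * 1))))
    regroup = solve-∀

  K-linear : ∀ d → 2 * L * (factor * suc d ^ 2) ≤ K₀ * suc d ^ 4
  K-linear d = begin
    2 * L * (factor * suc d ^ 2) ≡⟨ *-assoc (2 * L) factor _ ⟨
    2 * L * factor * suc d ^ 2   ≤⟨ *-mono-≤ (m≤n+m _ (2 * C * (factor * factor))) (^-monoʳ-≤ (suc d) {2} {4} (s≤s (s≤s z≤n))) ⟩
    K₀ * suc d ^ 4               ∎
    where open ≤-Reasoning

  Outcome : ℕ → VectorSets → Set
  Outcome w I = ∃[ t ] ∃[ s ] (w ⊢ program , initial MostOrthogonalVectors I ⇓ t , s) × Decides I (reg s 0) ×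
    t ^ b * VectorSets.n I ^ 1 ≤ (K₀ * suc (VectorSets.d I) ^ 4) ^ b * VectorSets.n I ^ (2 * b)

  1≤n : ∀ I → 1 ≤ VectorSets.n I
  1≤n I = >-nonZero⁻¹ (VectorSets.n I) {{VectorSets.nonZero I}}

  easy : ∀ w I → Admissible MostOrthogonalVectors (e * D) w I → ¬ VectorSets.r I < VectorSets.d I → Outcome w I
  easy w I adm r≮d =
    let s , run , reg≡1 = Instance.trivial-run w I adm r≮d in
    6 , s , run , inj₁ (reg≡1 , trivial-pair I (1≤n I) (≮⇒≥ r≮d)) ,
    linear-bound b {6} {VectorSets.n I} {L} {K₀ * suc (VectorSets.d I) ^ 4} (s≤s z≤n) (1≤n I)
      (≤-trans 6≤L (m≤m*n′ L (1≤n I))) (L≤ (VectorSets.d I))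

  module _ (w : ℕ) (I : VectorSets) (adm : Admissible MostOrthogonalVectors (e * D) w I)
           (r<d : VectorSets.r I < VectorSets.d I) where
    open VectorSets I using (n; d; r)

    N : ℕ
    N = size n d r

    total : ℕ → ℕ
    total t = 4 + suc (transformTime base sizeE symE thrE (N + N) + (t + 1))

    total≤ : ∀ t → total t ≤ t + L * N
    total≤ t = begin
      4 + suc (transformTime base sizeE symE thrE (N + N) + (t + 1)) ≡⟨ regroup (transformTime base sizeE symE thrE (N + N)) t ⟩
      t + (6 + transformTime base sizeE symE thrE (N + N)) ≤⟨ +-monoʳ-≤ t (transformTime-linear base sizeE symE thrE (≤-trans (1≤n I) (n≤size r<d))) ⟩
      t + L * N ∎
      where
      open ≤-Reasoning
      regroup : ∀ x t → 4 + suc (x + (t + 1)) ≡ t + (6 + x)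
      regroup = solve-∀

    total-bound : ∀ t → t ^ b * N ^ ℤ.∣ ↥ ε ∣ ≤ C ^ b * N ^ (2 * b) →
      total t ^ b * n ^ 1 ≤ (K₀ * suc d ^ 4) ^ b * n ^ (2 * b)
    total-bound t bound =
      combined-bound ℤ.∣ ↥ ε ∣ b {total t} {t} {n} {N} {C} {L} {factor * suc d ^ 2} {K₀ * suc d ^ 4} (1≤∣↥∣ 0<ε) (s≤s z≤n) (1≤n I)
        (n≤size r<d) (size≤ r<d (1≤n I)) bound (total≤ t) (K-oracle d) (K-linear d)

    finish : ∀ t s → w ⊢ oracle , initial (sequenceProblem σ Answer) (pair I r<d) ⇓ t , s →
      Answer (pair I r<d) (reg s 0) → t ^ b * N ^ ℤ.∣ ↥ ε ∣ ≤ C ^ b * N ^ (2 * b) → Outcome w I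
    finish t s run ans bound =
      let s′ , run′ , reg≡ = Instance.Nontrivial.solve-run w I adm r<d run in
      total t , s′ , run′ , subst (Decides I) (sym reg≡) (decides I r<d (reg s 0) ans) , total-bound t bound

    hard : Outcome w I
    hard =
      let t , s , run , ans , bound = solves w (pair I r<d) (Instance.Nontrivial.pair-admissible w I adm r<d)
      in finish t s run ans bound

  answer : ∀ w I → Admissible MostOrthogonalVectors (e * D) w I → Outcome w I
  answer w I adm with VectorSets.r I <? VectorSets.d I
  ... | no r≮d  = easy w I adm r≮d
  ... | yes r<d = hard w I adm r<d

-- Words with separators

++-split : ∀ {A : Set} (a : List A) {b} c {d} → a ++ b ≡ c ++ d →
  (∃[ e ] c ≡ a ++ e × b ≡ e ++ d) ⊎ (∃[ e ] a ≡ c ++ e × d ≡ e ++ b)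
++-split []      c       e≡ = inj₁ (c , refl , e≡)
++-split (x ∷ a) []      e≡ = inj₂ (x ∷ a , refl , sym e≡)
++-split (x ∷ a) (y ∷ c) e≡ with ∷-injective e≡
... | refl , e≡′ with ++-split a c e≡′
... | inj₁ (e , refl , r) = inj₁ (e , refl , r)
... | inj₂ (e , refl , r) = inj₂ (e , refl , r)

Infix : ∀ {A : Set} → List A → List A → Set
Infix z x = ∃[ p ] ∃[ q ] p ++ z ++ q ≡ x

infix-refl : ∀ {A : Set} {x : List A} → Infix x x
infix-refl {x = x} = [] , [] , ++-identityʳ x

infix-++ˡ : ∀ {A : Set} {z y x : List A} → Infix (z ++ y) x → Infix z x
infix-++ˡ {z = z} {y} (p , q , refl) = p , y ++ q , cong (p ++_) (sym (++-assoc z y q))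

infix-++ʳ : ∀ {A : Set} (z : List A) {y x : List A} → Infix (z ++ y) x → Infix y x
infix-++ʳ z {y} (p , q , refl) = p ++ z , q , trans (++-assoc p z (y ++ q)) (cong (p ++_) (sym (++-assoc z y q)))

infix⇒⊆ : ∀ {A : Set} {z x : List A} → Infix z x → z ⊆ x
infix⇒⊆ {z = z} (p , q , refl) = ++⁺ˡ p (++⁺ʳ q ⊆-refl)

dist-refl : ∀ {σ} (a : Fin σ) → dist a a ≡ 0
dist-refl a with a Fin.≟ a
... | yes _ = refl
... | no a≢a = contradiction refl a≢a

dist-≢ : ∀ {σ} {a b : Fin σ} → a ≢ b → dist a b ≡ 1
dist-≢ {a = a} {b} a≢b with a Fin.≟ b
... | yes a≡b = contradiction a≡b a≢b
... | no _ = refl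

dist≤1 : ∀ {σ} (a b : Fin σ) → dist a b ≤ 1
dist≤1 a b with a Fin.≟ b
... | yes _ = z≤n
... | no _ = ≤-refl

dist-sym : ∀ {σ} (a b : Fin σ) → dist a b ≡ dist b a
dist-sym a b with a Fin.≟ b | b Fin.≟ a
... | yes _    | yes _   = refl
... | no _     | no _    = refl
... | yes refl | no b≢a  = contradiction refl b≢a
... | no a≢b   | yes refl = contradiction refl a≢b

module Frame {σ : ℕ} (h : Fin σ) where

  Sym : Set
  Sym = Fin σ

  plain hashes : List Sym → ℕ
  plain []       = 0
  plain (a ∷ z)  = dist a h + plain z
  hashes []      = 0
  hashes (a ∷ z) = (1 ∸ dist a h) + hashes z

  plain-++ : ∀ y z → plain (y ++ z) ≡ plain y + plain z
  plain-++ []      z = refl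
  plain-++ (a ∷ y) z = trans (cong (dist a h +_) (plain-++ y z)) (sym (+-assoc (dist a h) _ _))

  hashes-++ : ∀ y z → hashes (y ++ z) ≡ hashes y + hashes z
  hashes-++ []      z = refl
  hashes-++ (a ∷ y) z = trans (cong ((1 ∸ dist a h) +_) (hashes-++ y z)) (sym (+-assoc (1 ∸ dist a h) _ _))

  plain≤length : ∀ z → plain z ≤ length z
  plain≤length []      = z≤n
  plain≤length (a ∷ z) = +-mono-≤ (dist≤1 a h) (plain≤length z)

  hashes-replicate : ∀ n → hashes (replicate n h) ≡ n
  hashes-replicate zero    = refl
  hashes-replicate (suc n) = cong₂ _+_ (cong (1 ∸_) (dist-refl h)) (hashes-replicate n)

  plain-replicate : ∀ n → plain (replicate n h) ≡ 0
  plain-replicate zero    = refl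
  plain-replicate (suc n) = cong₂ _+_ (dist-refl h) (plain-replicate n)

  Plain : List Sym → Set
  Plain = All (_≢ h)

  plain-Plain : ∀ {z} → Plain z → plain z ≡ length z
  plain-Plain []       = refl
  plain-Plain (n ∷ ns) = cong₂ _+_ (dist-≢ n) (plain-Plain ns)

  hashes-Plain : ∀ {z} → Plain z → hashes z ≡ 0
  hashes-Plain []       = refl
  hashes-Plain (n ∷ ns) = cong₂ _+_ (cong (1 ∸_) (dist-≢ n)) (hashes-Plain ns)

  hashes-⊆ : ∀ {y z} → y ⊆ z → hashes y ≤ hashes z
  hashes-⊆ []         = z≤n
  hashes-⊆ (a ∷ʳ s)   = ≤-trans (hashes-⊆ s) (m≤n+m _ (1 ∸ dist a h))
  hashes-⊆ (refl ∷ s) = +-monoʳ-≤ _ (hashes-⊆ s)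

  frame : ℕ → List (List Sym) → List Sym
  frame L []       = replicate L h
  frame L (u ∷ us) = replicate L h ++ u ++ frame L us

  prefix-replicate : ∀ n {z q} → z ++ q ≡ replicate n h → ∃[ i ] ∃[ j ] z ≡ replicate i h × q ≡ replicate j h
  prefix-replicate n       {[]}    e≡ = 0 , n , refl , e≡
  prefix-replicate (suc n) {a ∷ z} e≡ with ∷-injective e≡
  ... | refl , e≡′ with prefix-replicate n {z} e≡′
  ... | i , j , refl , q≡ = suc i , j , refl , q≡

  Short : ℕ → List Sym → Set
  Short B u = Plain u × length u ≤ B

  plain-short : ∀ {B u} → Short B u → plain u ≤ B
  plain-short {u = u} (_ , ≤B) = ≤-trans (plain≤length u) ≤B

  module _ {B L : ℕ} (2B≤L : B + B ≤ L) where

    -- A prefix that leaves the first run contains all of it. Every block entered has at most B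
    -- plain symbols and is preceded by a run of at least 2B hashes, so a surplus of B hashes
    -- remains. The surplus is there to pay for part of an earlier block.
    frame-prefix : ∀ us {z q} → All (Short B) us → z ++ q ≡ frame L us →
      (∃[ i ] ∃[ j ] z ≡ replicate i h × replicate i h ++ replicate j h ≡ replicate L h) ⊎
      (plain z + B ≤ hashes z × L ≤ hashes z)
    frame-prefix [] {z} {q} _ e≡ with prefix-replicate L {z} e≡
    ... | i , j , refl , refl = inj₁ (i , j , refl , e≡)
    frame-prefix (u ∷ us) {z} {q} (s ∷ ss) e≡ with ++-split z (replicate L h) e≡
    ... | inj₁ (e , e≡₁ , _) with prefix-replicate L {z} (sym e≡₁)
    ... | i , j , refl , refl = inj₁ (i , j , refl , sym e≡₁)
    frame-prefix (u ∷ us) {z} {q} (s ∷ ss) e≡ | inj₂ (e , refl , e≡₁)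
      with ++-split e u (sym e≡₁)
    ... | inj₁ (e′ , refl , _) = inj₂ (≤-trans plain≤ hashes≥ , hashes≥)
      where
      hashes≥ : L ≤ hashes (replicate L h ++ e)
      hashes≥ = subst (L ≤_) (sym (trans (hashes-++ (replicate L h) e) (cong (_+ hashes e) (hashes-replicate L)))) (m≤m+n L _)
      plain≤ : plain (replicate L h ++ e) + B ≤ L
      plain≤ = ≤-trans (+-monoˡ-≤ B (subst (_≤ B) (sym (trans (plain-++ (replicate L h) e) (cong (_+ plain e) (plain-replicate L))))
        (≤-trans (m≤m+n (plain e) (plain e′)) (subst (_≤ B) (plain-++ e e′) (plain-short s))))) 2B≤L
    ... | inj₂ (e′ , refl , e≡₂) = inj₂ (plain≤ , hashes≥)
      where
      hashes≡ : hashes (replicate L h ++ u ++ e′) ≡ L + (hashes u + hashes e′)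
      hashes≡ = trans (hashes-++ (replicate L h) _) (cong₂ _+_ (hashes-replicate L) (hashes-++ u e′))
      plain≡ : plain (replicate L h ++ u ++ e′) ≡ plain u + plain e′
      plain≡ = trans (plain-++ (replicate L h) _) (cong₂ _+_ (plain-replicate L) (plain-++ u e′))
      hashes≥ : L ≤ hashes (replicate L h ++ u ++ e′)
      hashes≥ = subst (L ≤_) (sym hashes≡) (m≤m+n L _)
      plain≤ : plain (replicate L h ++ u ++ e′) + B ≤ hashes (replicate L h ++ u ++ e′)
      plain≤ rewrite hashes≡ | plain≡ with frame-prefix us {e′} ss (sym e≡₂)
      ... | inj₁ (i , _ , refl , _) rewrite plain-replicate i | +-identityʳ (plain u) =
        ≤-trans (+-monoˡ-≤ B (plain-short s)) (≤-trans 2B≤L (m≤m+n L _))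
      ... | inj₂ (p , _) = begin
        plain u + plain e′ + B   ≡⟨ +-assoc (plain u) _ _ ⟩
        plain u + (plain e′ + B) ≤⟨ +-mono-≤ (plain-short s) p ⟩
        B + hashes e′            ≤⟨ +-mono-≤ (≤-trans (m≤m+n B B) 2B≤L) (m≤n+m _ (hashes u)) ⟩
        L + (hashes u + hashes e′) ∎
        where open ≤-Reasoning

    -- Either the infix stays within a single block and its two runs, or it extends past the run
    -- behind the block at which it starts; then the surplus from `frame-prefix` pays for the part
    -- of that block. An infix of the last run is placed around an empty block, which accounts for
    -- `P []`.
    frame-infix : ∀ {P : List Sym → Set} us {z} → (∀ {u} → P u → Short B u) → P [] → All P us →
      Infix z (frame L us) →
      (∃[ u ] P u × Infix z (replicate L h ++ u ++ replicate L h)) ⊎ (plain z ≤ hashes z × L ≤ hashes z)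
    frame-infix [] {z} _ P[] _ (p , q , e≡) = inj₁ ([] , P[] , p , q ++ replicate L h , lemma)
      where
      lemma : p ++ z ++ q ++ replicate L h ≡ replicate L h ++ replicate L h
      lemma = trans (cong (p ++_) (sym (++-assoc z q (replicate L h))))
        (trans (sym (++-assoc p (z ++ q) (replicate L h))) (cong (_++ replicate L h) e≡))
    frame-infix (u ∷ us) {z} P⇒ P[] (Pu ∷ Ps) (p , q , e≡)
      with ++-split p (replicate L h ++ u) (trans e≡ (sym (++-assoc (replicate L h) u (frame L us))))
    ... | inj₂ (e , refl , e≡₁) = frame-infix us P⇒ P[] Ps (e , q , sym e≡₁)
    ... | inj₁ (e , e≡₁ , e≡₂) with ++-split z e e≡₂
    ... | inj₁ (e′ , refl , _) = inj₁ (u , Pu , p , e′ ++ replicate L h , (begin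
        p ++ z ++ e′ ++ replicate L h   ≡⟨ cong (p ++_) (++-assoc z e′ _) ⟨
        p ++ (z ++ e′) ++ replicate L h ≡⟨ ++-assoc p (z ++ e′) _ ⟨
        (p ++ z ++ e′) ++ replicate L h ≡⟨ cong (_++ replicate L h) e≡₁ ⟨
        (replicate L h ++ u) ++ replicate L h ≡⟨ ++-assoc (replicate L h) u _ ⟩
        replicate L h ++ u ++ replicate L h ∎))
      where open ≡-Reasoning
    ... | inj₂ (e′ , refl , e≡₃) with frame-prefix us {e′} (All.map P⇒ Ps) (sym e≡₃)
    ... | inj₁ (i , j , refl , e≡₄) = inj₁ (u , Pu , p , replicate j h , (begin
        p ++ (e ++ replicate i h) ++ replicate j h ≡⟨ cong (p ++_) (++-assoc e _ _) ⟩
        p ++ e ++ replicate i h ++ replicate j h   ≡⟨ cong (λ r → p ++ e ++ r) e≡₄ ⟩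
        p ++ e ++ replicate L h                    ≡⟨ ++-assoc p e _ ⟨
        (p ++ e) ++ replicate L h                  ≡⟨ cong (_++ replicate L h) e≡₁ ⟨
        (replicate L h ++ u) ++ replicate L h      ≡⟨ ++-assoc (replicate L h) u _ ⟩
        replicate L h ++ u ++ replicate L h        ∎))
      where open ≡-Reasoning
    ... | inj₂ (p≤ , L≤) = inj₂ (plain≤ , ≤-trans L≤ (subst (hashes e′ ≤_) (sym (hashes-++ e e′)) (m≤n+m _ (hashes e))))
      where
      open ≤-Reasoning
      plain≤ : plain (e ++ e′) ≤ hashes (e ++ e′)
      plain≤ = begin
        plain (e ++ e′)    ≡⟨ plain-++ e e′ ⟩
        plain e + plain e′ ≤⟨ +-monoˡ-≤ (plain e′) (≤-trans (m≤n+m _ (plain p))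
            (≤-trans (≤-reflexive (trans (sym (plain-++ p e)) (trans (cong plain (sym e≡₁)) (plain-++ (replicate L h) u))))
            (≤-trans (≤-reflexive (cong (_+ plain u) (plain-replicate L))) (plain-short (P⇒ Pu))))) ⟩
        B + plain e′       ≡⟨ +-comm B _ ⟩
        plain e′ + B       ≤⟨ p≤ ⟩
        hashes e′          ≤⟨ m≤n+m _ (hashes e) ⟩
        hashes e + hashes e′ ≡⟨ hashes-++ e e′ ⟨
        hashes (e ++ e′)   ∎

-- Common subsequences

module _ {σ : ℕ} (α β : Fin σ) (M : ℕ) where

  core : (ℕ → Fin σ) → ℕ → List (Fin σ)
  core w zero    = []
  core w (suc K) = replicate M α ++ replicate M β ++ w 0 ∷ core (w ∘ suc) K

  length-core : ∀ w K → length (core w K) ≡ K * (M + M + 1)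
  length-core w zero    = refl
  length-core w (suc K)
    rewrite length-++ (replicate M α) {replicate M β ++ w 0 ∷ core (w ∘ suc) K}
          | length-++ (replicate M β) {w 0 ∷ core (w ∘ suc) K}
          | length-replicate M {α} | length-replicate M {β} | length-core (w ∘ suc) K =
    regroup M (K * (M + M + 1))
    where
    regroup : ∀ m k → m + (m + suc k) ≡ m + m + 1 + k
    regroup = solve-∀

  core-All : ∀ {P : Fin σ → Set} → P α → P β → ∀ w → (∀ k → P (w k)) → ∀ K → All P (core w K)
  core-All Pα Pβ w Pw zero    = []
  core-All Pα Pβ w Pw (suc K) =
    AllP.++⁺ (AllP.replicate⁺ M Pα) (AllP.++⁺ (AllP.replicate⁺ M Pβ) (Pw 0 ∷ core-All Pα Pβ (w ∘ suc) (Pw ∘ suc) K))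

module _ {σ : ℕ} where

  ham agreement : (w v : ℕ → Fin σ) → ℕ → ℕ
  ham w v zero    = 0
  ham w v (suc K) = dist (w 0) (v 0) + ham (w ∘ suc) (v ∘ suc) K
  agreement w v zero    = 0
  agreement w v (suc K) = (1 ∸ dist (w 0) (v 0)) + agreement (w ∘ suc) (v ∘ suc) K

  ham+agreement : ∀ w v K → ham w v K + agreement w v K ≡ K
  ham+agreement w v zero    = refl
  ham+agreement w v (suc K) = trans (regroup (dist (w 0) (v 0)) _ _ _)
    (cong₂ _+_ (m+[n∸m]≡n (dist≤1 (w 0) (v 0))) (ham+agreement (w ∘ suc) (v ∘ suc) K))
    where
    regroup : ∀ a b c d → a + b + (c + d) ≡ a + c + (b + d)
    regroup = solve-∀

module _ {A : Set} where

  Common : List A → List A → ℕ → Set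
  Common x y ℓ = ∃[ z ] z ⊆ x × z ⊆ y × ℓ ≤ length z

  CommonBound : List A → List A → ℕ → Set
  CommonBound x y ℓ = ∀ z → z ⊆ x → z ⊆ y → length z ≤ ℓ

  common-++ : ∀ {x y x′ y′ ℓ ℓ′} → Common x y ℓ → Common x′ y′ ℓ′ → Common (x ++ x′) (y ++ y′) (ℓ + ℓ′)
  common-++ (z , a , b , c) (z′ , a′ , b′ , c′) =
    z ++ z′ , ++⁺ a a′ , ++⁺ b b′ , subst (_ ≤_) (sym (length-++ z)) (+-mono-≤ c c′)

  ⊆-tail : ∀ {e a : A} {z x} → e ∷ z ⊆ a ∷ x → z ⊆ x
  ⊆-tail (_ ∷ʳ s) = ∷ˡ⁻ s
  ⊆-tail (_ ∷ s)  = s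

  ⊆-skip : ∀ n {a e : A} {z x} → e ≢ a → e ∷ z ⊆ replicate n a ++ x → e ∷ z ⊆ x
  ⊆-skip zero    e≢a s            = s
  ⊆-skip (suc n) e≢a (_ ∷ʳ s)     = ⊆-skip n e≢a s
  ⊆-skip (suc n) e≢a (e≡a ∷ s)    = contradiction e≡a e≢a

  ⊆-skips : ∀ n {a : A} {z x} → All (_≢ a) z → z ⊆ replicate n a ++ x → z ⊆ x
  ⊆-skips n []        s = minimum _
  ⊆-skips n (e≢a ∷ _) s = ⊆-skip n e≢a s

  ⊆-replicate : ∀ n {a : A} {z} → All (_≢ a) z → z ⊆ replicate n a → z ≡ []
  ⊆-replicate n {a} {z} ns s with ⊆-skips n {a} {z} {[]} ns (subst (z ⊆_) (sym (++-identityʳ _)) s)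
  ... | [] = refl

  ⊆-++⁻ : ∀ x {y z : List A} → z ⊆ x ++ y → ∃[ z₁ ] ∃[ z₂ ] z ≡ z₁ ++ z₂ × z₁ ⊆ x × z₂ ⊆ y
  ⊆-++⁻ []      {z = z} s = [] , z , refl , [] , s
  ⊆-++⁻ (a ∷ x) (_ ∷ʳ s) with ⊆-++⁻ x s
  ... | z₁ , z₂ , refl , s₁ , s₂ = z₁ , z₂ , refl , a ∷ʳ s₁ , s₂
  ⊆-++⁻ (a ∷ x) (refl ∷ s) with ⊆-++⁻ x s
  ... | z₁ , z₂ , refl , s₁ , s₂ = a ∷ z₁ , z₂ , refl , refl ∷ s₁ , s₂

  ++⁻-⊆ : ∀ z₁ {z₂ x : List A} → z₁ ++ z₂ ⊆ x → ∃[ x₁ ] ∃[ x₂ ] x ≡ x₁ ++ x₂ × z₁ ⊆ x₁ × z₂ ⊆ x₂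
  ++⁻-⊆ []       {x = x} s = [] , x , refl , [] , s
  ++⁻-⊆ (e ∷ z₁) (a ∷ʳ s) with ++⁻-⊆ (e ∷ z₁) s
  ... | x₁ , x₂ , refl , s₁ , s₂ = a ∷ x₁ , x₂ , refl , a ∷ʳ s₁ , s₂
  ++⁻-⊆ (e ∷ z₁) (refl ∷ s) with ++⁻-⊆ z₁ s
  ... | x₁ , x₂ , refl , s₁ , s₂ = e ∷ x₁ , x₂ , refl , refl ∷ s₁ , s₂

  -- Deleting the first symbol of z allows the first symbol of both words to be deleted, whatever it
  -- was matched with. A shared prefix is thus worth at most its length, without any claim that it
  -- is matched with itself.
  strip-common : ∀ s {x y z : List A} → z ⊆ s ++ x → z ⊆ s ++ y →
    ∃[ z′ ] z′ ⊆ x × z′ ⊆ y × length z ≤ length s + length z′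
  strip-common []      {z = z} sx sy = z , sx , sy , ≤-refl
  strip-common (a ∷ s) {z = []} sx sy = [] , minimum _ , minimum _ , z≤n
  strip-common (a ∷ s) {z = e ∷ z} sx sy with strip-common s (⊆-tail sx) (⊆-tail sy)
  ... | z′ , sx′ , sy′ , ≤z′ = z′ , sx′ , sy′ , s≤s ≤z′

module _ {σ : ℕ} {α β : Fin σ} {M : ℕ} where

  common-core : ∀ w v K → Common (core α β M w K) (core α β M v K) (K * (M + M) + agreement w v K)
  common-core w v zero    = [] , [] , [] , z≤n
  common-core w v (suc K) = subst (Common _ _) (regroup M (K * (M + M)) (1 ∸ dist (w 0) (v 0)) (agreement (w ∘ suc) (v ∘ suc) K))
    (common-++ (run α) (common-++ (run β) (common-++ head (common-core (w ∘ suc) (v ∘ suc) K))))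
    where
    run : ∀ a → Common (replicate M a) (replicate M a) M
    run a = replicate M a , ⊆-refl , ⊆-refl , ≤-reflexive (sym (length-replicate M))
    head : Common (w 0 ∷ []) (v 0 ∷ []) (1 ∸ dist (w 0) (v 0))
    head with w 0 Fin.≟ v 0
    ... | yes w≡v = w 0 ∷ [] , ⊆-refl , (w≡v ∷ []) , ≤-refl
    ... | no _    = [] , minimum _ , minimum _ , z≤n
    regroup : ∀ m k d a → m + (m + (d + (k + a))) ≡ m + m + k + (d + a)
    regroup = solve-∀

  Proper : (ℕ → Fin σ) → Set
  Proper w = ∀ k → w k ≢ α × w k ≢ β

  -- A match between different slots wastes a whole separator.
  mismatch : ∀ {e z} v K → e ≢ α → e ≢ β → suc K ≤ M + M + 1 → e ∷ z ⊆ core α β M v K →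
    M + M + length (e ∷ z) ≤ suc K * (M + M)
  mismatch {e} {z} v (suc K) e≢α e≢β K≤ s = begin
    M + M + length (e ∷ z)                  ≤⟨ +-monoʳ-≤ (M + M) (length-mono-≤ (⊆-skip M e≢β (⊆-skip M e≢α s))) ⟩
    M + M + suc (length (core α β M (v ∘ suc) K)) ≡⟨ cong (λ l → M + M + suc l) (length-core α β M (v ∘ suc) K) ⟩
    M + M + suc (K * (M + M + 1))     ≡⟨ regroup M K ⟩
    (M + M + K * (M + M)) + suc K     ≤⟨ +-monoʳ-≤ (M + M + K * (M + M)) (s≤s⁻¹ (≤-trans K≤ (≤-reflexive (+-comm (M + M) 1)))) ⟩
    (M + M + K * (M + M)) + (M + M)   ≡⟨ +-comm (M + M + K * (M + M)) (M + M) ⟩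
    suc (suc K) * (M + M)             ∎
    where
    open ≤-Reasoning
    regroup : ∀ m k → m + m + suc (k * (m + m + 1)) ≡ (m + m + k * (m + m)) + suc k
    regroup = solve-∀

  -- Behind the shared separator both words begin with a bit. If z uses both bits or neither,
  -- induction applies. If it uses only one, the match in the other word lies in a later slot, since
  -- no symbol of a separator equals a bit; the separator lost there outweighs all remaining bits
  -- because K ≤ 2 M + 1.
  core-bound : ∀ w v K → Proper w → Proper v → K ≤ M + M + 1 →
    CommonBound (core α β M w K) (core α β M v K) (K * (M + M) + agreement w v K)
  core-bound w v zero    _  _  _  []  _ _ = z≤n
  core-bound w v (suc K) pw pv K≤ z sx sy
    with strip-common (replicate M α ++ replicate M β)
           (subst (z ⊆_) (sym (++-assoc (replicate M α) (replicate M β) _)) sx)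
           (subst (z ⊆_) (sym (++-assoc (replicate M α) (replicate M β) _)) sy)
  ... | z′ , sx′ , sy′ , ≤z′ = ≤-trans ≤z′ (subst (λ l → l + length z′ ≤ suc K * (M + M) + agreement w v (suc K)) (sym sep) (rest z′ sx′ sy′))
    where
    open ≤-Reasoning
    sep : length (replicate M α ++ replicate M β) ≡ M + M
    sep = trans (length-++ (replicate M α)) (cong₂ _+_ (length-replicate M) (length-replicate M))
    IH : CommonBound (core α β M (w ∘ suc) K) (core α β M (v ∘ suc) K) (K * (M + M) + agreement (w ∘ suc) (v ∘ suc) K)
    IH = core-bound (w ∘ suc) (v ∘ suc) K (pw ∘ suc) (pv ∘ suc) (≤-trans (n≤1+n K) K≤)
    regroup : ∀ m k d a → m + (d + (k + a)) ≡ m + k + (d + a)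
    regroup = solve-∀
    rest : ∀ z → z ⊆ w 0 ∷ core α β M (w ∘ suc) K → z ⊆ v 0 ∷ core α β M (v ∘ suc) K →
      M + M + length z ≤ suc K * (M + M) + agreement w v (suc K)
    rest z (_ ∷ʳ s) (_ ∷ʳ t) = begin
      M + M + length z ≤⟨ +-monoʳ-≤ (M + M) (≤-trans (IH z s t) (m≤n+m _ (1 ∸ dist (w 0) (v 0)))) ⟩
      M + M + ((1 ∸ dist (w 0) (v 0)) + (K * (M + M) + agreement (w ∘ suc) (v ∘ suc) K)) ≡⟨ regroup (M + M) (K * (M + M)) (1 ∸ dist (w 0) (v 0)) _ ⟩
      suc K * (M + M) + agreement w v (suc K) ∎
    rest (e ∷ z) (e≡w ∷ s) (e≡v ∷ t) = begin
      M + M + (1 + length z) ≤⟨ +-monoʳ-≤ (M + M) (+-mono-≤ (≤-reflexive (cong (1 ∸_) (sym (trans (cong (dist (w 0)) (trans (sym e≡v) e≡w)) (dist-refl (w 0)))))) (IH z s t)) ⟩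
      M + M + ((1 ∸ dist (w 0) (v 0)) + (K * (M + M) + agreement (w ∘ suc) (v ∘ suc) K)) ≡⟨ regroup (M + M) (K * (M + M)) (1 ∸ dist (w 0) (v 0)) _ ⟩
      suc K * (M + M) + agreement w v (suc K) ∎
    rest (e ∷ z) (refl ∷ s) (_ ∷ʳ t) =
      ≤-trans (mismatch (v ∘ suc) K (proj₁ (pw 0)) (proj₂ (pw 0)) K≤ t) (m≤m+n _ (agreement w v (suc K)))
    rest (e ∷ z) (_ ∷ʳ s) (refl ∷ t) =
      ≤-trans (mismatch (w ∘ suc) K (proj₁ (pv 0)) (proj₂ (pv 0)) K≤ s) (m≤m+n _ (agreement w v (suc K)))

  
module _ {A : Set} where

  -- The symbols c precede the core in one word and follow it in the other. A common subsequence
  -- with a c in it consists of c only, and any other is common to the two cores.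
  choice-bound : ∀ {c : A} {C₁ C₂ E} → All (_≢ c) C₁ → All (_≢ c) C₂ → CommonBound C₁ C₂ E →
    CommonBound (replicate E c ++ C₁) (C₂ ++ replicate E c) E
  choice-bound {c} {C₁} {C₂} {E} n₁ n₂ bound z sx sy
    with ⊆-++⁻ (replicate E c) sx | ⊆-++⁻ C₂ sy
  ... | y₁ , y₂ , refl , t₁ , t₂ | z₁ , z₂ , e , s₁ , s₂ with ++-split y₁ z₁ e
  ... | inj₁ (f , refl , refl)
    with ⊆-replicate E (All-resp-⊆ (⊆-trans (++⁺ˡ f ⊆-refl) t₂) n₁) s₂
       | ⊆-replicate E (All-resp-⊆ (⊆-trans (++⁺ʳ f ⊆-refl) s₁) n₂) t₁
  ... | refl | refl = bound (f ++ []) t₂ (subst (_⊆ C₂) (sym (++-identityʳ f)) s₁)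
  choice-bound {c} {C₁} {C₂} {E} n₁ n₂ bound z sx sy
      | y₁ , y₂ , refl , t₁ , t₂ | z₁ , z₂ , e , s₁ , s₂ | inj₂ (f , refl , refl)
    with ⊆-replicate E (All-resp-⊆ t₂ n₁) (⊆-trans (++⁺ˡ f ⊆-refl) s₂)
  ... | refl = subst (λ l → length l ≤ E) (sym (++-identityʳ (z₁ ++ f))) (subst (length (z₁ ++ f) ≤_) (length-replicate E) (length-mono-≤ t₁))

-- Common subsequences of framed words

module _ {σ : ℕ} (h : Fin σ) where
  open Frame h

  replicate-+ : ∀ m n → replicate (m + n) h ≡ replicate m h ++ replicate n h
  replicate-+ zero    n = refl
  replicate-+ (suc m) n = cong (h ∷_) (replicate-+ m n)

  blocks : ℕ → List (List Sym) → List Sym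
  blocks L []       = []
  blocks L (u ∷ us) = (replicate L h ++ u) ++ blocks L us

  frame-++ : ∀ {L} us vs → frame L (us ++ vs) ≡ blocks L us ++ frame L vs
  frame-++ []       vs = refl
  frame-++ {L} (u ∷ us) vs = trans (cong (λ r → replicate L h ++ u ++ r) (frame-++ us vs))
    (trans (sym (++-assoc (replicate L h) u _)) (sym (++-assoc (replicate L h ++ u) _ _)))

  hashes-frame : ∀ L {us} → All Plain us → hashes (frame L us) ≡ suc (length us) * L
  hashes-frame L []       = trans (hashes-replicate L) (sym (+-identityʳ L))
  hashes-frame L {u ∷ us} (n ∷ ns) = trans (hashes-++ (replicate L h) _) (cong₂ _+_ (hashes-replicate L)
    (trans (hashes-++ u _) (cong₂ _+_ (hashes-Plain n) (hashes-frame L ns))))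

  ⊆-hashes : ∀ n {z} → z ⊆ replicate n h → length z ≡ hashes z
  ⊆-hashes n {z} s = lemma (All-resp-⊆ s (AllP.replicate⁺ n refl))
    where
    lemma : ∀ {z} → All (_≡ h) z → length z ≡ hashes z
    lemma []          = refl
    lemma (refl ∷ es) = cong₂ _+_ (cong (1 ∸_) (sym (dist-refl h))) (lemma es)

  module _ {B L E P′ : ℕ} (2B≤L : B + B ≤ L) where

    Partner : List Sym → List Sym → Set
    Partner v u = Short B u × CommonBound u v E

    -- A match that spans a whole run # ^ L wastes more hashes than v has symbols.
    piece-bound : ∀ {us v x} → Short B v → All (Partner v) us → Infix x (frame L us) →
      CommonBound x v (E + hashes x)
    piece-bound {us} {v} {x} (pv , v≤B) ps inf z sx sv
      with frame-infix 2B≤L {Partner v} us proj₁ (([] , z≤n) , λ { [] _ _ → z≤n }) ps inf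
    ... | inj₂ (_ , L≤) = begin
      length z     ≤⟨ length-mono-≤ sv ⟩
      length v     ≤⟨ v≤B ⟩
      B            ≤⟨ ≤-trans (m≤m+n B B) (≤-trans 2B≤L L≤) ⟩
      hashes x     ≤⟨ m≤n+m _ E ⟩
      E + hashes x ∎
      where open ≤-Reasoning
    ... | inj₁ (u , (_ , bound) , inf′)
      with ⊆-++⁻ u (⊆-skips L (All-resp-⊆ sv pv) (⊆-trans sx (infix⇒⊆ inf′)))
    ... | z₁ , z₂ , refl , s₁ , s₂
      with ⊆-replicate L (All-resp-⊆ (⊆-trans (++⁺ˡ z₁ ⊆-refl) sv) pv) s₂
    ... | refl = ≤-trans (bound (z₁ ++ []) (subst (_⊆ u) (sym (++-identityʳ z₁)) s₁) sv) (m≤m+n E _)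

    -- z is cut along the runs and blocks of y, and x is cut along the parts of z. A run of y gains
    -- at most the hashes in its piece of x, a block at most E more than that by `piece-bound`. The
    -- pieces are disjoint, so each hash of x is charged once.
    frame-bound : ∀ {us} vs {x} → All (Short B) vs → All (λ v → All (Partner v) us) vs →
      Infix x (frame L us) → CommonBound x (frame L vs ++ replicate P′ h) (hashes x + length vs * E)
    frame-bound [] {x} _ _ _ z sx sy = subst (length z ≤_) (sym (+-identityʳ _))
      (≤-trans (≤-reflexive (⊆-hashes (L + P′) (subst (z ⊆_) (sym (replicate-+ L P′)) sy))) (hashes-⊆ sx))
    frame-bound {us} (v ∷ vs) {x} (s ∷ ss) (p ∷ ps) inf z sx sy
      with ⊆-++⁻ (replicate L h) (subst (z ⊆_) (trans (++-assoc (replicate L h) _ _) (cong (replicate L h ++_) (++-assoc v _ _))) sy)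
    ... | z₁ , z′ , refl , t₁ , t′ with ⊆-++⁻ v t′
    ... | z₂ , z₃ , refl , t₂ , t₃ with ++⁻-⊆ z₁ sx
    ... | x₁ , x′ , refl , s₁ , s′ with ++⁻-⊆ z₂ s′
    ... | x₂ , x₃ , refl , s₂ , s₃ = begin
      length (z₁ ++ z₂ ++ z₃)            ≡⟨ trans (length-++ z₁) (cong (length z₁ +_) (length-++ z₂)) ⟩
      length z₁ + (length z₂ + length z₃) ≤⟨ +-mono-≤ (≤-trans (≤-reflexive (⊆-hashes L t₁)) (hashes-⊆ s₁))
          (+-mono-≤ (piece-bound s p (infix-++ˡ (infix-++ʳ x₁ inf)) z₂ s₂ t₂)
                    (frame-bound vs ss ps (infix-++ʳ x₂ (infix-++ʳ x₁ inf)) z₃ s₃ t₃)) ⟩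
      hashes x₁ + (E + hashes x₂ + (hashes x₃ + length vs * E)) ≡⟨ regroup (hashes x₁) E (hashes x₂) (hashes x₃) (length vs * E) ⟩
      hashes x₁ + (hashes x₂ + hashes x₃) + (E + length vs * E) ≡⟨ cong (_+ (E + length vs * E)) (trans (hashes-++ x₁ _) (cong (hashes x₁ +_) (hashes-++ x₂ x₃))) ⟨
      hashes (x₁ ++ x₂ ++ x₃) + (E + length vs * E) ∎
      where
      open ≤-Reasoning
      regroup : ∀ a e b c f → a + (e + b + (c + f)) ≡ a + (b + c) + (e + f)
      regroup = solve-∀

  padded-bound : ∀ {B L E P P′} (2B≤L : B + B ≤ L) {us} vs → All (Short B) vs →
    All (λ v → All (Partner {B} {L} {E} {P′} 2B≤L v) us) vs →
    CommonBound (frame L us) (replicate P h ++ frame L vs ++ replicate P′ h) (hashes (frame L us) + length vs * E)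
  padded-bound {B} {L} {E} {P} {P′} 2B≤L {us} vs ss ps z sx sy with ⊆-++⁻ (replicate P h) sy
  ... | z₁ , z₂ , refl , t₁ , t₂ with ++⁻-⊆ z₁ sx
  ... | x₁ , x₂ , x≡ , s₁ , s₂ = begin
    length (z₁ ++ z₂)                         ≡⟨ length-++ z₁ ⟩
    length z₁ + length z₂                     ≤⟨ +-mono-≤ (≤-trans (≤-reflexive (⊆-hashes P t₁)) (hashes-⊆ s₁))
        (frame-bound {B} {L} {E} {P′} 2B≤L vs ss ps
          (infix-++ʳ x₁ (subst (λ x → Infix x (frame L us)) x≡ infix-refl)) z₂ s₂ t₂) ⟩
    hashes x₁ + (hashes x₂ + length vs * E)   ≡⟨ +-assoc (hashes x₁) _ _ ⟨
    hashes x₁ + hashes x₂ + length vs * E     ≡⟨ cong (_+ length vs * E) (trans (cong hashes x≡) (hashes-++ x₁ x₂)) ⟨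
    hashes (frame L us) + length vs * E       ∎
    where open ≤-Reasoning

  replicate-⊆ : ∀ {m n} → m ≤ n → replicate m h ⊆ replicate n h
  replicate-⊆ z≤n       = minimum _
  replicate-⊆ (s≤s m≤n) = refl ∷ replicate-⊆ m≤n

  replicate-⊆-blocks : ∀ L us → replicate (length us * L) h ⊆ blocks L us
  replicate-⊆-blocks L []       = []
  replicate-⊆-blocks L (u ∷ us) = subst (_⊆ blocks L (u ∷ us)) (sym (replicate-+ L (length us * L)))
    (++⁺ (++⁺ʳ u ⊆-refl) (replicate-⊆-blocks L us))

  replicate-⊆-frame : ∀ L us → replicate (suc (length us) * L) h ⊆ frame L us
  replicate-⊆-frame L []       = replicate-⊆ (≤-reflexive (+-identityʳ L))
  replicate-⊆-frame L (u ∷ us) = subst (_⊆ frame L (u ∷ us)) (sym (replicate-+ L (suc (length us) * L)))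
    (++⁺ ⊆-refl (++⁺ˡ u (replicate-⊆-frame L us)))

  common-replicate : ∀ {m x y} → replicate m h ⊆ x → replicate m h ⊆ y → Common x y m
  common-replicate {m} s t = replicate m h , s , t , ≤-reflexive (sym (length-replicate m))

  module _ {L : ℕ} (f : List Sym) where

    common-block : ∀ {u v ℓ} → Common u v ℓ → Common (replicate L h ++ u) (replicate L h ++ v) (L + ℓ)
    common-block = common-++ (common-replicate ⊆-refl ⊆-refl)

    common-blocks : ∀ us vs → length us ≡ length vs → All (f ⊆_) us → All (f ⊆_) vs →
      Common (blocks L us) (blocks L vs) (length us * (L + length f))
    common-blocks []       []       _  _        _        = [] , [] , [] , z≤n
    common-blocks (u ∷ us) (v ∷ vs) l≡ (s ∷ ss) (t ∷ ts) =
      common-++ (common-block (f , s , t , ≤-refl)) (common-blocks us vs (suc-injective l≡) ss ts)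

    -- The blocks of `pre` and `post` are given up and only their runs are matched, with the padding
    -- of y; this is what P and P′ must be long enough for. The blocks between them are matched in
    -- order, by f alone except for the pair u and v.
    frame-common : ∀ pre us₁ {u} us₂ post vs₁ {v} vs₂ {P P′ ℓ} →
      length us₁ ≡ length vs₁ → length us₂ ≡ length vs₂ →
      All (f ⊆_) us₁ → All (f ⊆_) us₂ → All (f ⊆_) vs₁ → All (f ⊆_) vs₂ → Common u v ℓ →
      length pre * L ≤ P → length post * L ≤ P′ →
      Common (frame L (pre ++ us₁ ++ u ∷ us₂ ++ post)) (replicate P h ++ frame L (vs₁ ++ v ∷ vs₂) ++ replicate P′ h)
        (length pre * L + (length us₁ * (L + length f) + (L + ℓ + (length us₂ * (L + length f) + suc (length post) * L))))
    frame-common pre us₁ {u} us₂ post vs₁ {v} vs₂ {P} {P′} {ℓ} l₁ l₂ a₁ a₂ b₁ b₂ uv ≤P ≤P′ =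
      subst₂ (λ x y → Common x y total) (sym X≡) (sym Y≡)
        (common-++ (common-replicate (replicate-⊆-blocks L pre) (replicate-⊆ ≤P))
        (common-++ (common-blocks us₁ vs₁ l₁ a₁ b₁)
        (common-++ (common-block uv)
        (common-++ (common-blocks us₂ vs₂ l₂ a₂ b₂)
          (common-replicate (replicate-⊆-frame L post)
            (subst (_⊆ replicate L h ++ replicate P′ h) (sym (replicate-+ L (length post * L)))
              (++⁺ ⊆-refl (replicate-⊆ ≤P′))))))))
      where
      total : ℕ
      total = length pre * L + (length us₁ * (L + length f) + (L + ℓ + (length us₂ * (L + length f) + suc (length post) * L)))
      X≡ : frame L (pre ++ us₁ ++ u ∷ us₂ ++ post) ≡
        blocks L pre ++ (blocks L us₁ ++ ((replicate L h ++ u) ++ (blocks L us₂ ++ frame L post)))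
      X≡ = trans (frame-++ pre _) (cong (blocks L pre ++_) (trans (frame-++ us₁ _) (cong (blocks L us₁ ++_)
        (trans (sym (++-assoc (replicate L h) u _)) (cong ((replicate L h ++ u) ++_) (frame-++ us₂ post))))))
      Y≡ : replicate P h ++ frame L (vs₁ ++ v ∷ vs₂) ++ replicate P′ h ≡
        replicate P h ++ (blocks L vs₁ ++ ((replicate L h ++ v) ++ (blocks L vs₂ ++ (replicate L h ++ replicate P′ h))))
      Y≡ = cong (replicate P h ++_) (trans (cong (_++ replicate P′ h) (trans (frame-++ vs₁ _) (cong (blocks L vs₁ ++_)
          (trans (sym (++-assoc (replicate L h) v _)) (cong (λ l → (replicate L h ++ v) ++ l) (trans (cong (frame L) (sym (++-identityʳ vs₂))) (frame-++ vs₂ [])))))))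
        (trans (++-assoc (blocks L vs₁) _ _) (cong (blocks L vs₁ ++_)
          (trans (++-assoc (replicate L h ++ v) _ _) (cong ((replicate L h ++ v) ++_) (++-assoc (blocks L vs₂) _ _))))))

-- Traversals

-- Built from the last configuration backwards.
data Walk {σ : ℕ} : List (Fin σ) → List (Fin σ) → ℕ → Set where
  end   : ∀ {a b} → Walk (a ∷ []) (b ∷ []) (dist a b)
  stepˡ : ∀ {a b x y c} → Walk x (b ∷ y) c → Walk (a ∷ x) (b ∷ y) (dist a b + c)
  stepʳ : ∀ {a b x y c} → Walk (a ∷ x) y c → Walk (a ∷ x) (b ∷ y) (dist a b + c)
  step² : ∀ {a b x y c} → Walk x y c → Walk (a ∷ x) (b ∷ y) (dist a b + c)

module _ {σ : ℕ} where

  walk-sym : ∀ {x y : List (Fin σ)} {c} → Walk x y c → Walk y x c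
  walk-sym (end {a} {b})         = subst (Walk _ _) (dist-sym b a) end
  walk-sym (stepˡ {a} {b} {c = c} d) = subst (λ e → Walk _ _ (e + c)) (dist-sym b a) (stepʳ (walk-sym d))
  walk-sym (stepʳ {a} {b} {c = c} d) = subst (λ e → Walk _ _ (e + c)) (dist-sym b a) (stepˡ (walk-sym d))
  walk-sym (step² {a} {b} {c = c} d) = subst (λ e → Walk _ _ (e + c)) (dist-sym b a) (step² (walk-sym d))

  ham-sym : ∀ (w v : ℕ → Fin σ) K → ham w v K ≡ ham v w K
  ham-sym w v zero    = refl
  ham-sym w v (suc K) = cong₂ _+_ (dist-sym (w 0) (v 0)) (ham-sym (w ∘ suc) (v ∘ suc) K)

  -- The current configuration is paid for in every case, so a bound t on whatever follows is
  -- enough. When both words are down to one symbol nothing need follow, and t must vanish.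
  step-bound : ∀ {a b : Fin σ} {x y c} t → Walk (a ∷ x) (b ∷ y) c →
    (x ≡ [] → y ≡ [] → t ≤ 0) →
    (∀ {c} → Walk x (b ∷ y) c → t ≤ c) → (∀ {c} → Walk (a ∷ x) y c → t ≤ c) → (∀ {c} → Walk x y c → t ≤ c) →
    dist a b + t ≤ c
  step-bound t end       e l r b = ≤-trans (+-monoʳ-≤ _ (e refl refl)) (≤-reflexive (+-identityʳ _))
  step-bound t (stepˡ d) e l r b = +-monoʳ-≤ _ (l d)
  step-bound t (stepʳ d) e l r b = +-monoʳ-≤ _ (r d)
  step-bound t (step² d) e l r b = +-monoʳ-≤ _ (b d)

  replicate-++≢[] : ∀ n {a b : Fin σ} {x} → replicate n a ++ b ∷ x ≢ []
  replicate-++≢[] zero    ()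
  replicate-++≢[] (suc n) ()

module Rigid {σ : ℕ} {α β : Fin σ} (α≢β : α ≢ β) (m : ℕ) where

  M : ℕ
  M = suc m

  -- What is left of a word when i symbols of the current run remain: that run, the rest of the slot
  -- up to the bit `w 0`, and K further slots.
  slotα slotβ : ℕ → (ℕ → Fin σ) → ℕ → List (Fin σ)
  slotβ i w K = replicate i β ++ w 0 ∷ core α β M (w ∘ suc) K
  slotα i w K = replicate i α ++ slotβ M w K

  slotβ≢[] : ∀ i w K → slotβ i w K ≢ []
  slotβ≢[] i w K = replicate-++≢[] i

  slotα≢[] : ∀ i w K → slotα i w K ≢ []
  slotα≢[] i w K = replicate-++≢[] i

  Proper′ : (ℕ → Fin σ) → Set
  Proper′ = Proper {α = α} {β = β} {M = M}

  weaken : ∀ {d i H c} → d ≡ 1 → d + (i ⊓ H) ≤ c → suc i ⊓ H ≤ c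
  weaken {i = i} {H} refl ≤c = ≤-trans (≤-trans (⊓-monoʳ-≤ (suc i) (n≤1+n H)) ≤-refl) ≤c

  drop-dist : ∀ {d t c} → d + t ≤ c → t ≤ c
  drop-dist {d} {t} ≤c = ≤-trans (m≤n+m t d) ≤c

  -- Whenever the two markers are in different runs, the one in the run ahead
  -- pays for every further symbol of that run (hence the minima i ⊓ _) until the
  -- other marker has caught up.
  αα : ∀ K i j w v {c} → Proper′ w → Proper′ v → ham w v (suc K) ≤ M →
    Walk (slotα i w K) (slotα j v K) c → ham w v (suc K) ≤ c
  βα : ∀ K i j w v {c} → Proper′ w → Proper′ v → ham w v (suc K) ≤ M →
    Walk (slotβ i w K) (slotα j v K) c → i ⊓ ham w v (suc K) ≤ c
  ββ : ∀ K i j w v {c} → Proper′ w → Proper′ v → ham w v (suc K) ≤ M →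
    Walk (slotβ i w K) (slotβ j v K) c → ham w v (suc K) ≤ c
  bitβ : ∀ K j w v {c} → Proper′ w → Proper′ v → ham w v (suc K) ≤ M →
    Walk (slotβ 0 w K) (slotβ j v K) c → ham w v (suc K) ≤ c
  ahead : ∀ K i j w v {c} → Proper′ w → Proper′ v → ham w (v ∘ suc) (suc K) ≤ M →
    Walk (slotα i w K) (slotβ j v (suc K)) c → i ⊓ ham w (v ∘ suc) (suc K) ≤ c

  αα K zero    zero    w v pw pv H≤ d = ββ K M M w v pw pv H≤ d
  -- The marker in w is at the start of a full run of β, so the minimum in `βα` has M as its first
  -- argument and `H≤` reduces it to the distance.
  αα K zero    (suc j) w v pw pv H≤ d =
    subst (_≤ _) (m≥n⇒m⊓n≡n H≤) (βα K M (suc j) w v pw pv H≤ d)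
  αα K (suc i) zero    w v pw pv H≤ d =
    subst (_≤ _) (trans (cong (M ⊓_) (ham-sym v w (suc K))) (m≥n⇒m⊓n≡n H≤))
      (βα K M (suc i) v w pv pw (subst (_≤ M) (ham-sym w v (suc K)) H≤) (walk-sym d))
  αα K (suc i) (suc j) w v pw pv H≤ d = drop-dist {dist α α} (step-bound (ham w v (suc K)) d
    (λ x≡[] _ → contradiction x≡[] (slotα≢[] i w K))
    (αα K i (suc j) w v pw pv H≤) (αα K (suc i) j w v pw pv H≤) (αα K i j w v pw pv H≤))

  βα K i       zero    w v pw pv H≤ d = ≤-trans (m⊓n≤n i _) (ββ K i M w v pw pv H≤ d)
  βα K zero    (suc j) w v pw pv H≤ d = z≤n
  βα K (suc i) (suc j) w v pw pv H≤ d = weaken {dist β α} (dist-≢ (α≢β ∘ sym)) (step-bound (i ⊓ ham w v (suc K)) d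
    (λ x≡[] _ → contradiction x≡[] (slotβ≢[] i w K))
    (βα K i (suc j) w v pw pv H≤)
    (λ d′ → ≤-trans (⊓-monoˡ-≤ _ (n≤1+n i)) (βα K (suc i) j w v pw pv H≤ d′))
    (βα K i j w v pw pv H≤))

  ββ K zero    j       w v pw pv H≤ d = bitβ K j w v pw pv H≤ d
  ββ K (suc i) zero    w v {c} pw pv H≤ d = subst (_≤ c) (ham-sym v w (suc K))
    (bitβ K (suc i) v w pv pw (subst (_≤ M) (ham-sym w v (suc K)) H≤) (walk-sym d))
  ββ K (suc i) (suc j) w v pw pv H≤ d = drop-dist {dist β β} (step-bound (ham w v (suc K)) d
    (λ x≡[] _ → contradiction x≡[] (slotβ≢[] i w K))
    (ββ K i (suc j) w v pw pv H≤) (ββ K (suc i) j w v pw pv H≤) (ββ K i j w v pw pv H≤))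

  bitβ zero    zero w v pw pv H≤ d = step-bound 0 d (λ _ _ → z≤n) (λ _ → z≤n) (λ _ → z≤n) (λ _ → z≤n)
  bitβ (suc K) zero w v pw pv H≤ d = step-bound R d (λ ())
    (λ d′ → subst (_≤ _) (m≥n⇒m⊓n≡n R≤) (ahead K M 0 (w ∘ suc) v (pw ∘ suc) pv R≤ d′))
    (λ d′ → subst (_≤ _) (trans (cong (M ⊓_) R-sym) (m≥n⇒m⊓n≡n R≤))
      (ahead K M 0 (v ∘ suc) w (pv ∘ suc) pw (subst (_≤ M) (sym R-sym) R≤) (walk-sym d′)))
    (αα K M M (w ∘ suc) (v ∘ suc) (pw ∘ suc) (pv ∘ suc) R≤)
    where
    R : ℕ
    R = ham (w ∘ suc) (v ∘ suc) (suc K)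
    R≤ : R ≤ M
    R≤ = ≤-trans (m≤n+m R (dist (w 0) (v 0))) H≤
    R-sym : ham (v ∘ suc) (w ∘ suc) (suc K) ≡ R
    R-sym = ham-sym (v ∘ suc) (w ∘ suc) (suc K)
  -- A bit against β costs 1, which covers the distance of the two bits of this slot in advance,
  -- even if the marker in w leaves the slot before the other one reaches its bit.
  bitβ K (suc j) w v pw pv H≤ d = begin
    dist (w 0) (v 0) + ham (w ∘ suc) (v ∘ suc) K ≤⟨ +-monoˡ-≤ _ (dist≤1 (w 0) (v 0)) ⟩
    1 + ham (w ∘ suc) (v ∘ suc) K                ≡⟨ cong (_+ ham (w ∘ suc) (v ∘ suc) K) (dist-≢ (proj₂ (pw 0))) ⟨
    dist (w 0) β + ham (w ∘ suc) (v ∘ suc) K     ≤⟨ step-bound (ham (w ∘ suc) (v ∘ suc) K) d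
      (λ _ y≡[] → contradiction y≡[] (slotβ≢[] j v K))
      (λ d′ → behind K (suc j) H≤ d′)
      (λ d′ → ≤-trans (m≤n+m _ (dist (w 0) (v 0))) (bitβ K j w v pw pv H≤ d′))
      (λ d′ → behind K j H≤ d′) ⟩
    _ ∎
    where
    open ≤-Reasoning
    behind : ∀ K j {c} → ham w v (suc K) ≤ M → Walk (core α β M (w ∘ suc) K) (slotβ j v K) c →
      ham (w ∘ suc) (v ∘ suc) K ≤ c
    behind zero    j H≤ d = z≤n
    behind (suc K) j H≤ d = subst (_≤ _) (m≥n⇒m⊓n≡n R≤) (ahead K M j (w ∘ suc) v (pw ∘ suc) pv R≤ d)
      where
      R≤ : ham (w ∘ suc) (v ∘ suc) (suc K) ≤ M
      R≤ = ≤-trans (m≤n+m _ (dist (w 0) (v 0))) H≤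

  ahead K zero    j       w v pw pv R≤ d = z≤n
  ahead K (suc i) zero    w v pw pv R≤ d = weaken {dist α (v 0)} (dist-≢ (proj₁ (pv 0) ∘ sym)) (step-bound (i ⊓ ham w (v ∘ suc) (suc K)) d
    (λ x≡[] _ → contradiction x≡[] (slotα≢[] i w K))
    (ahead K i 0 w v pw pv R≤)
    (λ d′ → ≤-trans (m⊓n≤n i _) (αα K (suc i) M w (v ∘ suc) pw (pv ∘ suc) R≤ d′))
    (λ d′ → ≤-trans (m⊓n≤n i _) (αα K i M w (v ∘ suc) pw (pv ∘ suc) R≤ d′)))
  ahead K (suc i) (suc j) w v pw pv R≤ d = weaken {dist α β} (dist-≢ α≢β) (step-bound (i ⊓ ham w (v ∘ suc) (suc K)) d
    (λ x≡[] _ → contradiction x≡[] (slotα≢[] i w K))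
    (ahead K i (suc j) w v pw pv R≤)
    (λ d′ → ≤-trans (⊓-monoˡ-≤ _ (n≤1+n i)) (ahead K (suc i) j w v pw pv R≤ d′))
    (ahead K i j w v pw pv R≤))

  walk-core-bound : ∀ w v K {c} → Proper′ w → Proper′ v → ham w v K ≤ M →
    Walk (core α β M w K) (core α β M v K) c → ham w v K ≤ c
  walk-core-bound w v zero    pw pv H≤ d = z≤n
  walk-core-bound w v (suc K) pw pv H≤ d = αα K M M w v pw pv H≤ d

module _ {σ : ℕ} where

  Walk≤ : List (Fin σ) → List (Fin σ) → ℕ → Set
  Walk≤ x y c = ∃[ c′ ] c′ ≤ c × Walk x y c′

  walk≤ : ∀ {x y c} → Walk x y c → Walk≤ x y c
  walk≤ d = _ , ≤-refl , d

  walk≤-mono : ∀ {x y c c′} → c ≤ c′ → Walk≤ x y c → Walk≤ x y c′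
  walk≤-mono c≤ (e , e≤ , d) = e , ≤-trans e≤ c≤ , d

  walk-++ : ∀ {x y x′ y′ : List (Fin σ)} {c c′} → Walk x y c → Walk x′ y′ c′ → Walk (x ++ x′) (y ++ y′) (c + c′)
  walk-++ end d′ = step² d′
  walk-++ {c′ = c′} (stepˡ {a} {b} {c = c} d) d′ = subst (Walk _ _) (sym (+-assoc (dist a b) c c′)) (stepˡ (walk-++ d d′))
  walk-++ {c′ = c′} (stepʳ {a} {b} {c = c} d) d′ = subst (Walk _ _) (sym (+-assoc (dist a b) c c′)) (stepʳ (walk-++ d d′))
  walk-++ {c′ = c′} (step² {a} {b} {c = c} d) d′ = subst (Walk _ _) (sym (+-assoc (dist a b) c c′)) (step² (walk-++ d d′))

  walk≤-++ : ∀ {x y x′ y′ : List (Fin σ)} {c c′} → Walk≤ x y c → Walk≤ x′ y′ c′ → Walk≤ (x ++ x′) (y ++ y′) (c + c′)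
  walk≤-++ (_ , e≤ , d) (_ , e′≤ , d′) = _ , +-mono-≤ e≤ e′≤ , walk-++ d d′

  walk≤-run : ∀ (a : Fin σ) m n → Walk≤ (replicate (suc m) a) (replicate (suc n) a) 0
  walk≤-run a zero    zero    = dist a a , ≤-reflexive (dist-refl a) , end
  walk≤-run a zero    (suc n) with walk≤-run a zero n
  ... | c , c≤ , d = dist a a + c , ≤-trans (≤-reflexive (cong (_+ c) (dist-refl a))) c≤ , stepʳ d
  walk≤-run a (suc m) n with walk≤-run a m n
  ... | c , c≤ , d = dist a a + c , ≤-trans (≤-reflexive (cong (_+ c) (dist-refl a))) c≤ , stepˡ d

  walk≤-prepend : ∀ p {x y : List (Fin σ)} {c} → Walk≤ x y c → Walk≤ (p ++ x) y (length p + c)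
  walk≤-prepend []      w = w
  walk≤-prepend (a ∷ p) {y = []} w with walk≤-prepend p w
  ... | _ , _ , ()
  walk≤-prepend (a ∷ p) {y = b ∷ y} w with walk≤-prepend p w
  ... | c , c≤ , d = dist a b + c , +-mono-≤ (dist≤1 a b) c≤ , stepˡ d

  walk≤-snoc : ∀ a {x y : List (Fin σ)} {c} → Walk x y c → Walk≤ (x ++ a ∷ []) y (suc c)
  walk≤-snoc a (end {a = e} {b = b}) = dist e b + dist a b , ≤-trans (+-monoʳ-≤ (dist e b) (dist≤1 a b)) (≤-reflexive (+-comm _ 1)) , stepˡ end
  walk≤-snoc a (stepˡ {e} {b} {c = c} d) with walk≤-snoc a d
  ... | c′ , c′≤ , d′ = dist e b + c′ , ≤-trans (+-monoʳ-≤ (dist e b) c′≤) (≤-reflexive (+-suc _ c)) , stepˡ d′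
  walk≤-snoc a (stepʳ {e} {b} {c = c} d) with walk≤-snoc a d
  ... | c′ , c′≤ , d′ = dist e b + c′ , ≤-trans (+-monoʳ-≤ (dist e b) c′≤) (≤-reflexive (+-suc _ c)) , stepʳ d′
  walk≤-snoc a (step² {e} {b} {c = c} d) with walk≤-snoc a d
  ... | c′ , c′≤ , d′ = dist e b + c′ , ≤-trans (+-monoʳ-≤ (dist e b) c′≤) (≤-reflexive (+-suc _ c)) , step² d′

  walk≤-append : ∀ q {x y : List (Fin σ)} {c} → Walk≤ x y c → Walk≤ (x ++ q) y (length q + c)
  walk≤-append []      {x} w = subst (λ x → Walk≤ x _ _) (sym (++-identityʳ x)) w
  walk≤-append (a ∷ q) {x} {c = c} (e , e≤ , d) =
    subst (λ x → Walk≤ x _ _) (++-assoc x (a ∷ []) q)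
      (walk≤-mono (≤-reflexive (+-suc (length q) c)) (walk≤-append q (walk≤-mono (s≤s e≤) (walk≤-snoc a d))))

  walk≤-core : ∀ {α β : Fin σ} m w v K →
    Walk≤ (core α β (suc m) w (suc K)) (core α β (suc m) v (suc K)) (ham w v (suc K))
  walk≤-core {α} {β} m w v K =
    walk≤-++ (walk≤-run α m m) (walk≤-++ (walk≤-run β m m) (bits K))
    where
    bits : ∀ K → Walk≤ (w 0 ∷ core α β (suc m) (w ∘ suc) K) (v 0 ∷ core α β (suc m) (v ∘ suc) K) (ham w v (suc K))
    bits zero    = dist (w 0) (v 0) , ≤-reflexive (sym (+-identityʳ _)) , end
    bits (suc K) = walk≤-++ (walk≤ end) (walk≤-core m (w ∘ suc) (v ∘ suc) K)

-- Traversals of framed words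

module _ {σ : ℕ} (h : Fin σ) where
  open Frame h

  -- Every symbol of x is under its marker at least once, and against a word of hashes a plain one
  -- then costs 1.
  plain-bound : ∀ {x y c} → All (_≡ h) y → Walk x y c → plain x ≤ c
  plain-bound (refl ∷ _)    end       = ≤-reflexive (+-identityʳ _)
  plain-bound es@(refl ∷ _) (stepˡ d) = +-monoʳ-≤ _ (plain-bound es d)
  plain-bound (_ ∷ es)      (stepʳ {a} {b} d) = ≤-trans (plain-bound es d) (m≤n+m _ (dist a b))
  plain-bound (refl ∷ es)   (step² d) = +-monoʳ-≤ _ (plain-bound es d)

  1∸dist≤ : ∀ a {b} → b ≢ h → 1 ∸ dist a h ≤ dist a b
  1∸dist≤ a {b} b≢h with a Fin.≟ h
  ... | yes refl = ≤-reflexive (sym (dist-≢ (b≢h ∘ sym)))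
  ... | no _     = z≤n

  hashes-bound : ∀ {x y c} → Plain y → Walk x y c → hashes x ≤ c
  hashes-bound (n ∷ _)    (end {a})   = ≤-trans (≤-reflexive (+-identityʳ _)) (1∸dist≤ a n)
  hashes-bound ns@(n ∷ _) (stepˡ {a} d) = +-mono-≤ (1∸dist≤ a n) (hashes-bound ns d)
  hashes-bound (_ ∷ ns)   (stepʳ {a} {b} d) = ≤-trans (hashes-bound ns d) (m≤n+m _ (dist a b))
  hashes-bound (n ∷ ns)   (step² {a} d) = +-mono-≤ (1∸dist≤ a n) (hashes-bound ns d)

  -- A traversal is cut where the second marker passes from y₁ to y₂. If the first marker rests at
  -- that moment, its symbol belongs to both x₁ and x₂; hence `cover` is an inequality, and prefix
  -- and suffix are recorded separately.
  record Split (x y₁ y₂ : List Sym) (c : ℕ) : Set where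
    field
      {x₁ r₁ l₂ x₂} : List Sym
      {c₁ c₂} : ℕ
      prefix : x₁ ++ r₁ ≡ x
      suffix : l₂ ++ x₂ ≡ x
      cover  : plain x ≤ plain x₁ + plain x₂
      cost   : c₁ + c₂ ≡ c
      walk₁  : Walk x₁ y₁ c₁
      walk₂  : Walk x₂ y₂ c₂

  split-∷ : ∀ e {x y y₁ y₂ c c′} → (∀ {x₁ c₁} → Walk x₁ y c₁ → Walk (e ∷ x₁) y₁ (c′ + c₁)) →
    Split x y y₂ c → Split (e ∷ x) y₁ y₂ (c′ + c)
  split-∷ e {c′ = c′} first s = record
    { prefix = cong (e ∷_) prefix ; suffix = cong (e ∷_) suffix
    ; cover = ≤-trans (+-monoʳ-≤ (dist e h) cover) (≤-reflexive (sym (+-assoc (dist e h) _ _)))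
    ; cost = trans (+-assoc c′ _ _) (cong (c′ +_) cost) ; walk₁ = first walk₁ ; walk₂ = walk₂ }
    where open Split s

  split-stay : ∀ {e x a y y₂ c} → Split (e ∷ x) y y₂ c → Split (e ∷ x) (a ∷ y) y₂ (dist e a + c)
  split-stay record { x₁ = [] ; walk₁ = () }
  split-stay {e} {a = a} s@record { x₁ = _ ∷ _ ; prefix = refl } = record
    { prefix = refl ; suffix = suffix ; cover = cover
    ; cost = trans (+-assoc (dist e a) _ _) (cong (dist e a +_) cost) ; walk₁ = stepʳ walk₁ ; walk₂ = walk₂ }
    where open Split s using (suffix; cover; cost; walk₁; walk₂)

  walk-split : ∀ a y₁ b y₂ {x c} → Walk x (a ∷ y₁ ++ b ∷ y₂) c → Split x (a ∷ y₁) (b ∷ y₂) c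
  walk-split a []       b y₂ (stepʳ {e} {x = x} d) = record
    { x₁ = e ∷ [] ; l₂ = [] ; prefix = refl ; suffix = refl
    ; cover = m≤n+m _ (plain (e ∷ [])) ; cost = refl ; walk₁ = end ; walk₂ = d }
  walk-split a []       b y₂ (step² {e} {x = x} d) = record
    { x₁ = e ∷ [] ; l₂ = e ∷ [] ; prefix = refl ; suffix = refl
    ; cover = ≤-reflexive (cong (_+ plain x) (sym (+-identityʳ (dist e h)))) ; cost = refl ; walk₁ = end ; walk₂ = d }
  walk-split a []       b y₂ (stepˡ {e} d) = split-∷ e stepˡ (walk-split a [] b y₂ d)
  walk-split a (a′ ∷ y₁) b y₂ (stepˡ {e} d) = split-∷ e stepˡ (walk-split a (a′ ∷ y₁) b y₂ d)
  walk-split a (a′ ∷ y₁) b y₂ (stepʳ {e} d) = split-stay (walk-split a′ y₁ b y₂ d)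
  walk-split a (a′ ∷ y₁) b y₂ (step² {e} d) = split-∷ e step² (walk-split a′ y₁ b y₂ d)

  trim-head : ∀ a z {y c} → Plain y → Walk (h ∷ a ∷ z) y c → Walk≤ (a ∷ z) y c
  trim-head a z ns (stepˡ {b = b} {c = c} d) = c , m≤n+m c (dist h b) , d
  trim-head a z (n ∷ ns) (stepʳ {b = b} {c = c} d) with trim-head a z ns d
  ... | c′ , c′≤ , d′ = dist a b + c′ , +-mono-≤ (≤-trans (dist≤1 a b) (≤-reflexive (sym (dist-≢ (n ∘ sym))))) c′≤ , stepʳ d′
  trim-head a z (n ∷ ns) (step² {b = b} {c = c} d) =
    dist a b + c , +-monoˡ-≤ c (≤-trans (dist≤1 a b) (≤-reflexive (sym (dist-≢ (n ∘ sym))))) , stepʳ d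

  -- At the end of a word the neighbour takes the place of the `#` and has to accompany the rest of
  -- y; every configuration concerned already cost 1.
  relabel : ∀ a {y c} → Plain y → Walk (h ∷ []) y c → Walk≤ (a ∷ []) y c
  relabel a (n ∷ _) (end {b = b}) = dist a b , ≤-trans (dist≤1 a b) (≤-reflexive (sym (dist-≢ (n ∘ sym)))) , end
  relabel a (n ∷ ns) (stepʳ {b = b} d) with relabel a ns d
  ... | c′ , c′≤ , d′ = dist a b + c′ , +-mono-≤ (≤-trans (dist≤1 a b) (≤-reflexive (sym (dist-≢ (n ∘ sym))))) c′≤ , stepʳ d′
  relabel a _ (stepˡ ())
  relabel a _ (step² ())

  trim-last : ∀ a z {y c} → Plain y → Walk (a ∷ z ++ h ∷ []) y c → Walk≤ (a ∷ z) y c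
  trim-last a [] ns (stepˡ {b = b} d) = walk≤-mono (m≤n+m _ (dist a b)) (relabel a ns d)
  trim-last a [] (_ ∷ ns) (stepʳ {b = b} d) with trim-last a [] ns d
  ... | c′ , c′≤ , d′ = dist a b + c′ , +-monoʳ-≤ _ c′≤ , stepʳ d′
  trim-last a [] (_ ∷ ns) (step² {b = b} d) with relabel a ns d
  ... | c′ , c′≤ , d′ = dist a b + c′ , +-monoʳ-≤ _ c′≤ , stepʳ d′
  trim-last a (a′ ∷ z) ns (stepˡ {b = b} d) with trim-last a′ z ns d
  ... | c′ , c′≤ , d′ = dist a b + c′ , +-monoʳ-≤ _ c′≤ , stepˡ d′
  trim-last a (a′ ∷ z) (_ ∷ ns) (stepʳ {b = b} d) with trim-last a (a′ ∷ z) ns d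
  ... | c′ , c′≤ , d′ = dist a b + c′ , +-monoʳ-≤ _ c′≤ , stepʳ d′
  trim-last a (a′ ∷ z) (_ ∷ ns) (step² {b = b} d) with trim-last a′ z ns d
  ... | c′ , c′≤ , d′ = dist a b + c′ , +-monoʳ-≤ _ c′≤ , step² d′

  trim-head′ : ∀ x {y c} → x ≢ [] → Plain y → Walk (h ∷ x) y c → Walk≤ x y c
  trim-head′ []      x≢[] = contradiction refl x≢[]
  trim-head′ (a ∷ z) _    = trim-head a z

  trimˡ : ∀ i a z {y c} → Plain y → Walk (replicate i h ++ a ∷ z) y c → Walk≤ (a ∷ z) y c
  trimˡ zero    a z ns d = walk≤ d
  trimˡ (suc i) a z ns d with trim-head′ (replicate i h ++ a ∷ z) (replicate-++≢[] i) ns d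
  ... | c′ , c′≤ , d′ = walk≤-mono c′≤ (trimˡ i a z ns d′)

  trimʳ : ∀ j a z {y c} → Plain y → Walk (a ∷ z ++ replicate j h) y c → Walk≤ (a ∷ z) y c
  trimʳ zero    a z {y} {c} ns d = walk≤ (subst (λ x → Walk x y c) (cong (a ∷_) (++-identityʳ z)) d)
  trimʳ (suc j) a z {y} {c} ns d with trimʳ j a (z ++ h ∷ []) ns (subst (λ x → Walk x y c) (cong (a ∷_) (sym (++-assoc z (h ∷ []) (replicate j h)))) d)
  ... | c′ , c′≤ , d′ = walk≤-mono c′≤ (trim-last a z ns d′)

  infix-dropˡ : ∀ L {z w} p q → p ++ z ++ q ≡ replicate L h ++ w →
    ∃[ i ] ∃[ z′ ] z ≡ replicate i h ++ z′ × Infix z′ w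
  infix-dropˡ zero    {z} {w} p q e≡ = 0 , z , refl , p , q , e≡
  infix-dropˡ (suc L) {z} {w} (a ∷ p) q e≡ = infix-dropˡ L p q (proj₂ (∷-injective e≡))
  infix-dropˡ (suc L) {[]} {w} [] q e≡ = 0 , [] , refl , [] , w , refl
  infix-dropˡ (suc L) {a ∷ z} {w} [] q e≡ with ∷-injective e≡
  ... | refl , e≡′ with infix-dropˡ L {z} {w} [] q e≡′
  ... | i , z′ , refl , inf = suc i , z′ , refl , inf

  prefix-dropʳ : ∀ L w {z} q → z ++ q ≡ w ++ replicate L h →
    ∃[ j ] ∃[ z′ ] ∃[ q′ ] z ≡ z′ ++ replicate j h × z′ ++ q′ ≡ w
  prefix-dropʳ L []      {z} q e≡ with prefix-replicate L {z} e≡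
  ... | j , _ , z≡ , _ = j , [] , [] , z≡ , refl
  prefix-dropʳ L (b ∷ w) {[]} q e≡ = 0 , [] , b ∷ w , refl , refl
  prefix-dropʳ L (b ∷ w) {a ∷ z} q e≡ with ∷-injective e≡
  ... | refl , e≡′ with prefix-dropʳ L w {z} q e≡′
  ... | j , z′ , q′ , refl , refl = j , a ∷ z′ , q′ , refl , refl

  infix-dropʳ : ∀ L w {z} p q → p ++ z ++ q ≡ w ++ replicate L h →
    ∃[ j ] ∃[ z′ ] z ≡ z′ ++ replicate j h × Infix z′ w
  infix-dropʳ L w {z} p q e≡ with ++-split p w e≡
  ... | inj₁ (e , refl , e≡₁) with prefix-dropʳ L e {z} q e≡₁
  ... | j , z′ , q′ , z≡ , refl = j , z′ , z≡ , p , q′ , refl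
  infix-dropʳ L w {z} p q e≡ | inj₂ (e , refl , e≡₁) with prefix-replicate L {e} (sym e≡₁)
  ... | _ , k , _ , e≡₂ with prefix-replicate k {z} e≡₂
  ... | j , _ , z≡ , _ = j , [] , z≡ , [] , w , refl

  module _ {B L E P′ : ℕ} (2B≤L : B + B ≤ L) (E≤B : E ≤ B) where

    Costly : List Sym → List Sym → Set
    Costly v u = Short B u × (∀ {c} → Walk u v c → E ≤ c)

    -- Compared with skipping x against a single #, the block v saves at most B - E.
    walk-piece : ∀ {us v x c} → Plain v → All (Costly v) us → Infix x (frame L us) →
      Walk x v c → plain x + E ≤ c + B
    walk-piece {us} {v} {x} {c} pv ps inf d
      with frame-infix 2B≤L {Costly v} us proj₁ (([] , z≤n) , λ ()) ps inf
    -- A piece across a whole run has at least as many hashes as plain symbols, and v, being free of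
    -- hashes, pays for each of them.
    ... | inj₂ (p≤h , _) = +-mono-≤ (≤-trans p≤h (hashes-bound pv d)) E≤B
    ... | inj₁ (u , (su , costly) , p , q , e≡) with infix-dropˡ L p q e≡
    ... | i , x₁ , refl , p₁ , q₁ , e≡₁ with infix-dropʳ L u {x₁} p₁ q₁ e≡₁
    -- Nothing of u is left, so the piece has no plain symbols and the claim follows from E ≤ B.
    ... | j , [] , refl , _ = subst (λ n → n + E ≤ c + B) (sym zero-plain) (≤-trans E≤B (m≤n+m B c))
      where
      zero-plain : plain (replicate i h ++ replicate j h) ≡ 0
      zero-plain = trans (plain-++ (replicate i h) _) (cong₂ _+_ (plain-replicate i) (plain-replicate j))
    ... | j , a ∷ z , refl , p₂ , q₂ , refl
      with trimˡ i a (z ++ replicate j h) pv d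
    ... | c₁ , c₁≤ , d₁ with trimʳ j a z pv d₁
    -- The missing parts `p₂` and `q₂` of u are restored at a price of at most 1 per symbol. The
    -- result is a traversal of all of u, to which `costly` applies, and the price is covered by the
    -- length bound B on u.
    ... | c₂ , c₂≤ , d₂ with walk≤-prepend p₂ (walk≤-append q₂ (walk≤ d₂))
    ... | c₃ , c₃≤ , d₃ = begin
      plain (replicate i h ++ (a ∷ z) ++ replicate j h) + E ≡⟨ cong (_+ E) core-plain ⟩
      plain (a ∷ z) + E                                      ≤⟨ +-mono-≤ (plain≤length (a ∷ z)) (≤-trans (costly d₃) c₃≤) ⟩
      length (a ∷ z) + (length p₂ + (length q₂ + c₂))         ≤⟨ +-monoʳ-≤ (length (a ∷ z)) (+-monoʳ-≤ (length p₂) (+-monoʳ-≤ (length q₂) (≤-trans c₂≤ c₁≤))) ⟩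
      length (a ∷ z) + (length p₂ + (length q₂ + c))          ≡⟨ regroup (length (a ∷ z)) (length p₂) (length q₂) c ⟩
      c + (length p₂ + (length (a ∷ z) + length q₂))          ≡⟨ cong (c +_) (trans (length-++ p₂) (cong (length p₂ +_) (length-++ (a ∷ z)))) ⟨
      c + length (p₂ ++ (a ∷ z) ++ q₂)                        ≤⟨ +-monoʳ-≤ c (proj₂ su) ⟩
      c + B                                                  ∎
      where
      open ≤-Reasoning
      regroup : ∀ a p q c → a + (p + (q + c)) ≡ c + (p + (a + q))
      regroup = solve-∀
      core-plain : plain (replicate i h ++ (a ∷ z) ++ replicate j h) ≡ plain (a ∷ z)
      core-plain = trans (plain-++ (replicate i h) _) (trans (cong (_+ plain ((a ∷ z) ++ replicate j h)) (plain-replicate i))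
        (trans (plain-++ (a ∷ z) _) (trans (cong (plain (a ∷ z) +_) (plain-replicate j)) (+-identityʳ _))))

module _ {σ : ℕ} (h : Fin σ) where
  open Frame h

  frame-head : ∀ l vs → ∃[ t ] frame (suc l) vs ≡ h ∷ t
  frame-head l []       = replicate l h , refl
  frame-head l (v ∷ vs) = replicate l h ++ v ++ frame (suc l) vs , refl

  module _ {B l E P′ : ℕ} (2B≤L : B + B ≤ suc l) (E≤B : E ≤ B) where

    Block : List Sym → Set
    Block v = v ≢ [] × Plain v

    -- Passing over all blocks of x while waiting at a `#` costs `plain x`; each block of y lowers
    -- this by at most B - E. The credit is written on the other side to avoid truncated
    -- subtraction.
    walk-frame-bound : ∀ {us} vs {x c} → All Block vs →
      All (λ v → All (Costly h {B} {suc l} {E} {P′} 2B≤L E≤B v) us) vs → Infix x (frame (suc l) us) →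
      Walk x (frame (suc l) vs ++ replicate P′ h) c → plain x + length vs * E ≤ c + length vs * B
    walk-frame-bound [] {x} {c} _ _ _ d = +-monoˡ-≤ 0 (plain-bound h
      (AllP.++⁺ (AllP.replicate⁺ (suc l) refl) (AllP.replicate⁺ P′ refl)) d)
    walk-frame-bound ([] ∷ vs) ((v≢[] , _) ∷ _) = contradiction refl v≢[]
    walk-frame-bound {us} ((b ∷ v) ∷ vs) {x} {c} ((_ , pv) ∷ bs) (p ∷ ps) inf d with frame-head l vs
    ... | t , e≡ = begin
      plain x + (E + length vs * E)
        ≤⟨ +-monoˡ-≤ _ (≤-trans S₁.cover (+-monoʳ-≤ (plain S₁.x₁) S₂.cover)) ⟩
      plain S₁.x₁ + (plain S₂.x₁ + plain S₂.x₂) + (E + length vs * E)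
        ≡⟨ regroup (plain S₁.x₁) (plain S₂.x₁) (plain S₂.x₂) E (length vs * E) ⟩
      plain S₁.x₁ + (plain S₂.x₁ + E + (plain S₂.x₂ + length vs * E))
        ≤⟨ +-mono-≤ (plain-bound h (AllP.replicate⁺ (suc l) refl) S₁.walk₁) (+-mono-≤
            (walk-piece h {B} {suc l} {E} {P′} 2B≤L E≤B pv p
              (infix-++ˡ {y = S₂.r₁} (subst (λ z → Infix z (frame (suc l) us)) (sym S₂.prefix) inf₂)) S₂.walk₁)
            (walk-frame-bound vs bs ps
              (infix-++ʳ S₂.l₂ (subst (λ z → Infix z (frame (suc l) us)) (sym S₂.suffix) inf₂))
              (subst (λ y → Walk S₂.x₂ (y ++ replicate P′ h) S₂.c₂) (sym e≡) S₂.walk₂))) ⟩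
      S₁.c₁ + (S₂.c₁ + B + (S₂.c₂ + length vs * B))
        ≡⟨ regroup S₁.c₁ S₂.c₁ S₂.c₂ B (length vs * B) ⟨
      S₁.c₁ + (S₂.c₁ + S₂.c₂) + (B + length vs * B)
        ≡⟨ cong (_+ (B + length vs * B)) (trans (cong (S₁.c₁ +_) S₂.cost) S₁.cost) ⟩
      c + (B + length vs * B) ∎
      where
      open ≤-Reasoning
      regroup : ∀ a b c e f → a + (b + c) + (e + f) ≡ a + (b + e + (c + f))
      regroup = solve-∀
      shape : frame (suc l) ((b ∷ v) ∷ vs) ++ replicate P′ h ≡
        h ∷ replicate l h ++ b ∷ (v ++ h ∷ (t ++ replicate P′ h))
      shape = cong (h ∷_) (trans (++-assoc (replicate l h) _ _) (cong (λ y → replicate l h ++ b ∷ y)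
        (trans (++-assoc v _ _) (cong (λ y → v ++ y ++ replicate P′ h) e≡))))
      S₁ : Split h x (h ∷ replicate l h) (b ∷ v ++ h ∷ (t ++ replicate P′ h)) c
      S₁ = walk-split h h (replicate l h) b (v ++ h ∷ (t ++ replicate P′ h)) (subst (λ y → Walk x y c) shape d)
      module S₁ = Split S₁
      S₂ : Split h S₁.x₂ (b ∷ v) (h ∷ (t ++ replicate P′ h)) S₁.c₂
      S₂ = walk-split h b v h (t ++ replicate P′ h) S₁.walk₂
      module S₂ = Split S₂
      inf₂ : Infix S₁.x₂ (frame (suc l) us)
      inf₂ = infix-++ʳ S₁.l₂ (subst (λ z → Infix z (frame (suc l) us)) (sym S₁.suffix) inf)

    walk-padded-bound : ∀ {us} P vs {c} → All Block vs →
      All (λ v → All (Costly h {B} {suc l} {E} {P′} 2B≤L E≤B v) us) vs →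
      Walk (frame (suc l) us) (replicate P h ++ frame (suc l) vs ++ replicate P′ h) c →
      plain (frame (suc l) us) + length vs * E ≤ c + length vs * B
    walk-padded-bound zero    vs bs ps d = walk-frame-bound vs bs ps infix-refl d
    walk-padded-bound {us} (suc P) vs {c} bs ps d with frame-head l vs
    ... | t , e≡ = begin
      plain X + length vs * E ≤⟨ +-monoˡ-≤ _ S.cover ⟩
      plain S.x₁ + plain S.x₂ + length vs * E ≡⟨ +-assoc (plain S.x₁) _ _ ⟩
      plain S.x₁ + (plain S.x₂ + length vs * E)
        ≤⟨ +-mono-≤ (plain-bound h (AllP.replicate⁺ (suc P) refl) S.walk₁)
            (walk-frame-bound vs bs ps (infix-++ʳ S.l₂ (subst (λ z → Infix z X) (sym S.suffix) infix-refl))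
              (subst (λ y → Walk S.x₂ (y ++ replicate P′ h) S.c₂) (sym e≡) S.walk₂)) ⟩
      S.c₁ + (S.c₂ + length vs * B) ≡⟨ +-assoc S.c₁ _ _ ⟨
      S.c₁ + S.c₂ + length vs * B ≡⟨ cong (_+ length vs * B) S.cost ⟩
      c + length vs * B ∎
      where
      open ≤-Reasoning
      X : List Sym
      X = frame (suc l) us
      S : Split h X (h ∷ replicate P h) (h ∷ (t ++ replicate P′ h)) c
      S = walk-split h h (replicate P h) h (t ++ replicate P′ h)
        (subst (λ y → Walk X (replicate (suc P) h ++ y ++ replicate P′ h) c) e≡ d)
      module S = Split S

  walk≤-prepend-h : ∀ i {x y c} → Walk≤ x (h ∷ y) c → Walk≤ (replicate i h ++ x) (h ∷ y) c
  walk≤-prepend-h zero    w = w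
  walk≤-prepend-h (suc i) w with walk≤-prepend-h i w
  ... | c , c≤ , d = dist h h + c , ≤-trans (≤-reflexive (cong (_+ c) (dist-refl h))) c≤ , stepˡ d

  module _ {B l R : ℕ} where

    Tail : List (List Sym) → List Sym
    Tail vs = frame (suc l) vs ++ replicate R h

    tail-head : ∀ vs → ∃[ t ] Tail vs ≡ h ∷ t
    tail-head vs with frame-head l vs
    ... | t , e≡ = t ++ replicate R h , cong (_++ replicate R h) e≡

    record FrameWalk (us vs : List (List Sym)) (c : ℕ) : Set where
      constructor frameWalk
      field walk : Walk≤ (frame (suc l) us) (Tail vs) c

    open FrameWalk

    -- The second marker waits at the first `#` of `Tail vs`, so the runs cost nothing and each
    -- skipped block at most its length.
    walk-skip : ∀ us₁ {us vs c} → All (λ u → length u ≤ B) us₁ → FrameWalk us vs c →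
      FrameWalk (us₁ ++ us) vs (length us₁ * B + c)
    walk-skip []        _        w = w
    walk-skip (u ∷ us₁) {us} {vs} {c} (u≤ ∷ us≤) w with tail-head vs
    ... | t , e≡ = frameWalk (subst (λ y → Walk≤ (frame (suc l) (u ∷ us₁ ++ us)) y (B + length us₁ * B + c)) (sym e≡)
      (walk≤-prepend-h (suc l) (walk≤-mono (≤-trans (+-monoˡ-≤ _ u≤) (≤-reflexive (sym (+-assoc B _ c))))
        (walk≤-prepend u (subst (λ y → Walk≤ (frame (suc l) (us₁ ++ us)) y (length us₁ * B + c)) e≡
          (walk (walk-skip us₁ us≤ w)))))))

    walk-match : ∀ {u v us vs e c} → Walk≤ u v e → FrameWalk us vs c → FrameWalk (u ∷ us) (v ∷ vs) (e + c)
    walk-match {u} {v} {us} {vs} {e} {c} p w =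
      frameWalk (subst (λ y → Walk≤ (frame (suc l) (u ∷ us)) y (e + c))
        (sym (trans (++-assoc (replicate (suc l) h) _ _) (cong (replicate (suc l) h ++_) (++-assoc v _ _))))
        (walk≤-++ (walk≤-run h l l) (walk≤-++ p (walk w))))

    walk-matches : ∀ us₁ vs₁ {s us vs e c} → length us₁ ≡ length vs₁ → All (_≡ s) us₁ → All (λ v → Walk≤ s v e) vs₁ →
      FrameWalk us vs c → FrameWalk (us₁ ++ us) (vs₁ ++ vs) (length us₁ * e + c)
    walk-matches []        []        _  _ _ w = w
    walk-matches (u ∷ us₁) (v ∷ vs₁) {e = e} {c} l≡ (refl ∷ es) (p ∷ ps) w =
      subst (FrameWalk _ _) (sym (+-assoc e _ c)) (walk-match p (walk-matches us₁ vs₁ (suc-injective l≡) es ps w))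

    -- `us₁` and `us₄` hold the copies of s that serve the blocks before and after v. The blocks in
    -- `us₂`, `us₃` and `us₅` are passed over at a price of B each.
    frame-walk : ∀ us₁ us₂ {u} us₃ us₄ us₅ vs₁ {v} vs₂ {s e c} P →
      length us₁ ≡ length vs₁ → length us₄ ≡ length vs₂ → All (_≡ s) us₁ → All (_≡ s) us₄ →
      All (λ v → Walk≤ s v e) vs₁ → All (λ v → Walk≤ s v e) vs₂ → Walk≤ u v c →
      All (λ u → length u ≤ B) us₂ → All (λ u → length u ≤ B) us₃ → All (λ u → length u ≤ B) us₅ →
      Walk≤ (frame (suc l) (us₁ ++ us₂ ++ u ∷ us₃ ++ us₄ ++ us₅)) (replicate P h ++ Tail (vs₁ ++ v ∷ vs₂))
        (length us₁ * e + (length us₂ * B + (c + (length us₃ * B + (length us₄ * e + length us₅ * B)))))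
    frame-walk us₁ us₂ us₃ us₄ us₅ vs₁ {v} vs₂ {e = e} P l₁ l₄ s₁ s₄ m₁ m₂ uv b₂ b₃ b₅ =
      pad (walk-matches us₁ vs₁ l₁ s₁ m₁ (walk-skip us₂ b₂ (walk-match uv
        (walk-skip us₃ b₃ (subst (λ vs → FrameWalk (us₄ ++ us₅) vs (length us₄ * e + length us₅ * B)) (++-identityʳ vs₂)
          (walk-matches us₄ vs₂ l₄ s₄ m₂ finish))))))
      where
      finish : FrameWalk us₅ [] (length us₅ * B)
      finish = subst₂ (λ us c → FrameWalk us [] c) (++-identityʳ us₅) (+-identityʳ _)
        (walk-skip us₅ b₅ (frameWalk
          (subst (λ y → Walk≤ (replicate (suc l) h) y 0) (replicate-+ h (suc l) R) (walk≤-run h l (l + R)))))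
      -- With the roles of the two words exchanged, the first `#` of x waits for the P leading
      -- hashes of y.
      pad : ∀ {us vs c} → FrameWalk us vs c → Walk≤ (frame (suc l) us) (replicate P h ++ Tail vs) c
      pad {us} {vs} {c} (frameWalk (c′ , c′≤ , d)) with frame-head l us
      ... | t , e≡ with walk≤-prepend-h P (c′ , c′≤ , subst (λ x → Walk (Tail vs) x c′) e≡ (walk-sym d))
      ... | c″ , c″≤ , d″ = c″ , c″≤ , subst (λ x → Walk x (replicate P h ++ Tail vs) c″) (sym e≡) (walk-sym d″)

-- Traversals by markers and walks on lists

drop-lookup : ∀ {A : Set} {n} (x : Vec A n) i → drop (toℕ i) (toList x) ≡ lookup x i ∷ drop (suc (toℕ i)) (toList x)
drop-lookup (a ∷ x) Fin.zero    = refl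
drop-lookup (a ∷ x) (Fin.suc i) = drop-lookup x i

drop-∷⇒< : ∀ {A : Set} {n} (x : Vec A n) k {a t} → drop k (toList x) ≡ a ∷ t → k < n
drop-∷⇒< []      zero    ()
drop-∷⇒< []      (suc k) ()
drop-∷⇒< (_ ∷ x) zero    _  = s≤s z≤n
drop-∷⇒< (_ ∷ x) (suc k) e≡ = s≤s (drop-∷⇒< x k e≡)

module _ {σ : ℕ} where

  -- Walks exist between nonempty words only, so a walk on what lies ahead certifies that the marker
  -- can still move.
  nonempty⇒< : ∀ {k s t e} (z : Vec (Fin σ) k) (i : Fin k) → s ≡ drop (suc (toℕ i)) (toList z) → Walk s t e → suc (toℕ i) < k
  nonempty⇒< {s = []}    z i s≡ ()
  nonempty⇒< {s = a ∷ s} z i s≡ d = drop-∷⇒< z (suc (toℕ i)) (sym s≡)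

  next : ∀ {k s t e} (z : Vec (Fin σ) k) (i : Fin k) → s ≡ drop (suc (toℕ i)) (toList z) → Walk s t e → Fin k
  next z i s≡ d = fromℕ< (nonempty⇒< z i s≡ d)

  next≡ : ∀ {k s t e} (z : Vec (Fin σ) k) (i : Fin k) (s≡ : s ≡ drop (suc (toℕ i)) (toList z)) (d : Walk s t e) →
    toℕ (next z i s≡ d) ≡ suc (toℕ i)
  next≡ z i s≡ d = toℕ-fromℕ< (nonempty⇒< z i s≡ d)

module _ {σ m n} (x : Vec (Fin σ) m) (y : Vec (Fin σ) n) where

  X Y : List (Fin σ)
  X = toList x
  Y = toList y

  cell : Fin m → Fin n → ℕ
  cell i j = dist (lookup x i) (lookup y j)

  -- Traversals grow forwards and walks backwards. The accumulator e is the cost of everything after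
  -- the current configuration, collected while the traversal is unwound.
  reaches⇒walk : ∀ {i j c} → Reaches x y (i , j) c → ∀ e →
    Walk (drop (toℕ i) X) (drop (toℕ j) Y) (cell i j + e) → Walk X Y (c + e)
  reaches⇒walk {i} {j} (start i≡0 j≡0) e d =
    subst₂ (λ k l → Walk (drop k X) (drop l Y) (cell i j + e)) i≡0 j≡0 d
  reaches⇒walk {i} {j} (step {p = i′ , j′} {c = c} R mv) e d =
    subst (Walk X Y) (sym (+-assoc c (cell i j) e)) (reaches⇒walk R (cell i j + e) (move mv))
    where
    move : Move (i′ , j′) (i , j) → Walk (drop (toℕ i′) X) (drop (toℕ j′) Y) (cell i′ j′ + (cell i j + e))
    onto : ∀ {c} → Walk (lookup x i′ ∷ drop (suc (toℕ i′)) X) (lookup y j′ ∷ drop (suc (toℕ j′)) Y) c →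
      Walk (drop (toℕ i′) X) (drop (toℕ j′) Y) c
    onto {c} = subst₂ (λ s t → Walk s t c) (sym (drop-lookup x i′)) (sym (drop-lookup y j′))
    move (left i≡) = onto (stepˡ (subst₂ (λ s t → Walk s t (cell i j + e)) (cong (λ k → drop k X) i≡) (drop-lookup y j) d))
    move (right j≡) = onto (stepʳ (subst₂ (λ s t → Walk s t (cell i j + e)) (drop-lookup x i) (cong (λ k → drop k Y) j≡) d))
    move (both i≡ j≡) = onto (step² (subst₂ (λ s t → Walk s t (cell i j + e)) (cong (λ k → drop k X) i≡) (cong (λ k → drop k Y) j≡) d))

  traversal⇒walk : ∀ {c} → TraversalCost x y c → Walk X Y c
  traversal⇒walk {c} (i , j , i≡ , j≡ , R) = subst (Walk X Y) (+-identityʳ c)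
    (reaches⇒walk R 0 (subst₂ (λ s t → Walk s t (cell i j + 0)) (sym (last x i i≡)) (sym (last y j j≡))
      (subst (Walk _ _) (sym (+-identityʳ (cell i j))) end)))
    where
    last : ∀ {k} (z : Vec (Fin σ) k) (i : Fin k) → suc (toℕ i) ≡ k → drop (toℕ i) (toList z) ≡ lookup z i ∷ []
    last (a ∷ [])    Fin.zero    _  = refl
    last (a ∷ z)     (Fin.suc i) e≡ = last z i (suc-injective e≡)

  -- Here c is the cost spent before the current configuration, whereas the given partial traversal
  -- includes that configuration.
  walk⇒reaches : ∀ {s t e} → Walk s t e → ∀ i j → s ≡ drop (toℕ i) X → t ≡ drop (toℕ j) Y →
    ∀ c → Reaches x y (i , j) (c + cell i j) → TraversalCost x y (c + e)
  walk⇒reaches d i j s≡ t≡ c R with trans s≡ (drop-lookup x i) | trans t≡ (drop-lookup y j)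
  walk⇒reaches (end {a} {b}) i j s≡ t≡ c R | p | q with ∷-injective p | ∷-injective q
  ... | refl , x≡[] | refl , y≡[] = i , j , last x i x≡[] , last y j y≡[] , R
    where
    last : ∀ {k} (z : Vec (Fin σ) k) (i : Fin k) → [] ≡ drop (suc (toℕ i)) (toList z) → suc (toℕ i) ≡ k
    last (a ∷ [])    Fin.zero    _  = refl
    last (a ∷ b ∷ z) Fin.zero    ()
    last (a ∷ z)     (Fin.suc i) e≡ = cong suc (last z i e≡)
  walk⇒reaches (stepˡ {c = e} d) i j s≡ t≡ c R | p | q with ∷-injective p | ∷-injective q
  ... | refl , x≡ | refl , _ =
    subst (TraversalCost x y) (+-assoc c (cell i j) e)
      (walk⇒reaches d (next x i x≡ d) j (trans x≡ (cong (λ k → drop k X) (sym (next≡ x i x≡ d)))) t≡ (c + cell i j)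
        (step R (left (next≡ x i x≡ d))))
  walk⇒reaches (stepʳ {c = e} d) i j s≡ t≡ c R | p | q with ∷-injective p | ∷-injective q
  ... | refl , _ | refl , y≡ =
    subst (TraversalCost x y) (+-assoc c (cell i j) e)
      (walk⇒reaches d i (next y j y≡ (walk-sym d)) s≡ (trans y≡ (cong (λ k → drop k Y) (sym (next≡ y j y≡ (walk-sym d)))))
        (c + cell i j) (step R (right (next≡ y j y≡ (walk-sym d)))))
  walk⇒reaches (step² {c = e} d) i j s≡ t≡ c R | p | q with ∷-injective p | ∷-injective q
  ... | refl , x≡ | refl , y≡ =
    subst (TraversalCost x y) (+-assoc c (cell i j) e)
      (walk⇒reaches d (next x i x≡ d) (next y j y≡ (walk-sym d))
        (trans x≡ (cong (λ k → drop k X) (sym (next≡ x i x≡ d)))) (trans y≡ (cong (λ k → drop k Y) (sym (next≡ y j y≡ (walk-sym d)))))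
        (c + cell i j) (step R (both (next≡ x i x≡ d) (next≡ y j y≡ (walk-sym d)))))

walk⇒traversal : ∀ {σ m n} (x : Vec (Fin σ) m) (y : Vec (Fin σ) n) {c} → Walk (toList x) (toList y) c → TraversalCost x y c
walk⇒traversal []      y       ()
walk⇒traversal (a ∷ x) []      ()
walk⇒traversal (a ∷ x) (b ∷ y) d = walk⇒reaches (a ∷ x) (b ∷ y) d Fin.zero Fin.zero refl refl 0 (start refl refl)

-- Symbols as functions of the position

-- For a bit c: if c then a else b.
choose : ℕ → ℕ → ℕ → ℕ
choose c a b = c * a + bit (c ≡ᵇ 0) * b

choose-less-< : ∀ {x y} a b → x < y → choose (arith less x y) a b ≡ a
choose-less-< {x} {y} a b x<y = trans (cong (λ t → choose (bit t) a b) (<ᵇ-true x<y)) (regroup a)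
  where
  regroup : ∀ a → a + 0 + 0 ≡ a
  regroup = solve-∀

choose-less-≥ : ∀ {x y} a b → y ≤ x → choose (arith less x y) a b ≡ b
choose-less-≥ {x} {y} a b y≤x = trans (cong (λ t → choose (bit t) a b) (<ᵇ-false y≤x)) (+-identityʳ b)

quot-+ : ∀ q {n o} → o < n → arith quot (q * n + o) n ≡ q
quot-+ q {suc n} {o} o<n = begin
  (q * suc n + o) / suc n           ≡⟨ +-distrib-/-∣ˡ o (divides q refl) ⟩
  q * suc n / suc n + o / suc n     ≡⟨ cong₂ _+_ (m*n/n≡m q (suc n)) (m<n⇒m/n≡0 o<n) ⟩
  q + 0                             ≡⟨ +-identityʳ q ⟩
  q ∎
  where open ≡-Reasoning

rem-+ : ∀ q {n o} → o < n → arith rem (q * n + o) n ≡ o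
rem-+ q {suc n} {o} o<n = trans (cong (_% suc n) (+-comm (q * suc n) o))
  (trans ([m+kn]%n≡m%n o q (suc n)) (m<n⇒m%n≡m o<n))

-- Runs are taken twice as long as blocks, so the period is 3B: first 2B times the number 4 of `#`,
-- then the block.
frameSpec : ℕ → (ℕ → ℕ → ℕ) → ℕ → ℕ
frameSpec B u i = choose (arith less e (B + B)) 4 (u (arith quot i p) (e ∸ (B + B)))
  where
  p e : ℕ
  p = B + B + B
  e = arith rem i p

-- The frame is continued forever with blocks that consist of `#` from number n on, so it passes
-- into the trailing padding by itself.
paddedSpec : ℕ → ℕ → (ℕ → ℕ → ℕ) → ℕ → ℕ
paddedSpec B n v i =
  choose (arith less i (n * (B + B))) 4
    (frameSpec B (λ t o → choose (arith less t n) (v t o) 4) (i ∸ n * (B + B)))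

coreSpec : ℕ → (ℕ → ℕ) → ℕ → ℕ
coreSpec M w o =
  choose (arith less e M) 2 (choose (arith less e (M + M)) 3 (w (arith quot o s)))
  where
  s e : ℕ
  s = M + M + 1
  e = arith rem o s

module _ {A : Set} where

  applyUpTo-cong : ∀ {f g : ℕ → A} n → (∀ i → i < n → f i ≡ g i) → applyUpTo f n ≡ applyUpTo g n
  applyUpTo-cong zero    f≗g = refl
  applyUpTo-cong (suc n) f≗g = cong₂ _∷_ (f≗g 0 z<s) (applyUpTo-cong n (λ i i<n → f≗g (suc i) (s≤s i<n)))

  applyUpTo-replicate : ∀ {f : ℕ → A} {a} n → (∀ i → i < n → f i ≡ a) → applyUpTo f n ≡ replicate n a
  applyUpTo-replicate zero    f≗a = refl
  applyUpTo-replicate (suc n) f≗a = cong₂ _∷_ (f≗a 0 z<s) (applyUpTo-replicate n (λ i i<n → f≗a (suc i) (s≤s i<n)))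

  applyUpTo-pointwise : ∀ {f g : ℕ → A} n → applyUpTo f n ≡ applyUpTo g n → ∀ i → i < n → f i ≡ g i
  applyUpTo-pointwise (suc n) e≡ zero    _   = proj₁ (∷-injective e≡)
  applyUpTo-pointwise (suc n) e≡ (suc i) i<n = applyUpTo-pointwise n (proj₂ (∷-injective e≡)) i (s≤s⁻¹ i<n)

-- The symbols 0 and 1 are the bits, 2 and 3 are α and β, 4 is # and 5 is ^.
module Symbols (σ-1 : ℕ) where

  σ : ℕ
  σ = suc σ-1

  fin : ℕ → Fin σ
  fin v = fromℕ< (m%n<n v σ)

  toℕ-fin : ∀ v → toℕ (fin v) ≡ arith rem v σ
  toℕ-fin v = toℕ-fromℕ< (m%n<n v σ)

  hash : Fin σ
  hash = fin 4

  open Frame hash using (frame)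

  core′ : ℕ → (ℕ → ℕ) → ℕ → List (Fin σ)
  core′ M w = core (fin 2) (fin 3) M (fin ∘ w)

  private
    shift : ∀ p t e → p + (t * p + e) ≡ suc t * p + e
    shift p t e = sym (+-assoc p (t * p) e)

  -- There is one run more than there are blocks, hence t ≤ T for the former and t < T for the
  -- latter.
  frame-list : ∀ (g : ℕ → Fin σ) (u : ℕ → ℕ → Fin σ) L B T →
    (∀ t e → t ≤ T → e < L → g (t * (L + B) + e) ≡ hash) →
    (∀ t o → t < T → o < B → g (t * (L + B) + (L + o)) ≡ u t o) →
    applyUpTo g (T * (L + B) + L) ≡ frame L (applyUpTo (λ t → applyUpTo (u t) B) T)
  frame-list g u L B zero    sep blk = applyUpTo-replicate L (λ i i<L → sep 0 i z≤n i<L)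
  frame-list g u L B (suc T) sep blk = begin
    applyUpTo g (L + B + T * (L + B) + L)
      ≡⟨ cong (applyUpTo g) (trans (cong (_+ L) (+-assoc L B _)) (trans (+-assoc L _ L) (cong (L +_) (+-assoc B _ L)))) ⟩
    applyUpTo g (L + (B + (T * (L + B) + L)))
      ≡⟨ applyUpTo-++ g L _ ⟩
    applyUpTo g L ++ applyUpTo (g ∘ (L +_)) (B + (T * (L + B) + L))
      ≡⟨ cong₂ _++_ (applyUpTo-replicate L (λ i i<L → sep 0 i z≤n i<L)) (applyUpTo-++ (g ∘ (L +_)) B _) ⟩
    replicate L hash ++ applyUpTo (g ∘ (L +_)) B ++ applyUpTo (g ∘ (L +_) ∘ (B +_)) (T * (L + B) + L)
      ≡⟨ cong (replicate L hash ++_) (cong₂ _++_ (applyUpTo-cong B (λ o o<B → blk 0 o z<s o<B))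
          (trans (applyUpTo-cong (T * (L + B) + L) (λ i _ → cong g (sym (+-assoc L B i))))
            (frame-list (g ∘ (L + B +_)) (u ∘ suc) L B T
              (λ t e t≤T e<L → trans (cong g (shift (L + B) t e)) (sep (suc t) e (s≤s t≤T) e<L))
              (λ t o t<T o<B → trans (cong g (shift (L + B) t (L + o))) (blk (suc t) o (s≤s t<T) o<B))))) ⟩
    frame L (applyUpTo (λ t → applyUpTo (u t) B) (suc T)) ∎
    where open ≡-Reasoning

  core-list : ∀ (g : ℕ → Fin σ) w M K →
    (∀ k e → k < K → e < M → g (k * (M + M + 1) + e) ≡ fin 2) →
    (∀ k e → k < K → e < M → g (k * (M + M + 1) + (M + e)) ≡ fin 3) →
    (∀ k → k < K → g (k * (M + M + 1) + (M + M)) ≡ fin (w k)) →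
    applyUpTo g (K * (M + M + 1)) ≡ core′ M w K
  core-list g w M zero    is-α is-β is-bit = refl
  core-list g w M (suc K) is-α is-β is-bit = begin
    applyUpTo g (M + M + 1 + K * s)
      ≡⟨ cong (applyUpTo g) (regroup M (K * s)) ⟩
    applyUpTo g (M + (M + suc (K * s)))
      ≡⟨ trans (applyUpTo-++ g M _) (cong (applyUpTo g M ++_) (applyUpTo-++ (g ∘ (M +_)) M _)) ⟩
    applyUpTo g M ++ applyUpTo (g ∘ (M +_)) M ++ g (M + (M + 0)) ∷ applyUpTo (g ∘ (M +_) ∘ (M +_) ∘ suc) (K * s)
      ≡⟨ cong₂ _++_ (applyUpTo-replicate M (λ i i<M → is-α 0 i z<s i<M))
          (cong₂ _++_ (applyUpTo-replicate M (λ i i<M → is-β 0 i z<s i<M))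
          (cong₂ _∷_ (trans (cong g (cong (M +_) (+-identityʳ M))) (is-bit 0 z<s))
            (trans (applyUpTo-cong (K * s) (λ i _ → cong g (sym (regroup M i))))
              (core-list (g ∘ (s +_)) (w ∘ suc) M K
                (λ k e k<K e<M → trans (cong g (shift s k e)) (is-α (suc k) e (s≤s k<K) e<M))
                (λ k e k<K e<M → trans (cong g (shift s k (M + e))) (is-β (suc k) e (s≤s k<K) e<M))
                (λ k k<K → trans (cong g (shift s k (M + M))) (is-bit (suc k) (s≤s k<K))))))) ⟩
    core′ M w (suc K) ∎
    where
    open ≡-Reasoning
    s : ℕ
    s = M + M + 1
    regroup : ∀ m k → m + m + 1 + k ≡ m + (m + suc k)
    regroup = solve-∀

  frameSpec-list : ∀ B u T →
    applyUpTo (fin ∘ frameSpec B u) (T * (B + B + B) + (B + B)) ≡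
    frame (B + B) (applyUpTo (λ t → applyUpTo (fin ∘ u t) B) T)
  frameSpec-list B u T = frame-list (fin ∘ frameSpec B u) (λ t → fin ∘ u t) (B + B) B T
    (λ t e _ e<L → cong fin (at-separator t e e<L)) (λ t o _ o<B → cong fin (at-block t o o<B))
    where
    at-separator : ∀ t e → e < B + B → frameSpec B u (t * (B + B + B) + e) ≡ 4
    at-separator t e e<L rewrite rem-+ t {B + B + B} (<-≤-trans e<L (m≤m+n (B + B) B)) = choose-less-< 4 _ e<L
    at-block : ∀ t o → o < B → frameSpec B u (t * (B + B + B) + (B + B + o)) ≡ u t o
    at-block t o o<B rewrite rem-+ t {B + B + B} (+-monoʳ-< (B + B) o<B) | quot-+ t {B + B + B} (+-monoʳ-< (B + B) o<B) =
      trans (choose-less-≥ 4 _ (m≤m+n (B + B) o)) (cong (u t) (m+n∸m≡n (B + B) o))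

  frameSpec-beyond : ∀ B n (v : ℕ → ℕ → ℕ) i → 0 < B → n * (B + B + B) ≤ i →
    frameSpec B (λ t o → choose (arith less t n) (v t o) 4) i ≡ 4
  frameSpec-beyond B@(suc _) n v i _ ≤i = by-cases (e <? B + B)
    where
    e x : ℕ
    e = arith rem i (B + B + B)
    x = v (arith quot i (B + B + B)) (e ∸ (B + B))
    by-cases : Dec (e < B + B) → frameSpec B (λ t o → choose (arith less t n) (v t o) 4) i ≡ 4
    by-cases (yes e<L) = choose-less-< 4 (choose (arith less (arith quot i (B + B + B)) n) x 4) e<L
    by-cases (no e≮L) = trans (choose-less-≥ 4 (choose (arith less (arith quot i (B + B + B)) n) x 4) (≮⇒≥ e≮L))
      (choose-less-≥ x 4 (≤-trans (≤-reflexive (sym (m*n/n≡m n (B + B + B)))) (/-monoˡ-≤ (B + B + B) ≤i)))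

  frame-blocks : ∀ B (u u′ : ℕ → ℕ → ℕ) T → (∀ t → t < T → applyUpTo (fin ∘ u t) B ≡ applyUpTo (fin ∘ u′ t) B) →
    frame (B + B) (applyUpTo (λ t → applyUpTo (fin ∘ u t) B) T) ≡ frame (B + B) (applyUpTo (λ t → applyUpTo (fin ∘ u′ t) B) T)
  frame-blocks B u u′ T u≗u′ = cong (frame (B + B)) (applyUpTo-cong T u≗u′)

  -- The length is that of a frame with 3 n blocks. After the leading run and the frame of n blocks,
  -- exactly twice the leading run is left over.
  paddedSpec-list : ∀ B n (v : ℕ → ℕ → ℕ) → 0 < B →
    applyUpTo (fin ∘ paddedSpec B n v) (3 * n * (B + B + B) + (B + B)) ≡
    replicate (n * (B + B)) hash ++ frame (B + B) (applyUpTo (λ t → applyUpTo (fin ∘ v t) B) n) ++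
      replicate (n * (B + B) + n * (B + B)) hash
  paddedSpec-list B n v 0<B = begin
    applyUpTo (fin ∘ paddedSpec B n v) (3 * n * (B + B + B) + (B + B))
      ≡⟨ cong (applyUpTo (fin ∘ paddedSpec B n v)) (regroup n B) ⟩
    applyUpTo (fin ∘ paddedSpec B n v) (P + (F + (P + P)))
      ≡⟨ applyUpTo-++ (fin ∘ paddedSpec B n v) P _ ⟩
    applyUpTo (fin ∘ paddedSpec B n v) P ++ applyUpTo (fin ∘ paddedSpec B n v ∘ (P +_)) (F + (P + P))
      ≡⟨ cong₂ _++_ (applyUpTo-replicate P (λ i i<P → cong fin (choose-less-< 4 (frameSpec B v′ (i ∸ P)) i<P)))
          (applyUpTo-cong (F + (P + P)) (λ i _ → cong fin (trans (choose-less-≥ 4 (frameSpec B v′ (P + i ∸ P)) (m≤m+n P i)) (cong (frameSpec B v′) (m+n∸m≡n P i))))) ⟩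
    replicate P hash ++ applyUpTo (fin ∘ frameSpec B v′) (F + (P + P))
      ≡⟨ cong (replicate P hash ++_) (applyUpTo-++ (fin ∘ frameSpec B v′) F (P + P)) ⟩
    replicate P hash ++ applyUpTo (fin ∘ frameSpec B v′) F ++ applyUpTo (fin ∘ frameSpec B v′ ∘ (F +_)) (P + P)
      ≡⟨ cong (replicate P hash ++_) (cong₂ _++_
          (trans (frameSpec-list B v′ n) (frame-blocks B v′ v n (λ t t<n → applyUpTo-cong B (λ o _ → cong fin (choose-less-< (v t o) 4 t<n)))))
          (applyUpTo-replicate (P + P) (λ i _ → cong fin (frameSpec-beyond B n v (F + i) 0<B
            (≤-trans (m≤m+n (n * (B + B + B)) (B + B)) (m≤m+n F i)))))) ⟩
    replicate P hash ++ frame (B + B) (applyUpTo (λ t → applyUpTo (fin ∘ v t) B) n) ++ replicate (P + P) hash ∎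
    where
    open ≡-Reasoning
    P F : ℕ
    P = n * (B + B)
    F = n * (B + B + B) + (B + B)
    v′ : ℕ → ℕ → ℕ
    v′ t o = choose (arith less t n) (v t o) 4
    regroup : ∀ n B → 3 * n * (B + B + B) + (B + B) ≡ n * (B + B) + (n * (B + B + B) + (B + B) + (n * (B + B) + n * (B + B)))
    regroup = solve-∀

  coreSpec-list : ∀ M (w w′ : ℕ → ℕ) K → (∀ k → k < K → w k ≡ w′ k) →
    applyUpTo (fin ∘ coreSpec M w) (K * (M + M + 1)) ≡ core′ M w′ K
  coreSpec-list M w w′ K w≗w′ = core-list (fin ∘ coreSpec M w) w′ M K
    (λ k e _ e<M → cong fin (at-α k e e<M)) (λ k e _ e<M → cong fin (at-β k e e<M))
    (λ k k<K → cong fin (trans (at-bit k) (w≗w′ k k<K)))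
    where
    s : ℕ
    s = M + M + 1
    2M<s : M + M < s
    2M<s = ≤-reflexive (+-comm 1 (M + M))
    at-α : ∀ k e → e < M → coreSpec M w (k * s + e) ≡ 2
    at-α k e e<M rewrite rem-+ k {s} (<-trans (<-≤-trans e<M (m≤m+n M M)) 2M<s) = choose-less-< 2 _ e<M
    at-β : ∀ k e → e < M → coreSpec M w (k * s + (M + e)) ≡ 3
    at-β k e e<M rewrite rem-+ k {s} (<-trans (+-monoʳ-< M e<M) 2M<s) =
      trans (choose-less-≥ 2 _ (m≤m+n M e)) (choose-less-< 3 _ (+-monoʳ-< M e<M))
    at-bit : ∀ k → coreSpec M w (k * s + (M + M)) ≡ w k
    at-bit k rewrite rem-+ k {s} 2M<s | quot-+ k {s} 2M<s =
      trans (choose-less-≥ 2 _ (m≤m+n M M)) (choose-less-≥ {M + M} {M + M} 3 (w k) ≤-refl)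

-- Vectors as bits

-- Each coordinate becomes four bits, so that the Hamming distance of leftCode x
-- and rightCode y is 1 + 2xy, and that of tunedCode x and rightCode y is 1 + 2x.
leftCode rightCode tunedCode : ℕ → ℕ → ℕ
leftCode x e  = choose (arith same e 0) 1 (choose (arith same e 1) (arith same x 0) (choose (arith same e 2) x 0))
rightCode y e = choose (arith same e 0) (arith same y 0) (choose (arith same e 1) y 0)
tunedCode x e = choose x (arith less 1 e) (arith less e 2)

bitsOf : (ℕ → ℕ → ℕ) → (ℕ → ℕ) → ℕ → ℕ
bitsOf f a k = f (a (arith quot k 4)) (arith rem k 4)

sumTo : (ℕ → ℕ) → ℕ → ℕ
sumTo f zero    = 0
sumTo f (suc n) = f 0 + sumTo (f ∘ suc) n

sumTo-cong : ∀ {f g} n → (∀ c → c < n → f c ≡ g c) → sumTo f n ≡ sumTo g n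
sumTo-cong zero    f≗g = refl
sumTo-cong (suc n) f≗g = cong₂ _+_ (f≗g 0 z<s) (sumTo-cong n (λ c c<n → f≗g (suc c) (s≤s c<n)))

sumTo-affine : ∀ f n → sumTo (λ c → 1 + 2 * f c) n ≡ n + 2 * sumTo f n
sumTo-affine f zero    = refl
sumTo-affine f (suc n) = trans (cong (1 + 2 * f 0 +_) (sumTo-affine (f ∘ suc) n)) (regroup (f 0) n (sumTo (f ∘ suc) n))
  where
  regroup : ∀ x n s → 1 + 2 * x + (n + 2 * s) ≡ suc n + 2 * (x + s)
  regroup = solve-∀

sumTo-less : ∀ r n → r ≤ n → sumTo (λ c → arith less c r) n ≡ r
sumTo-less zero    zero    _         = refl
sumTo-less zero    (suc n) _         = sumTo-less zero n z≤n
sumTo-less (suc r) (suc n) (s≤s r≤n) = cong suc (sumTo-less r n r≤n)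

quot-4+ : ∀ k → arith quot (4 + k) 4 ≡ suc (arith quot k 4)
quot-4+ k = +-distrib-/-∣ˡ {4} k (divides 1 refl)

rem-4+ : ∀ k → arith rem (4 + k) 4 ≡ arith rem k 4
rem-4+ k = trans (cong (_% 4) (+-comm 4 k)) ([m+n]%n≡m%n k 4)

IsBit : ℕ → Set
IsBit x = x ≡ 0 ⊎ x ≡ 1

bit? : ∀ {x} → x < 2 → IsBit x
bit? {0} _ = inj₁ refl
bit? {1} _ = inj₂ refl
bit? {suc (suc _)} (s≤s (s≤s ()))

less-bit : ∀ x y → IsBit (arith less x y)
less-bit x y = bit? (s≤s (bit≤1 (x <ᵇ y)))

same-bit : ∀ x y → IsBit (arith same x y)
same-bit x y = bit? (s≤s (bit≤1 (x ≡ᵇ y)))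

choose-bit : ∀ c a b → IsBit c → IsBit a → IsBit b → IsBit (choose c a b)
choose-bit _ a b (inj₁ refl) _ bb = subst IsBit (sym (+-identityʳ b)) bb
choose-bit _ a b (inj₂ refl) ba _ = subst IsBit (sym (trans (+-identityʳ (a + 0)) (+-identityʳ a))) ba

leftCode-bit : ∀ {x} e → IsBit x → IsBit (leftCode x e)
leftCode-bit {x} e bx = choose-bit (arith same e 0) _ _ (same-bit e 0) (inj₂ refl)
  (choose-bit (arith same e 1) _ _ (same-bit e 1) (same-bit x 0)
    (choose-bit (arith same e 2) _ _ (same-bit e 2) bx (inj₁ refl)))

rightCode-bit : ∀ {x} e → IsBit x → IsBit (rightCode x e)
rightCode-bit {x} e bx = choose-bit (arith same e 0) _ _ (same-bit e 0) (same-bit x 0)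
  (choose-bit (arith same e 1) _ _ (same-bit e 1) bx (inj₁ refl))

tunedCode-bit : ∀ {x} e → IsBit x → IsBit (tunedCode x e)
tunedCode-bit {x} e bx = choose-bit x _ _ bx (less-bit 1 e) (less-bit e 2)

module Codes (τ : ℕ) where

  open Symbols (4 + τ) public

  ham-cong : ∀ {w w′ v v′ : ℕ → Fin σ} K → (∀ k → w k ≡ w′ k) → (∀ k → v k ≡ v′ k) → ham w v K ≡ ham w′ v′ K
  ham-cong zero    p q = refl
  ham-cong (suc K) p q = cong₂ _+_ (cong₂ dist (p 0) (q 0)) (ham-cong K (p ∘ suc) (q ∘ suc))

  codeDistance : (f g : ℕ → ℕ → ℕ) → ℕ → ℕ → ℕ
  codeDistance f g x y = ham (fin ∘ f x) (fin ∘ g y) 4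

  ham-bitsOf : ∀ f g a b d → ham (fin ∘ bitsOf f a) (fin ∘ bitsOf g b) (d * 4) ≡ sumTo (λ c → codeDistance f g (a c) (b c)) d
  ham-bitsOf f g a b zero    = refl
  ham-bitsOf f g a b (suc d) = trans
    (cong (λ rest → x 0 + (x 1 + (x 2 + (x 3 + rest))))
      (trans (ham-cong (d * 4) (λ k → cong fin (cong₂ (λ q e → f (a q) e) (quot-4+ k) (rem-4+ k)))
                               (λ k → cong fin (cong₂ (λ q e → g (b q) e) (quot-4+ k) (rem-4+ k))))
        (ham-bitsOf f g (a ∘ suc) (b ∘ suc) d)))
    (regroup (x 0) (x 1) (x 2) (x 3) _)
    where
    x : ℕ → ℕ
    x e = dist (fin (f (a 0) e)) (fin (g (b 0) e))
    regroup : ∀ p q r s t → p + (q + (r + (s + t))) ≡ p + (q + (r + (s + 0))) + t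
    regroup = solve-∀

  left-right : ∀ {x y} → IsBit x → IsBit y → codeDistance leftCode rightCode x y ≡ 1 + 2 * (x * y)
  left-right (inj₁ refl) (inj₁ refl) = refl
  left-right (inj₁ refl) (inj₂ refl) = refl
  left-right (inj₂ refl) (inj₁ refl) = refl
  left-right (inj₂ refl) (inj₂ refl) = refl

  tuned-right : ∀ {x y} → IsBit x → IsBit y → codeDistance tunedCode rightCode x y ≡ 1 + 2 * x
  tuned-right (inj₁ refl) (inj₁ refl) = refl
  tuned-right (inj₁ refl) (inj₂ refl) = refl
  tuned-right (inj₂ refl) (inj₁ refl) = refl
  tuned-right (inj₂ refl) (inj₂ refl) = refl

  ham-left : ∀ a b d → (∀ c → IsBit (a c)) → (∀ c → IsBit (b c)) →
    ham (fin ∘ bitsOf leftCode a) (fin ∘ bitsOf rightCode b) (d * 4) ≡ d + 2 * sumTo (λ c → a c * b c) d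
  ham-left a b d ba bb = trans (ham-bitsOf leftCode rightCode a b d)
    (trans (sumTo-cong d (λ c _ → left-right (ba c) (bb c))) (sumTo-affine (λ c → a c * b c) d))

  ham-tuned : ∀ r b d → r ≤ d → (∀ c → IsBit (b c)) →
    ham (fin ∘ bitsOf tunedCode (λ c → arith less c r)) (fin ∘ bitsOf rightCode b) (d * 4) ≡ d + 2 * r
  ham-tuned r b d r≤d bb = trans (ham-bitsOf tunedCode rightCode (λ c → arith less c r) b d)
    (trans (sumTo-cong d (λ c _ → tuned-right (less-bit c r) (bb c)))
      (trans (sumTo-affine (λ c → arith less c r) d) (cong (λ s → d + 2 * s) (sumTo-less r d r≤d))))

  fin-bit-≢ : ∀ {x} → IsBit x → fin x ≢ fin 2 × fin x ≢ fin 3 × fin x ≢ fin 4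
  fin-bit-≢ (inj₁ refl) = (λ ()) , (λ ()) , (λ ())
  fin-bit-≢ (inj₂ refl) = (λ ()) , (λ ()) , (λ ())

coordinates : ∀ {d} → Vec (Fin 2) d → ℕ → ℕ
coordinates v = contents (toList (map toℕ v))

sumTo-dot : ∀ {d} (a b : Vec (Fin 2) d) → sumTo (λ c → coordinates a c * coordinates b c) d ≡ a ∙ b
sumTo-dot []      []      = refl
sumTo-dot (x ∷ a) (y ∷ b) = cong (toℕ x * toℕ y +_) (sumTo-dot a b)

contents-concat : ∀ {n d} (A : Vec (Vec (Fin 2) d) n) i {c} → c < d →
  contents (toList (map toℕ (concat A))) (toℕ i * d + c) ≡ coordinates (lookup A i) c
contents-concat {d = d} (a ∷ A) i {c} c<d = trans (cong (λ l → contents l (toℕ i * d + c))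
    (trans (cong toList (map-++ toℕ a (concat A))) (toList-++ (map toℕ a) (map toℕ (concat A))))) (by-index i)
  where
  len : length (toList (map toℕ a)) ≡ d
  len = length-toList (map toℕ a)
  by-index : ∀ i → contents (toList (map toℕ a) ++ toList (map toℕ (concat A))) (toℕ i * d + c) ≡ coordinates (lookup (a ∷ A) i) c
  by-index Fin.zero    = contents-++ˡ (toList (map toℕ a)) _ (subst (c <_) (sym len) c<d)
  by-index (Fin.suc i) = trans (cong (contents (toList (map toℕ a) ++ toList (map toℕ (concat A))))
      (trans (+-assoc d (toℕ i * d) c) (cong (λ l → l + (toℕ i * d + c)) (sym len))))
    (trans (contents-++ʳ (toList (map toℕ a)) (toList (map toℕ (concat A))) (toℕ i * d + c)) (contents-concat A i c<d))

module Rows (I : VectorSets) where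
  open VectorSets I

  cells : ℕ → ℕ
  cells = contents (Problem.memory MostOrthogonalVectors I)

  rowA rowB : ℕ → ℕ → ℕ
  rowA t c = cells (t * d + c)
  rowB j c = cells (n * d + (j * d + c))

  cells-bit : ∀ a → IsBit (cells a)
  cells-bit a = bit? (contents-< (Problem.memory MostOrthogonalVectors I) (s≤s z≤n) (memory-< I) a)

  lenA : length (toList (map toℕ (concat A))) ≡ n * d
  lenA = length-toList (map toℕ (concat A))

  offset< : ∀ {t c} → t < n → c < d → t * d + c < n * d
  offset< {t} {c} t<n c<d = <-≤-trans (+-monoʳ-< (t * d) c<d) (≤-trans (≤-reflexive (+-comm (t * d) d)) (*-monoˡ-≤ d t<n))

  rowA-coordinates : ∀ i {c} → c < d → rowA (toℕ i) c ≡ coordinates (lookup A i) c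
  rowA-coordinates i c<d = trans
    (contents-++ˡ (toList (map toℕ (concat A))) _ (subst (λ l → toℕ i * d + _ < l) (sym lenA) (offset< (toℕ<n i) c<d)))
    (contents-concat A i c<d)

  rowB-coordinates : ∀ j {c} → c < d → rowB (toℕ j) c ≡ coordinates (lookup B j) c
  rowB-coordinates j {c} c<d = trans (cong (λ l → cells (l + (toℕ j * d + c))) (sym lenA))
    (trans (contents-++ʳ (toList (map toℕ (concat A))) (toList (map toℕ (concat B))) (toℕ j * d + c)) (contents-concat B j c<d))

  dot-rows : ∀ i j → sumTo (λ c → rowA (toℕ i) c * rowB (toℕ j) c) d ≡ lookup A i ∙ lookup B j
  dot-rows i j = trans (sumTo-cong d (λ c c<d → cong₂ _*_ (rowA-coordinates i c<d) (rowB-coordinates j c<d)))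
    (sumTo-dot (lookup A i) (lookup B j))

-- Expressions that compute the symbols

nE dE rE : Expr
nE = var Fin.zero
dE = var (Fin.suc Fin.zero)
rE = var (Fin.suc (Fin.suc Fin.zero))

-- These expressions copy the functions on numbers term by term, so that evaluating them gives those
-- functions by mere computation.
chooseE : Expr → Expr → Expr → Expr
chooseE c a b = (c ‹ times › a) ‹ plus › ((c ‹ same › lit 0) ‹ times › b)

frameE : Expr → (Expr → Expr → Expr) → Expr → Expr
frameE B u i = chooseE (e ‹ less › (B ‹ plus › B)) (lit 4) (u (i ‹ quot › p) (e ‹ monus › (B ‹ plus › B)))
  where
  p e : Expr
  p = B ‹ plus › B ‹ plus › B
  e = i ‹ rem › p

paddedE : Expr → (Expr → Expr → Expr) → Expr → Expr
paddedE B v i =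
  chooseE (i ‹ less › (nE ‹ times › (B ‹ plus › B))) (lit 4)
    (frameE B (λ t o → chooseE (t ‹ less › nE) (v t o) (lit 4)) (i ‹ monus › (nE ‹ times › (B ‹ plus › B))))

coreE : Expr → (Expr → Expr) → Expr → Expr
coreE M w o =
  chooseE (e ‹ less › M) (lit 2) (chooseE (e ‹ less › (M ‹ plus › M)) (lit 3) (w (o ‹ quot › s)))
  where
  s e : Expr
  s = M ‹ plus › M ‹ plus › lit 1
  e = o ‹ rem › s

leftE rightE tunedE : Expr → Expr → Expr
leftE x e  = chooseE (e ‹ same › lit 0) (lit 1) (chooseE (e ‹ same › lit 1) (x ‹ same › lit 0) (chooseE (e ‹ same › lit 2) x (lit 0)))
rightE y e = chooseE (e ‹ same › lit 0) (y ‹ same › lit 0) (chooseE (e ‹ same › lit 1) y (lit 0))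
tunedE x e = chooseE x (lit 1 ‹ less › e) (e ‹ less › lit 2)

bitsE : (Expr → Expr → Expr) → (Expr → Expr) → Expr → Expr
bitsE f a k = f (a (k ‹ quot › lit 4)) (k ‹ rem › lit 4)

rowAE rowBE : Expr → Expr → Expr
rowAE t c = load (t ‹ times › dE ‹ plus › c)
rowBE j c = load (nE ‹ times › dE ‹ plus › (j ‹ times › dE ‹ plus › c))

totalE : Expr → Expr
totalE B = lit 3 ‹ times › nE ‹ times › (B ‹ plus › B ‹ plus › B) ‹ plus › (B ‹ plus › B)

-- The final remainder mirrors `fin`, which turns any number into a symbol.
symbolE : ℕ → Expr → (u v : Expr → Expr → Expr) → Expr
symbolE σ B u v =
  chooseE (counter ‹ less › totalE B) (frameE B u counter) (paddedE B v (counter ‹ monus › totalE B)) ‹ rem › lit σ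

total : ℕ → ℕ → ℕ
total B n = 3 * n * (B + B + B) + (B + B)

symbolSpec : ℕ → ℕ → (u v : ℕ → ℕ → ℕ) → ℕ → ℕ
symbolSpec B n u v i = choose (arith less i (total B n)) (frameSpec B u i) (paddedSpec B n v (i ∸ total B n))

module SymbolLists (τ : ℕ) where

  open Codes τ public
  open Frame hash public

  symbolSpec-x : ∀ B n (u v : ℕ → ℕ → ℕ) → applyUpTo (fin ∘ symbolSpec B n u v) (total B n) ≡
    frame (B + B) (applyUpTo (λ t → applyUpTo (fin ∘ u t) B) (3 * n))
  symbolSpec-x B n u v = trans
    (applyUpTo-cong (total B n) (λ i i< → cong fin (choose-less-< (frameSpec B u i) (paddedSpec B n v (i ∸ total B n)) i<)))
    (frameSpec-list B u (3 * n))

  symbolSpec-y : ∀ B n (u v : ℕ → ℕ → ℕ) → 0 < B → applyUpTo (fin ∘ symbolSpec B n u v ∘ (total B n +_)) (total B n) ≡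
    replicate (n * (B + B)) hash ++ frame (B + B) (applyUpTo (λ j → applyUpTo (fin ∘ v j) B) n) ++
      replicate (n * (B + B) + n * (B + B)) hash
  symbolSpec-y B n u v 0<B = trans
    (applyUpTo-cong (total B n) (λ i i< → cong fin (trans
      (choose-less-≥ (frameSpec B u (total B n + i)) (paddedSpec B n v (total B n + i ∸ total B n)) (m≤m+n (total B n) i))
      (cong (paddedSpec B n v) (m+n∸m≡n (total B n) i)))))
    (paddedSpec-list B n v 0<B)

  -- The arithmetic of positions is already settled by the list equations, so pointwise equality is
  -- read off from equality of lists. It shows that symbols depend on the memory only through the
  -- blocks.
  symbolSpec-cong : ∀ B n (u v u′ v′ : ℕ → ℕ → ℕ) → 0 < B →
    (∀ t → t < 3 * n → applyUpTo (fin ∘ u t) B ≡ applyUpTo (fin ∘ u′ t) B) →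
    (∀ j → j < n → applyUpTo (fin ∘ v j) B ≡ applyUpTo (fin ∘ v′ j) B) →
    ∀ i → i < total B n + total B n → fin (symbolSpec B n u v i) ≡ fin (symbolSpec B n u′ v′ i)
  symbolSpec-cong B n u v u′ v′ 0<B u≗ v≗ = applyUpTo-pointwise (N + N) (begin
    applyUpTo (fin ∘ symbolSpec B n u v) (N + N)
      ≡⟨ applyUpTo-++ (fin ∘ symbolSpec B n u v) N N ⟩
    applyUpTo (fin ∘ symbolSpec B n u v) N ++ applyUpTo (fin ∘ symbolSpec B n u v ∘ (N +_)) N
      ≡⟨ cong₂ _++_
          (trans (symbolSpec-x B n u v) (trans (cong (frame (B + B)) (applyUpTo-cong (3 * n) u≗)) (sym (symbolSpec-x B n u′ v′))))
          (trans (symbolSpec-y B n u v 0<B) (trans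
            (cong (λ vs → replicate (n * (B + B)) hash ++ frame (B + B) vs ++ replicate (n * (B + B) + n * (B + B)) hash) (applyUpTo-cong n v≗))
            (sym (symbolSpec-y B n u′ v′ 0<B)))) ⟩
    applyUpTo (fin ∘ symbolSpec B n u′ v′) N ++ applyUpTo (fin ∘ symbolSpec B n u′ v′ ∘ (N +_)) N
      ≡⟨ applyUpTo-++ (fin ∘ symbolSpec B n u′ v′) N N ⟨
    applyUpTo (fin ∘ symbolSpec B n u′ v′) (N + N) ∎)
    where
    open ≡-Reasoning
    N : ℕ
    N = total B n

-- Lengths of the sequences, and what the two reductions share

n≤total : ∀ {B n} → 0 < B → n ≤ total B n
n≤total {B} {n} 0<B = begin
  n                       ≤⟨ m≤n*m′ n {3} (s≤s z≤n) ⟩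
  3 * n                   ≤⟨ m≤m*n′ (3 * n) (≤-trans 0<B (m≤n+m B (B + B))) ⟩
  3 * n * (B + B + B)     ≤⟨ m≤m+n _ (B + B) ⟩
  total B n               ∎
  where open ≤-Reasoning

n*d≤total : ∀ {B n d} → d ≤ B → n * d ≤ total B n
n*d≤total {B} {n} {d} d≤B = begin
  n * d                   ≤⟨ *-mono-≤ (m≤n*m′ n {3} (s≤s z≤n)) (≤-trans d≤B (m≤n+m B (B + B))) ⟩
  3 * n * (B + B + B)     ≤⟨ m≤m+n _ (B + B) ⟩
  total B n               ∎
  where open ≤-Reasoning

coreSize : ℕ → ℕ
coreSize d = d * 4 * (d * 4 + d * 4 + 1)

-- The core is doubled because an LCS block consists of a core and of at most as many carets.
coreSize≤ : ∀ d → coreSize d + coreSize d ≤ 64 * suc d ^ 2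
coreSize≤ d = subst (coreSize d + coreSize d ≤_) (regroup d) (m≤m+n _ (120 * d + 64))
  where
  regroup : ∀ d → d * 4 * (d * 4 + d * 4 + 1) + d * 4 * (d * 4 + d * 4 + 1) + (120 * d + 64) ≡ 64 * (suc d * (suc d * 1))
  regroup = solve-∀

d≤coreSize : ∀ d → d ≤ coreSize d
d≤coreSize d = ≤-trans (m≤m*n′ d {4} (s≤s z≤n)) (m≤m*n′ (d * 4) (m≤n+m 1 (d * 4 + d * 4)))

-- 9 n B for the 3 n periods and, as 1 ≤ n, at most 2 n B for the last run; 704 is 11 · 64.
total≤ : ∀ {B n d} → B ≤ 64 * suc d ^ 2 → 1 ≤ n → total B n ≤ 704 * suc d ^ 2 * n
total≤ {B} {n} {d} B≤ 1≤n = begin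
  3 * n * (B + B + B) + (B + B)     ≤⟨ +-monoʳ-≤ (3 * n * (B + B + B)) (m≤n*m′ (B + B) 1≤n) ⟩
  3 * n * (B + B + B) + n * (B + B) ≡⟨ regroup n B ⟩
  11 * n * B                        ≤⟨ *-monoʳ-≤ (11 * n) B≤ ⟩
  11 * n * (64 * suc d ^ 2)         ≡⟨ regroup′ n (suc d ^ 2) ⟩
  704 * suc d ^ 2 * n               ∎
  where
  open ≤-Reasoning
  regroup : ∀ n B → 3 * n * (B + B + B) + n * (B + B) ≡ 11 * n * B
  regroup = solve-∀
  regroup′ : ∀ n x → 11 * n * (64 * x) ≡ 704 * x * n
  regroup′ = solve-∀

-- The reductions locate vectors by their indices while `HasPair` speaks of membership; each
-- alternative provides both forms.
pair? : ∀ I → let A = VectorSets.A I; B = VectorSets.B I; r = VectorSets.r I in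
  ((∃[ i ] ∃[ j ] lookup A i ∙ lookup B j ≤ r) × VectorSets.HasPair I) ⊎
  ((∀ i j → r < lookup A i ∙ lookup B j) × ¬ VectorSets.HasPair I)
pair? I with any? (λ i → any? (λ j → lookup (VectorSets.A I) i ∙ lookup (VectorSets.B I) j ≤? VectorSets.r I))
... | yes (i , j , ≤r) = inj₁ ((i , j , ≤r) , lookup (VectorSets.A I) i , lookup (VectorSets.B I) j , ∈-lookup i (VectorSets.A I) , ∈-lookup j (VectorSets.B I) , ≤r)
... | no none = inj₂ ((λ i j → ≰⇒> (λ ≤r → none (i , j , ≤r))) ,
  λ (a , b , a∈A , b∈B , ≤r) → none (index a∈A , index b∈B , subst₂ (λ a b → a ∙ b ≤ VectorSets.r I) (lookup-index a∈A) (lookup-index b∈B) ≤r))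

module _ (I : VectorSets) where
  open VectorSets I

  Local : (ℕ → ℕ) → Set
  Local m = ∀ a → a < n * d + n * d → m a ≡ contents (Problem.memory MostOrthogonalVectors I) a

-- `unit` is the common length of all blocks, and u and v give the symbol at an offset within a left
-- or a right block. They take the memory as an argument, because the actual memory differs from the
-- input in the cells that are being written.
module Assembly (τ : ℕ) (unitE : Expr) (uE vE : Expr → Expr → Expr)
  (unit : ℕ → ℕ → ℕ) (u v : (ℕ → ℕ) → ℕ → ℕ → ℕ → ℕ → ℕ → ℕ)
  (unit≡ : ∀ n d r i m → eval (env n d r i) m unitE ≡ unit d r)
  (d≤unit : ∀ d r → d ≤ unit d r) (unit≤ : ∀ d r → unit d r ≤ 64 * suc d ^ 2)
  (symbolE≡ : ∀ n d r i m → eval (env n d r i) m (symbolE (5 + τ) unitE uE vE) ≡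
    arith rem (symbolSpec (unit d r) n (u m n d r) (v m n d r) i) (5 + τ))
  where

  open SymbolLists τ public

  symbolAt : VectorSets → ℕ → Fin σ
  symbolAt I i = fin (symbolSpec (unit d r) n (u cells n d r) (v cells n d r) i)
    where
    open VectorSets I
    open Rows I using (cells)

  module Sequences (I : VectorSets) (r<d : VectorSets.r I < VectorSets.d I) (lefts rights : ℕ → List (Fin σ)) where
    open VectorSets I using (n; d; r)
    open Rows I

    U L P : ℕ
    U = unit d r
    L = U + U
    P = n * L

    0<n : 0 < n
    0<n = >-nonZero⁻¹ n {{VectorSets.nonZero I}}

    0<U : 0 < U
    0<U = ≤-trans (≤-<-trans z≤n r<d) (d≤unit d r)

    leftBlocks rightBlocks : List (List (Fin σ))
    leftBlocks  = applyUpTo lefts (3 * n)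
    rightBlocks = applyUpTo rights n

    xFrame yFrame : List (Fin σ)
    xFrame = frame L leftBlocks
    yFrame = replicate P hash ++ frame L rightBlocks ++ replicate (P + P) hash

    module _
      (left-block : ∀ m → Local I m → ∀ t → applyUpTo (fin ∘ u m n d r t) U ≡ lefts t)
      (right-block : ∀ m → Local I m → ∀ j → j < n → applyUpTo (fin ∘ v m n d r j) U ≡ rights j)
      where

      x-list : applyUpTo (symbolAt I) (total U n) ≡ xFrame
      x-list = trans (symbolSpec-x U n (u cells n d r) (v cells n d r))
        (cong (frame L) (applyUpTo-cong (3 * n) (λ t _ → left-block cells (λ _ _ → refl) t)))

      y-list : applyUpTo (symbolAt I ∘ (total U n +_)) (total U n) ≡ yFrame
      y-list = trans (symbolSpec-y U n (u cells n d r) (v cells n d r) 0<U)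
        (cong (λ vs → replicate P hash ++ frame L vs ++ replicate (P + P) hash)
          (applyUpTo-cong n (λ j j<n → right-block cells (λ _ _ → refl) j j<n)))

      symbol-local : ∀ m → Local I m → ∀ i → i < total U n + total U n →
        eval (env n d r i) m (symbolE σ unitE uE vE) ≡ toℕ (symbolAt I i)
      symbol-local m local i i< = trans (symbolE≡ n d r i m)
        (trans (sym (toℕ-fin (symbolSpec U n (u m n d r) (v m n d r) i)))
          (cong toℕ (symbolSpec-cong U n (u m n d r) (v m n d r) (u cells n d r) (v cells n d r) 0<U
            (λ t _ → trans (left-block m local t) (sym (left-block cells (λ _ _ → refl) t)))
            (λ j j<n → trans (right-block m local j j<n) (sym (right-block cells (λ _ _ → refl) j j<n))) i i<)))

  LeftList RightList : (VectorSets → ℕ → List (Fin σ)) → Set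
  LeftList lefts = ∀ I → VectorSets.r I < VectorSets.d I → ∀ m → Local I m → ∀ t →
    applyUpTo (fin ∘ u m (VectorSets.n I) (VectorSets.d I) (VectorSets.r I) t) (unit (VectorSets.d I) (VectorSets.r I)) ≡ lefts I t
  RightList rights = ∀ I → VectorSets.r I < VectorSets.d I → ∀ m → Local I m → ∀ j → j < VectorSets.n I →
    applyUpTo (fin ∘ v m (VectorSets.n I) (VectorSets.d I) (VectorSets.r I) j) (unit (VectorSets.d I) (VectorSets.r I)) ≡ rights I j

  assemble : ∀ {Answer : SequencePair σ → ℕ → Set} (lefts rights : VectorSets → ℕ → List (Fin σ)) →
    LeftList lefts → RightList rights →
    (thrE : Expr) (threshold : ℕ → ℕ → ℕ → ℕ) →
    (∀ {n d r i} m → eval (env n d r i) m thrE ≡ threshold n d r) → (increasing : Bool) →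
    (∀ I (r<d : VectorSets.r I < VectorSets.d I) S ℓ →
      toList (SequencePair.x S) ≡ Sequences.xFrame I r<d (lefts I) (rights I) →
      toList (SequencePair.y S) ≡ Sequences.yFrame I r<d (lefts I) (rights I) → Answer S ℓ →
      Decides I (verdict increasing (threshold (VectorSets.n I) (VectorSets.d I) (VectorSets.r I)) ℓ)) →
    Reduction σ Answer
  assemble lefts rights left-block right-block thrE threshold threshold≡ increasing decides = record
    { sizeE = totalE unitE
    ; symE = symbolE σ unitE uE vE
    ; thrE = thrE
    ; size = λ n d r → total (unit d r) n
    ; threshold = threshold
    ; size≡ = λ {n} {d} {r} {i} m → cong (λ U → total U n) (unit≡ n d r i m)
    ; threshold≡ = threshold≡
    ; factor = 704
    ; 1≤factor = s≤s z≤n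
    ; n≤size = λ {n} {d} {r} r<d → n≤total {unit d r} {n} (≤-trans (≤-<-trans z≤n r<d) (d≤unit d r))
    ; n*d≤size = λ {n} {d} {r} _ → n*d≤total {unit d r} {n} {d} (d≤unit d r)
    ; size≤ = λ {n} {d} {r} _ 1≤n → total≤ {unit d r} {n} {d} (unit≤ d r) 1≤n
    ; symbol = symbolAt
    ; symbol≡ = λ I r<d m local → Sequences.symbol-local I r<d (lefts I) (rights I) (left-block I r<d) (right-block I r<d) m
        (λ a a< → local a (<-≤-trans a< (+-mono-≤ (n*d≤N I) (n*d≤N I))))
    ; increasing = increasing
    ; decides = λ I r<d ℓ → decides I r<d _ ℓ
        (trans (toList-tabulate _ (symbolAt I)) (Sequences.x-list I r<d (lefts I) (rights I) (left-block I r<d) (right-block I r<d)))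
        (trans (toList-tabulate _ (symbolAt I ∘ (_ +_))) (Sequences.y-list I r<d (lefts I) (rights I) (left-block I r<d) (right-block I r<d)))
    }
    where
    n*d≤N : ∀ I → VectorSets.n I * VectorSets.d I ≤ total (unit (VectorSets.d I) (VectorSets.r I)) (VectorSets.n I)
    n*d≤N I = n*d≤total {unit (VectorSets.d I) (VectorSets.r I)} {VectorSets.n I} {VectorSets.d I} (d≤unit _ (VectorSets.r I))

-- The reduction to LCS

module LcsReduction where

  open SymbolLists 2 using (fin)

  caret : Fin 7
  caret = fin 5

  -- One less than the LCS of the codes of two vectors with a ∙ b = r.
  base : ℕ → ℕ → ℕ
  base d r = d * 4 * (d * 4 + d * 4) + (3 * d ∸ (1 + 2 * r))

  unit : ℕ → ℕ → ℕ
  unit d r = base d r + coreSize d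

  -- All (3 n + 1) L hashes of the left sequence, and E for each of the n blocks of the right one.
  threshold : ℕ → ℕ → ℕ → ℕ
  threshold n d r = (3 * n + 1) * (unit d r + unit d r) + n * base d r

  KE gE baseE unitE thresholdE : Expr
  KE = dE ‹ times › lit 4
  gE = KE ‹ times › (KE ‹ plus › KE ‹ plus › lit 1)
  baseE = KE ‹ times › (KE ‹ plus › KE) ‹ plus › (lit 3 ‹ times › dE ‹ monus › (lit 1 ‹ plus › (lit 2 ‹ times › rE)))
  unitE = baseE ‹ plus › gE
  thresholdE = (lit 3 ‹ times › nE ‹ plus › lit 1) ‹ times › (unitE ‹ plus › unitE) ‹ plus › (nE ‹ times › baseE)

  uE vE : Expr → Expr → Expr
  uE t o = chooseE (o ‹ less › baseE) (lit 5) (coreE KE (bitsE leftE (rowAE (t ‹ rem › nE))) (o ‹ monus › baseE))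
  vE j o = chooseE (o ‹ less › gE) (coreE KE (bitsE rightE (rowBE j)) o) (lit 5)

  module Spec (m : ℕ → ℕ) (n d r : ℕ) where

    rowA rowB : ℕ → ℕ → ℕ
    rowA t c = m (t * d + c)
    rowB j c = m (n * d + (j * d + c))

    u v : ℕ → ℕ → ℕ
    u t o = choose (arith less o (base d r)) 5 (coreSpec (d * 4) (bitsOf leftCode (rowA (arith rem t n))) (o ∸ base d r))
    v j o = choose (arith less o (coreSize d)) (coreSpec (d * 4) (bitsOf rightCode (rowB j)) o) 5

  base≤coreSize : ∀ d r → base d r ≤ coreSize d
  base≤coreSize d r = ≤-trans (+-monoʳ-≤ (d * 4 * (d * 4 + d * 4)) (≤-trans (m∸n≤m (3 * d) (1 + 2 * r)) (≤-trans (m≤n+m (3 * d) d) (≤-reflexive (*-comm 4 d)))))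
    (≤-reflexive (regroup d))
    where
    regroup : ∀ d → d * 4 * (d * 4 + d * 4) + d * 4 ≡ d * 4 * (d * 4 + d * 4 + 1)
    regroup = solve-∀

  open Assembly 2 unitE uE vE unit Spec.u Spec.v (λ _ _ _ _ _ → refl)
    (λ d r → ≤-trans (d≤coreSize d) (m≤n+m (coreSize d) (base d r)))
    (λ d r → ≤-trans (+-monoˡ-≤ (coreSize d) (base≤coreSize d r)) (coreSize≤ d))
    (λ _ _ _ _ _ → refl) hiding (fin)

  module Blocks (d : ℕ) where

    K : ℕ
    K = d * 4

    leftBlock rightBlock : ℕ → (ℕ → ℕ) → List (Fin 7)
    leftBlock E a = replicate E caret ++ core′ K (bitsOf leftCode a) K
    rightBlock E b = core′ K (bitsOf rightCode b) K ++ replicate E caret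

    coordinate< : ∀ {k} → k < K → arith quot k 4 < d
    coordinate< {k} k<K = m<n*o⇒m/o<n {k} {d} {4} k<K

    left-list : ∀ E a a′ → (∀ c → c < d → a c ≡ a′ c) →
      applyUpTo (λ o → fin (choose (arith less o E) 5 (coreSpec K (bitsOf leftCode a) (o ∸ E)))) (E + coreSize d) ≡ leftBlock E a′
    left-list E a a′ a≗a′ = trans (applyUpTo-++ f E (coreSize d)) (cong₂ _++_
      (applyUpTo-replicate E (λ o o<E → cong fin (choose-less-< 5 (spec (o ∸ E)) o<E)))
      (trans (applyUpTo-cong (coreSize d) (λ o _ → cong fin (trans (choose-less-≥ 5 (spec (E + o ∸ E)) (m≤m+n E o)) (cong spec (m+n∸m≡n E o)))))
        (coreSpec-list K (bitsOf leftCode a) (bitsOf leftCode a′) K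
          (λ k k<K → cong (λ x → leftCode x (arith rem k 4)) (a≗a′ (arith quot k 4) (coordinate< k<K))))))
      where
      spec : ℕ → ℕ
      spec = coreSpec K (bitsOf leftCode a)
      f : ℕ → Fin 7
      f o = fin (choose (arith less o E) 5 (spec (o ∸ E)))

    right-list : ∀ E b b′ → (∀ c → c < d → b c ≡ b′ c) →
      applyUpTo (λ o → fin (choose (arith less o (coreSize d)) (coreSpec K (bitsOf rightCode b) o) 5)) (E + coreSize d) ≡ rightBlock E b′
    right-list E b b′ b≗b′ = trans (cong (applyUpTo f) (+-comm E (coreSize d))) (trans (applyUpTo-++ f (coreSize d) E) (cong₂ _++_
      (trans (applyUpTo-cong (coreSize d) (λ o o< → cong fin (choose-less-< (spec o) 5 o<)))
        (coreSpec-list K (bitsOf rightCode b) (bitsOf rightCode b′) K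
          (λ k k<K → cong (λ x → rightCode x (arith rem k 4)) (b≗b′ (arith quot k 4) (coordinate< k<K)))))
      (applyUpTo-replicate E (λ o _ → cong fin (choose-less-≥ (spec (coreSize d + o)) 5 (m≤m+n (coreSize d) o))))))
      where
      spec : ℕ → ℕ
      spec = coreSpec K (bitsOf rightCode b)
      f : ℕ → Fin 7
      f o = fin (choose (arith less o (coreSize d)) (spec o) 5)

    module Pair (E : ℕ) (a b : ℕ → ℕ) (ba : ∀ c → IsBit (a c)) (bb : ∀ c → IsBit (b c)) where

      w w′ : ℕ → Fin 7
      w  = fin ∘ bitsOf leftCode a
      w′ = fin ∘ bitsOf rightCode b

      w-bit : ∀ k → IsBit (bitsOf leftCode a k)
      w-bit k = leftCode-bit (arith rem k 4) (ba (arith quot k 4))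

      w′-bit : ∀ k → IsBit (bitsOf rightCode b k)
      w′-bit k = rightCode-bit (arith rem k 4) (bb (arith quot k 4))

      bit≢caret : ∀ {x} → IsBit x → fin x ≢ caret
      bit≢caret (inj₁ refl) = λ ()
      bit≢caret (inj₂ refl) = λ ()

      dot : ℕ
      dot = sumTo (λ c → a c * b c) d

      agreement≡ : agreement w w′ K + (d + 2 * dot) ≡ K
      agreement≡ = trans (+-comm (agreement w w′ K) _)
        (trans (cong (_+ agreement w w′ K) (sym (ham-left a b d ba bb))) (ham+agreement w w′ K))

      -- Of the 4 d bits, d + 2 (a ∙ b) disagree.
      agreement+ : agreement w w′ K + 2 * dot ≡ 3 * d
      agreement+ = +-cancelʳ-≡ d _ _ (trans (regroup (agreement w w′ K) dot d) (trans agreement≡ (regroup′ d)))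
        where
        regroup : ∀ g x d → g + 2 * x + d ≡ g + (d + 2 * x)
        regroup = solve-∀
        regroup′ : ∀ d → d * 4 ≡ 3 * d + d
        regroup′ = solve-∀

      plain-left : All (_≢ hash) (leftBlock E a)
      plain-left = AllP.++⁺ (AllP.replicate⁺ E (λ ())) (core-All (fin 2) (fin 3) K (λ ()) (λ ()) w (λ k → proj₂ (proj₂ (fin-bit-≢ (w-bit k)))) K)

      plain-right : All (_≢ hash) (rightBlock E b)
      plain-right = AllP.++⁺ (core-All (fin 2) (fin 3) K (λ ()) (λ ()) w′ (λ k → proj₂ (proj₂ (fin-bit-≢ (w′-bit k)))) K) (AllP.replicate⁺ E (λ ()))

      length-left : length (leftBlock E a) ≡ E + coreSize d
      length-left = trans (length-++ (replicate E caret)) (cong₂ _+_ (length-replicate E) (length-core (fin 2) (fin 3) K w K))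

      length-right : length (rightBlock E b) ≡ E + coreSize d
      length-right = trans (length-++ (core′ K (bitsOf rightCode b) K))
        (trans (cong₂ _+_ (length-core (fin 2) (fin 3) K w′ K) (length-replicate E)) (+-comm (coreSize d) E))

      core-common-bound : CommonBound (core′ K (bitsOf leftCode a) K) (core′ K (bitsOf rightCode b) K) (K * (K + K) + agreement w w′ K)
      core-common-bound = core-bound w w′ K
        (λ k → proj₁ (fin-bit-≢ (w-bit k)) , proj₁ (proj₂ (fin-bit-≢ (w-bit k))))
        (λ k → proj₁ (fin-bit-≢ (w′-bit k)) , proj₁ (proj₂ (fin-bit-≢ (w′-bit k))))
        (≤-trans (m≤m+n K K) (m≤m+n (K + K) 1))

      block-bound : K * (K + K) + agreement w w′ K ≤ E → CommonBound (leftBlock E a) (rightBlock E b) E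
      block-bound ≤E = choice-bound
        (core-All (fin 2) (fin 3) K (λ ()) (λ ()) w (λ k → bit≢caret (w-bit k)) K)
        (core-All (fin 2) (fin 3) K (λ ()) (λ ()) w′ (λ k → bit≢caret (w′-bit k)) K)
        (λ z s t → ≤-trans (core-common-bound z s t) ≤E)

      block-common : Common (leftBlock E a) (rightBlock E b) (K * (K + K) + agreement w w′ K)
      block-common =
        let z , s , t , ≤z = common-core {α = fin 2} {β = fin 3} {M = K} w w′ K
        in z , ++⁺ˡ (replicate E caret) s , ++⁺ʳ (replicate E caret) t , ≤z

  module OnInstance (I : VectorSets) (r<d : VectorSets.r I < VectorSets.d I) where
    open VectorSets I using (n; d; r; A; B)
    open Rows I
    open Blocks d

    E : ℕ
    E = base d r

    open Sequences I r<d (λ t → leftBlock E (rowA (arith rem t n))) (λ j → rightBlock E (rowB j))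

    rem<n : ∀ t → arith rem t n < n
    rem<n t = remainder n 0<n
      where
      remainder : ∀ n → 0 < n → arith rem t n < n
      remainder (suc n) _ = m%n<n t (suc n)

    left-block : ∀ m → Local I m → ∀ t → applyUpTo (fin ∘ Spec.u m n d r t) U ≡ leftBlock E (rowA (arith rem t n))
    left-block m local t = left-list E (Spec.rowA m n d r (arith rem t n)) (rowA (arith rem t n))
      (λ c c<d → local _ (≤-trans (offset< (rem<n t) c<d) (m≤m+n (n * d) (n * d))))

    right-block : ∀ m → Local I m → ∀ j → j < n → applyUpTo (fin ∘ Spec.v m n d r j) U ≡ rightBlock E (rowB j)
    right-block m local j j<n = right-list E (Spec.rowB m n d r j) (rowB j)
      (λ c c<d → local _ (+-monoʳ-< (n * d) (offset< j<n c<d)))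

    module Match (t j : ℕ) = Pair E (rowA t) (rowB j) (λ c → cells-bit (t * d + c)) (λ c → cells-bit (n * d + (j * d + c)))

    -- Ensures that the subtraction in `base` is not truncated.
    2r<3d : 1 + 2 * r ≤ 3 * d
    2r<3d = ≤-trans (≤-trans (s≤s (m≤n+m (2 * r) 1)) (≤-reflexive (regroup r))) (*-mono-≤ (s≤s (s≤s (z≤n {1}))) r<d)
      where
      regroup : ∀ r → 2 + 2 * r ≡ 2 * suc r
      regroup = solve-∀

    -- Agreements vary in steps of two, so 3 d - 2 r - 1 lies strictly between their values for a ∙
    -- b = r + 1 and a ∙ b = r. E is built on this number, which separates the two kinds of pairs by
    -- one on either side.
    bad-agreement : ∀ {g x} → g + 2 * x ≡ 3 * d → r < x → g ≤ 3 * d ∸ (1 + 2 * r)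
    bad-agreement {g} {x} e≡ r<x = begin
      g                           ≡⟨ m+n∸n≡m g (2 * x) ⟨
      g + 2 * x ∸ 2 * x           ≡⟨ cong (_∸ 2 * x) e≡ ⟩
      3 * d ∸ 2 * x               ≤⟨ ∸-monoʳ-≤ (3 * d) (≤-trans (s≤s (m≤n+m (2 * r) 1)) (≤-trans (≤-reflexive (regroup r)) (*-monoʳ-≤ 2 r<x))) ⟩
      3 * d ∸ (1 + 2 * r)         ∎
      where
      open ≤-Reasoning
      regroup : ∀ r → 2 + 2 * r ≡ 2 * suc r
      regroup = solve-∀

    good-agreement : ∀ {g x} → g + 2 * x ≡ 3 * d → x ≤ r → suc (3 * d ∸ (1 + 2 * r)) ≤ g
    good-agreement {g} {x} e≡ x≤r = +-cancelʳ-≤ (2 * x) _ _ (begin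
      suc (3 * d ∸ (1 + 2 * r)) + 2 * x       ≤⟨ +-monoʳ-≤ (suc (3 * d ∸ (1 + 2 * r))) (*-monoʳ-≤ 2 x≤r) ⟩
      suc (3 * d ∸ (1 + 2 * r)) + 2 * r       ≡⟨ +-suc (3 * d ∸ (1 + 2 * r)) (2 * r) ⟨
      3 * d ∸ (1 + 2 * r) + (1 + 2 * r)       ≡⟨ m∸n+n≡m 2r<3d ⟩
      3 * d                                   ≡⟨ e≡ ⟨
      g + 2 * x                               ∎)
      where open ≤-Reasoning

    dot≡ : ∀ i j → Match.dot (toℕ i) (toℕ j) ≡ lookup A i ∙ lookup B j
    dot≡ = dot-rows

    by-index : ∀ {Q : ℕ → ℕ → Set} → (∀ (i j : Fin n) → Q (toℕ i) (toℕ j)) → ∀ {i j} → i < n → j < n → Q i j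
    by-index {Q} q i<n j<n = subst₂ Q (toℕ-fromℕ< i<n) (toℕ-fromℕ< j<n) (q (fromℕ< i<n) (fromℕ< j<n))

    no-pair-bound : (∀ i j → r < lookup A i ∙ lookup B j) →
      CommonBound xFrame yFrame (threshold n d r)
    no-pair-bound far = subst (CommonBound _ _) (cong₂ _+_ hashes≡ (cong (_* E) (length-applyUpTo _ n)))
      (padded-bound hash {U} {L} {E} {P} {P + P} ≤-refl rightBlocks
        -- The row 0 is a placeholder: symbols and length of a right block do not depend on the left
        -- vector of the pair.
        (AllP.applyUpTo⁺₁ _ n (λ {j} j<n → Match.plain-right 0 j , ≤-reflexive (Match.length-right 0 j)))
        (AllP.applyUpTo⁺₁ _ n (λ {j} j<n → AllP.applyUpTo⁺₂ _ (3 * n) (λ t →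
          (Match.plain-left (arith rem t n) 0 , ≤-reflexive (Match.length-left (arith rem t n) 0)) ,
          Match.block-bound (arith rem t n) j (+-monoʳ-≤ (d * 4 * (d * 4 + d * 4))
            (bad-agreement (Match.agreement+ (arith rem t n) j)
              (by-index {λ i j → r < Match.dot i j} (λ i j → subst (r <_) (sym (dot≡ i j)) (far i j)) (rem<n t) j<n)))))))
      where
      hashes≡ : hashes xFrame ≡ (3 * n + 1) * L
      hashes≡ = trans (hashes-frame hash L (AllP.applyUpTo⁺₂ _ (3 * n) (λ t → Match.plain-left (arith rem t n) 0)))
        (cong (_* L) (trans (cong suc (length-applyUpTo _ (3 * n))) (+-comm 1 (3 * n))))

    -- The left block aligned with right block j has index s + j and must be row i modulo n. The
    -- shift is i - j, increased by n if negative, so the n aligned blocks lie within the first 2 n.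
    shift-to : ∀ {i j} → i < n → j < n → ∃[ s ] s ≤ n × arith rem (s + j) n ≡ i
    shift-to {i} {j} i<n j<n with j ≤? i
    ... | yes j≤i = i ∸ j , ≤-trans (m∸n≤m i j) (<⇒≤ i<n) ,
      trans (cong (λ z → arith rem z n) (m∸n+n≡m j≤i)) (rem-+ 0 i<n)
    ... | no j≰i = n + i ∸ j , ≤-trans (∸-monoʳ-≤ (n + i) (<⇒≤ (≰⇒> j≰i))) (≤-reflexive (m+n∸n≡m n i)) ,
      trans (cong (λ z → arith rem z n) (trans (m∸n+n≡m (≤-trans (<⇒≤ j<n) (m≤m+n n i))) (cong (_+ i) (sym (*-identityˡ n))))) (rem-+ 1 i<n)

    carets : List (Fin 7)
    carets = replicate E caret

    leftAt : ℕ → List (Fin 7)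
    leftAt t = leftBlock E (rowA (arith rem t n))

    good-pair-common : ∀ i j → lookup A i ∙ lookup B j ≤ r →
      Common xFrame yFrame (suc (threshold n d r))
    good-pair-common i j ≤r with shift-to (toℕ<n i) (toℕ<n j)
    ... | s , s≤n , rem≡ =
      subst₂ (λ us vs → Common (frame L us) (replicate P hash ++ frame L vs ++ replicate (P + P) hash) (suc (threshold n d r)))
        (sym left≡) (sym right≡)
        (subst (Common _ _) count
          (frame-common hash {L} carets pre us₁ us₂ post vs₁ vs₂ {P} {P + P} {suc E}
            (trans (length-applyUpTo _ j′) (sym (length-applyUpTo _ j′))) (trans (length-applyUpTo _ n₁) (sym (length-applyUpTo _ n₁)))
            (AllP.applyUpTo⁺₂ _ j′ (λ t → left-carets (s + t)))
            (AllP.applyUpTo⁺₂ _ n₁ (λ t → left-carets (s + (j′ + suc t))))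
            (AllP.applyUpTo⁺₂ _ j′ right-carets)
            (AllP.applyUpTo⁺₂ _ n₁ (λ t → right-carets (j′ + suc t)))
            matched
            (≤-trans (≤-reflexive (cong (_* L) (length-applyUpTo _ s))) (*-monoˡ-≤ L s≤n))
            (≤-trans (≤-reflexive (cong (_* L) (length-applyUpTo _ p)))
              (≤-trans (*-monoˡ-≤ L (+-monoˡ-≤ n (m∸n≤m n s))) (≤-reflexive (*-distribʳ-+ L n n))))))
      where
      j′ n₁ p : ℕ
      j′ = toℕ j
      n₁ = n ∸ suc j′
      -- The number 3 n - s - n of blocks behind the aligned ones. It is at most 2 n, which is why
      -- the trailing padding is P + P.
      p  = n ∸ s + n
      n≡ : n ≡ j′ + suc n₁
      n≡ = trans (sym (m+[n∸m]≡n (toℕ<n j))) (sym (+-suc j′ n₁))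
      3n≡ : 3 * n ≡ s + (j′ + suc (n₁ + p))
      3n≡ = begin
        3 * n                       ≡⟨ expand n ⟩
        n + (n + n)                 ≡⟨ cong₂ (λ x y → x + (y + n)) n≡ (sym (m+[n∸m]≡n s≤n)) ⟩
        j′ + suc n₁ + (s + (n ∸ s) + n) ≡⟨ regroup j′ n₁ s (n ∸ s) n ⟩
        s + (j′ + suc (n₁ + p)) ∎
        where
        open ≡-Reasoning
        expand : ∀ n → 3 * n ≡ n + (n + n)
        expand = solve-∀
        regroup : ∀ j m s q n → j + suc m + (s + q + n) ≡ s + (j + suc (m + (q + n)))
        regroup = solve-∀
      pre us₁ us₂ post vs₁ vs₂ : List (List (Fin 7))
      pre  = applyUpTo leftAt s
      us₁  = applyUpTo (leftAt ∘ (s +_)) j′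
      us₂  = applyUpTo (leftAt ∘ (s +_) ∘ (j′ +_) ∘ suc) n₁
      post = applyUpTo (leftAt ∘ (s +_) ∘ (j′ +_) ∘ suc ∘ (n₁ +_)) p
      vs₁  = applyUpTo (λ j → rightBlock E (rowB j)) j′
      vs₂  = applyUpTo ((λ j → rightBlock E (rowB j)) ∘ (j′ +_) ∘ suc) n₁
      left≡ : leftBlocks ≡ pre ++ us₁ ++ leftAt (s + (j′ + 0)) ∷ us₂ ++ post
      left≡ = trans (cong (applyUpTo leftAt) 3n≡) (trans (applyUpTo-++ leftAt s _) (cong (pre ++_)
        (trans (applyUpTo-++ (leftAt ∘ (s +_)) j′ _) (cong (us₁ ++_) (cong (leftAt (s + (j′ + 0)) ∷_)
          (applyUpTo-++ (leftAt ∘ (s +_) ∘ (j′ +_) ∘ suc) n₁ p))))))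
      right≡ : rightBlocks ≡ vs₁ ++ rightBlock E (rowB (j′ + 0)) ∷ vs₂
      right≡ = trans (cong (applyUpTo (λ j → rightBlock E (rowB j))) n≡) (applyUpTo-++ (λ j → rightBlock E (rowB j)) j′ (suc n₁))
      left-carets : ∀ t → carets ⊆ leftAt t
      left-carets t = ++⁺ʳ _ ⊆-refl
      right-carets : ∀ t → carets ⊆ rightBlock E (rowB t)
      right-carets t = ++⁺ˡ (core′ K (bitsOf rightCode (rowB t)) K) ⊆-refl
      matched : Common (leftAt (s + (j′ + 0))) (rightBlock E (rowB (j′ + 0))) (suc E)
      matched = subst₂ (λ t j → Common (leftBlock E (rowA t)) (rightBlock E (rowB j)) (suc E))
        (sym (trans (cong (λ z → arith rem (s + z) n) (+-identityʳ j′)) rem≡)) (sym (+-identityʳ j′))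
        (let z , a , b , ≤z = Match.block-common (toℕ i) j′ in z , a , b ,
          ≤-trans (≤-trans (≤-reflexive (sym (+-suc (d * 4 * (d * 4 + d * 4)) _)))
            (+-monoʳ-≤ (d * 4 * (d * 4 + d * 4)) (good-agreement (Match.agreement+ (toℕ i) j′) (subst (_≤ r) (sym (dot≡ i j)) ≤r)))) ≤z)
      count : length pre * L + (length us₁ * (L + length carets) + (L + suc E + (length us₂ * (L + length carets) + suc (length post) * L)))
        ≡ suc (threshold n d r)
      count = trans
        (cong₂ _+_ (cong (_* L) (length-applyUpTo leftAt s)) (cong₂ _+_ (cong₂ (λ x y → x * (L + y)) (length-applyUpTo (leftAt ∘ (s +_)) j′) (length-replicate E))
          (cong (L + suc E +_) (cong₂ _+_ (cong₂ (λ x y → x * (L + y)) (length-applyUpTo (leftAt ∘ (s +_) ∘ (j′ +_) ∘ suc) n₁) (length-replicate E))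
            (cong (λ x → suc x * L) (length-applyUpTo (leftAt ∘ (s +_) ∘ (j′ +_) ∘ suc ∘ (n₁ +_)) p))))))
        (trans (regroup s j′ n₁ p L E) (cong₂ (λ x y → suc ((x + 1) * L + y * E)) (sym 3n≡) (sym n≡)))
        where
        regroup : ∀ s j m p L E → s * L + (j * (L + E) + (L + suc E + (m * (L + E) + suc p * L))) ≡
          suc ((s + (j + suc (m + p)) + 1) * L + (j + suc m) * E)
        regroup = solve-∀

    decides : ∀ {x y} ℓ → x ≡ xFrame → y ≡ yFrame → IsLCS x y ℓ → Decides I (verdict true (threshold n d r) ℓ)
    decides ℓ refl refl ((z , zx , zy , refl) , longest) with pair? I
    ... | inj₁ ((i , j , ≤r) , pair) =
      let z′ , s , t , ≤z′ = good-pair-common i j ≤r in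
      inj₁ (cong bit (<ᵇ-true (≤-trans ≤z′ (longest z′ s t))) , pair)
    ... | inj₂ (far , no-pair) = inj₂ (cong bit (<ᵇ-false (no-pair-bound far z zx zy)) , no-pair)

  reduction : Reduction 7 (λ I → IsLCS (toList (SequencePair.x I)) (toList (SequencePair.y I)))
  reduction = assemble
    (λ I t → Blocks.leftBlock (VectorSets.d I) (base (VectorSets.d I) (VectorSets.r I)) (Rows.rowA I (arith rem t (VectorSets.n I))))
    (λ I j → Blocks.rightBlock (VectorSets.d I) (base (VectorSets.d I) (VectorSets.r I)) (Rows.rowB I j))
    OnInstance.left-block OnInstance.right-block thresholdE threshold (λ _ → refl) true
    (λ I r<d _ ℓ → OnInstance.decides I r<d ℓ)

-- The reduction to DTWD

module DtwReduction where

  -- The DTWD of a tuned code and any right code.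
  base : ℕ → ℕ → ℕ
  base d r = d + 2 * (1 + r)

  -- Of the 3 n left blocks, 2 n are passed over at the price of their length and n are matched at E
  -- each.
  threshold : ℕ → ℕ → ℕ → ℕ
  threshold n d r = (n + n) * coreSize d + n * base d r

  KE unitE baseE thresholdE : Expr
  KE = dE ‹ times › lit 4
  unitE = KE ‹ times › (KE ‹ plus › KE ‹ plus › lit 1)
  baseE = dE ‹ plus › (lit 2 ‹ times › (lit 1 ‹ plus › rE))
  thresholdE = (nE ‹ plus › nE) ‹ times › unitE ‹ plus › (nE ‹ times › baseE)

  tunedBitE : Expr → Expr
  tunedBitE = bitsE tunedE (λ c → c ‹ less › (lit 1 ‹ plus › rE))

  uE vE : Expr → Expr → Expr
  uE t o = coreE KE (λ k → chooseE (t ‹ less › nE) (tunedBitE k)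
    (chooseE (t ‹ less › (nE ‹ plus › nE)) (bitsE leftE (rowAE (t ‹ monus › nE)) k) (tunedBitE k))) o
  vE j o = coreE KE (bitsE rightE (rowBE j)) o

  -- The vector with r + 1 ones followed by zeros. Under `tunedCode` distances depend on the left
  -- bit alone, so every code of B is at distance d + 2 (1 + r), just above that of a pair with a ∙
  -- b = r.
  tunedBits : ℕ → ℕ → ℕ
  tunedBits r = bitsOf tunedCode (λ c → arith less c (1 + r))

  module Spec (m : ℕ → ℕ) (n d r : ℕ) where

    rowA rowB : ℕ → ℕ → ℕ
    rowA t c = m (t * d + c)
    rowB j c = m (n * d + (j * d + c))

    -- n tuned blocks on either side of the n rows of A: wherever the good pair is, up to n - 1
    -- blocks of B have to be served before its row, or after it.
    mixed : ℕ → ℕ → ℕ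
    mixed t k = choose (arith less t n) (tunedBits r k)
      (choose (arith less t (n + n)) (bitsOf leftCode (rowA (t ∸ n)) k) (tunedBits r k))

    u v : ℕ → ℕ → ℕ
    u t = coreSpec (d * 4) (mixed t)
    v j = coreSpec (d * 4) (bitsOf rightCode (rowB j))

    mixed-before : ∀ {t} → t < n → ∀ k → mixed t k ≡ tunedBits r k
    mixed-before {t} t<n k = choose-less-< (tunedBits r k)
      (choose (arith less t (n + n)) (bitsOf leftCode (rowA (t ∸ n)) k) (tunedBits r k)) t<n

    mixed-middle : ∀ {i} → i < n → ∀ k → mixed (n + i) k ≡ bitsOf leftCode (rowA i) k
    mixed-middle {i} i<n k = trans
      (choose-less-≥ (tunedBits r k) (choose (arith less (n + i) (n + n)) (bitsOf leftCode (rowA (n + i ∸ n)) k) (tunedBits r k)) (m≤m+n n i))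
      (trans (choose-less-< (bitsOf leftCode (rowA (n + i ∸ n)) k) (tunedBits r k) (+-monoʳ-< n i<n))
        (cong (λ z → bitsOf leftCode (rowA z) k) (m+n∸m≡n n i)))

    mixed-after : ∀ {t} → n + n ≤ t → ∀ k → mixed t k ≡ tunedBits r k
    mixed-after {t} ≤t k = trans
      (choose-less-≥ (tunedBits r k) (choose (arith less t (n + n)) (bitsOf leftCode (rowA (t ∸ n)) k) (tunedBits r k)) (≤-trans (m≤m+n n n) ≤t))
      (choose-less-≥ (bitsOf leftCode (rowA (t ∸ n)) k) (tunedBits r k) ≤t)

  open Assembly 0 unitE uE vE (λ d _ → coreSize d) Spec.u Spec.v (λ _ _ _ _ _ → refl) (λ d _ → d≤coreSize d)
    (λ d _ → ≤-trans (m≤m+n (coreSize d) (coreSize d)) (coreSize≤ d)) (λ _ _ _ _ _ → refl)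

  module Blocks (d : ℕ) (0<d : 0 < d) where

    K : ℕ
    K = d * 4

    0<K : 0 < K
    0<K = ≤-trans 0<d (m≤m*n′ d {4} (s≤s z≤n))

    block : (ℕ → ℕ) → List (Fin 5)
    block w = core′ K w K

    coordinate< : ∀ {k} → k < K → arith quot k 4 < d
    coordinate< {k} k<K = m<n*o⇒m/o<n {k} {d} {4} k<K

    block-list : ∀ w w′ → (∀ k → k < K → w k ≡ w′ k) → applyUpTo (fin ∘ coreSpec K w) (coreSize d) ≡ block w′
    block-list w w′ = coreSpec-list K w w′ K

    block-cong : ∀ w w′ → (∀ k → w k ≡ w′ k) → block w ≡ block w′
    block-cong w w′ w≗w′ = trans (sym (block-list w w (λ _ _ → refl))) (block-list w w′ (λ k _ → w≗w′ k))

    length-block : ∀ w → length (block w) ≡ coreSize d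
    length-block w = length-core (fin 2) (fin 3) K (fin ∘ w) K

    module _ (w : ℕ → ℕ) (bw : ∀ k → IsBit (w k)) where

      plain-block : Plain (block w)
      plain-block = core-All (fin 2) (fin 3) K (λ ()) (λ ()) (fin ∘ w) (λ k → proj₂ (proj₂ (fin-bit-≢ (bw k)))) K

      proper : ∀ {M} → Proper {α = fin 2} {β = fin 3} {M = M} (fin ∘ w)
      proper k = proj₁ (fin-bit-≢ (bw k)) , proj₁ (proj₂ (fin-bit-≢ (bw k)))

    block≢[] : ∀ w → block w ≢ []
    block≢[] w e≡ = <⇒≢ (≤-trans 0<d (d≤coreSize d)) (trans (sym (cong length e≡)) (length-block w))

    module _ {w w′ : ℕ → ℕ} (bw : ∀ k → IsBit (w k)) (bw′ : ∀ k → IsBit (w′ k)) where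

      distance : ℕ
      distance = ham (fin ∘ w) (fin ∘ w′) K

      walk-block-bound : ∀ {c} → Walk (block w) (block w′) c → distance ≤ c
      -- The runs are as long as the number K of bits, so no Hamming distance exceeds them and the
      -- rigidity of cores applies.
      walk-block-bound {c} = bound K 0<K (≤-trans (m≤m+n distance _) (≤-reflexive (ham+agreement (fin ∘ w) (fin ∘ w′) K)))
        where
        bound : ∀ M → 0 < M → distance ≤ M → Walk (core′ M w K) (core′ M w′ K) c → distance ≤ c
        bound (suc m) _ ≤M = Rigid.walk-core-bound {α = fin 2} {β = fin 3} (λ ()) m (fin ∘ w) (fin ∘ w′) K
          (proper w bw {suc m}) (proper w′ bw′ {suc m}) ≤M

      walk-block : Walk≤ (block w) (block w′) distance
      walk-block = build K K 0<K 0<K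
        where
        build : ∀ M K → 0 < M → 0 < K → Walk≤ (core′ M w K) (core′ M w′ K) (ham (fin ∘ w) (fin ∘ w′) K)
        build (suc m) (suc K) _ _ = walk≤-core m (fin ∘ w) (fin ∘ w′) K

  plain-frame : ∀ L {B} {us : List (List (Fin 5))} → All Plain us → All (λ u → length u ≡ B) us → plain (frame L us) ≡ length us * B
  plain-frame L []       []       = plain-replicate L
  plain-frame L {us = u ∷ us} (p ∷ ps) (l ∷ ls) = trans (plain-++ (replicate L hash) _) (cong₂ _+_ (plain-replicate L)
    (trans (plain-++ u _) (cong₂ _+_ (trans (plain-Plain p) l) (plain-frame L ps ls))))

  module OnInstance (I : VectorSets) (r<d : VectorSets.r I < VectorSets.d I) where
    open VectorSets I using (n; d; r; A; B)
    open Rows I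
    open Blocks d (≤-<-trans z≤n r<d)

    E : ℕ
    E = base d r

    module C = Spec cells n d r

    open Sequences I r<d (λ t → block (C.mixed t)) (λ j → block (bitsOf rightCode (rowB j)))

    left-block : ∀ m → Local I m → ∀ t → applyUpTo (fin ∘ Spec.u m n d r t) U ≡ block (C.mixed t)
    left-block m local t = block-list (Spec.mixed m n d r t) (C.mixed t) same-bits
      where
      same-bits : ∀ k → k < K → Spec.mixed m n d r t k ≡ C.mixed t k
      same-bits k k<K with t <? n
      ... | yes t<n = trans (Spec.mixed-before m n d r t<n k) (sym (C.mixed-before t<n k))
      ... | no t≮n with t <? n + n
      ... | no t≮2n = trans (Spec.mixed-after m n d r (≮⇒≥ t≮2n) k) (sym (C.mixed-after (≮⇒≥ t≮2n) k))
      ... | yes t<2n = subst (λ t → Spec.mixed m n d r t k ≡ C.mixed t k) (m+[n∸m]≡n (≮⇒≥ t≮n))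
        (trans (Spec.mixed-middle m n d r i<n k) (trans
          (cong (λ x → leftCode x (arith rem k 4)) (local _ (≤-trans (offset< i<n (coordinate< k<K)) (m≤m+n (n * d) (n * d)))))
          (sym (C.mixed-middle i<n k))))
        where
        i<n : t ∸ n < n
        i<n = +-cancelˡ-< n _ _ (subst (_< n + n) (sym (m+[n∸m]≡n (≮⇒≥ t≮n))) t<2n)

    right-block : ∀ m → Local I m → ∀ j → j < n → applyUpTo (fin ∘ Spec.v m n d r j) U ≡ block (bitsOf rightCode (rowB j))
    right-block m local j j<n = block-list (bitsOf rightCode (Spec.rowB m n d r j)) (bitsOf rightCode (rowB j))
      (λ k k<K → cong (λ x → rightCode x (arith rem k 4)) (local _ (+-monoʳ-< (n * d) (offset< j<n (coordinate< k<K)))))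

    mixedBlock rightBlock : ℕ → List (Fin 5)
    mixedBlock t = block (C.mixed t)
    rightBlock j = block (bitsOf rightCode (rowB j))

    tuned-bit : ∀ k → IsBit (tunedBits r k)
    tuned-bit k = tunedCode-bit (arith rem k 4) (less-bit (arith quot k 4) (1 + r))

    left-bit : ∀ t k → IsBit (bitsOf leftCode (rowA t) k)
    left-bit t k = leftCode-bit (arith rem k 4) (cells-bit (t * d + arith quot k 4))

    right-bit : ∀ j k → IsBit (bitsOf rightCode (rowB j) k)
    right-bit j k = rightCode-bit (arith rem k 4) (cells-bit (n * d + (j * d + arith quot k 4)))

    mixed-bit : ∀ t k → IsBit (C.mixed t k)
    mixed-bit t k = choose-bit (arith less t n) _ _ (less-bit t n) (tuned-bit k)
      (choose-bit (arith less t (n + n)) _ _ (less-bit t (n + n)) (left-bit (t ∸ n) k) (tuned-bit k))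

    tuned-distance : ∀ j → distance tuned-bit (right-bit j) ≡ E
    tuned-distance j = ham-tuned (1 + r) (rowB j) d r<d (λ c → cells-bit (n * d + (j * d + c)))

    left-distance : ∀ i j → distance (left-bit (toℕ i)) (right-bit (toℕ j)) ≡ d + 2 * (lookup A i ∙ lookup B j)
    left-distance i j = trans
      (ham-left (rowA (toℕ i)) (rowB (toℕ j)) d (λ c → cells-bit (toℕ i * d + c)) (λ c → cells-bit (n * d + (toℕ j * d + c))))
      (cong (λ x → d + 2 * x) (dot-rows i j))

    tunedBlock : List (Fin 5)
    tunedBlock = block (tunedBits r)

    tuned-costly : ∀ j {c} → Walk tunedBlock (rightBlock j) c → E ≤ c
    tuned-costly j w = subst (_≤ _) (tuned-distance j) (walk-block-bound tuned-bit (right-bit j) w)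

    mixed-costly : (∀ i j → r < lookup A i ∙ lookup B j) → ∀ t → ∀ j → j < n →
      ∀ {c} → Walk (mixedBlock t) (rightBlock j) c → E ≤ c
    mixed-costly far t j j<n {c} w with t <? n
    ... | yes t<n = tuned-costly j (subst (λ u → Walk u (rightBlock j) c) (block-cong (C.mixed t) (tunedBits r) (C.mixed-before t<n)) w)
    ... | no t≮n with t <? n + n
    ... | no t≮2n = tuned-costly j (subst (λ u → Walk u (rightBlock j) c) (block-cong (C.mixed t) (tunedBits r) (C.mixed-after (≮⇒≥ t≮2n))) w)
    ... | yes t<2n = ≤-trans (+-monoʳ-≤ d (*-monoʳ-≤ 2 (far i j′)))
      (subst (_≤ c) (left-distance i j′) (walk-block-bound (left-bit (toℕ i)) (right-bit (toℕ j′))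
        (subst₂ (λ u v → Walk u v c)
          (trans (cong mixedBlock t≡) (block-cong (C.mixed (n + toℕ i)) (bitsOf leftCode (rowA (toℕ i))) (C.mixed-middle (toℕ<n i))))
          (cong rightBlock (sym (toℕ-fromℕ< j<n))) w)))
      where
      i<n : t ∸ n < n
      i<n = +-cancelˡ-< n _ _ (subst (_< n + n) (sym (m+[n∸m]≡n (≮⇒≥ t≮n))) t<2n)
      i j′ : Fin n
      i = fromℕ< i<n
      j′ = fromℕ< j<n
      t≡ : t ≡ n + toℕ i
      t≡ = trans (sym (m+[n∸m]≡n (≮⇒≥ t≮n))) (cong (n +_) (sym (toℕ-fromℕ< i<n)))

    -- A tuned match is never dearer than passing over a block. The lower bound for framed words
    -- builds on this: it credits each right block with U - E.
    E≤U : E ≤ U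
    E≤U = begin
      d + 2 * (1 + r)     ≤⟨ +-monoʳ-≤ d (*-monoʳ-≤ 2 r<d) ⟩
      d + 2 * d           ≤⟨ m≤m+n (d + 2 * d) d ⟩
      d + 2 * d + d       ≡⟨ regroup d ⟩
      d * 4               ≤⟨ m≤m*n′ (d * 4) (m≤n+m 1 (d * 4 + d * 4)) ⟩
      U                   ∎
      where
      open ≤-Reasoning
      regroup : ∀ d → d + 2 * d + d ≡ d * 4
      regroup = solve-∀

    no-pair-bound : (∀ i j → r < lookup A i ∙ lookup B j) → ∀ {c} →
      Walk xFrame yFrame c → threshold n d r ≤ c
    -- n U is added on both sides, since the bound for framed words starts from passing over all 3 n
    -- blocks and credits the n matches separately.
    no-pair-bound far {c} w = +-cancelʳ-≤ (n * U) _ _ (begin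
      (n + n) * U + n * E + n * U            ≡⟨ regroup n U E ⟩
      3 * n * U + n * E                      ≡⟨ cong (_+ n * E) (trans (plain-frame L
          (AllP.applyUpTo⁺₂ mixedBlock (3 * n) (λ t → plain-block (C.mixed t) (mixed-bit t)))
          (AllP.applyUpTo⁺₂ mixedBlock (3 * n) (λ t → length-block (C.mixed t)))) (cong (_* U) (length-applyUpTo mixedBlock (3 * n)))) ⟨
      plain (frame L leftBlocks) + n * E     ≤⟨ bound L (≤-trans 0<U (m≤m+n U U)) ≤-refl w ⟩
      c + n * U                              ∎)
      where
      open ≤-Reasoning
      regroup : ∀ n u e → (n + n) * u + n * e + n * u ≡ 3 * n * u + n * e
      regroup = solve-∀
      bound : ∀ L → 0 < L → U + U ≤ L →
        Walk (frame L leftBlocks) (replicate P hash ++ frame L rightBlocks ++ replicate (P + P) hash) c →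
        plain (frame L leftBlocks) + n * E ≤ c + n * U
      bound (suc l) _ 2U≤L w = subst (λ k → plain (frame (suc l) leftBlocks) + k * E ≤ c + k * U) (length-applyUpTo rightBlock n)
        (walk-padded-bound hash {U} {l} {E} {P + P} 2U≤L E≤U P rightBlocks
          (AllP.applyUpTo⁺₂ rightBlock n (λ j → block≢[] (bitsOf rightCode (rowB j)) , plain-block (bitsOf rightCode (rowB j)) (right-bit j)))
          (AllP.applyUpTo⁺₁ rightBlock n (λ {j} j<n → AllP.applyUpTo⁺₂ mixedBlock (3 * n) (λ t →
            (plain-block (C.mixed t) (mixed-bit t) , ≤-reflexive (length-block (C.mixed t))) , mixed-costly far t j j<n))) w)

    good-pair-walk : ∀ i j → lookup A i ∙ lookup B j ≤ r →
      ∃[ c ] c < threshold n d r ×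
        Walk xFrame yFrame c
    good-pair-walk i j ≤r =
      let c , c≤ , w = build L (≤-trans 0<U (m≤m+n U U)) in
      c , ≤-<-trans c≤ cost< , subst₂ (λ us vs → Walk (frame L us) (replicate P hash ++ frame L vs ++ replicate (P + P) hash) c) (sym left≡) (sym right≡) w
      where
      i′ j′ i₁ j₁ : ℕ
      i′ = toℕ i
      j′ = toℕ j
      i₁ = n ∸ suc i′
      j₁ = n ∸ suc j′
      n≡j : n ≡ j′ + suc j₁
      n≡j = trans (sym (m+[n∸m]≡n (toℕ<n j))) (sym (+-suc j′ j₁))
      n≡i : n ≡ i′ + suc i₁
      n≡i = trans (sym (m+[n∸m]≡n (toℕ<n i))) (sym (+-suc i′ i₁))
      gap : ℕ
      -- Between the first j′ tuned blocks and row i there are n - j′ further tuned blocks and i′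
      -- rows.
      gap = suc j₁ + i′
      3n≡ : 3 * n ≡ j′ + (gap + suc (i₁ + (j₁ + suc j′)))
      3n≡ = begin
        3 * n                                         ≡⟨ expand n ⟩
        n + (n + n)                                   ≡⟨ cong₂ _+_ n≡j (cong₂ _+_ n≡i n≡j) ⟩
        j′ + suc j₁ + (i′ + suc i₁ + (j′ + suc j₁))   ≡⟨ regroup j′ j₁ i′ i₁ ⟩
        j′ + (gap + suc (i₁ + (j₁ + suc j′)))         ∎
        where
        open ≡-Reasoning
        expand : ∀ n → 3 * n ≡ n + (n + n)
        expand = solve-∀
        regroup : ∀ j j₁ i i₁ → j + suc j₁ + (i + suc i₁ + (j + suc j₁)) ≡ j + (suc j₁ + i + suc (i₁ + (j₁ + suc j)))
        regroup = solve-∀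
      f₂ f₃ f₄ f₅ : ℕ → List (Fin 5)
      f₂ = mixedBlock ∘ (j′ +_)
      f₃ = f₂ ∘ (gap +_) ∘ suc
      f₄ = f₃ ∘ (i₁ +_)
      f₅ = f₄ ∘ (j₁ +_)
      us₁ us₂ us₃ us₄ us₅ vs₁ vs₂ : List (List (Fin 5))
      us₁ = applyUpTo mixedBlock j′
      us₂ = applyUpTo f₂ gap
      us₃ = applyUpTo f₃ i₁
      us₄ = applyUpTo f₄ j₁
      us₅ = applyUpTo f₅ (suc j′)
      vs₁ = applyUpTo rightBlock j′
      vs₂ = applyUpTo (rightBlock ∘ (j′ +_) ∘ suc) j₁
      u v : List (Fin 5)
      u = mixedBlock (j′ + (gap + 0))
      v = rightBlock (j′ + 0)
      left≡ : leftBlocks ≡ us₁ ++ us₂ ++ u ∷ us₃ ++ us₄ ++ us₅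
      left≡ = trans (cong (applyUpTo mixedBlock) 3n≡) (trans (applyUpTo-++ mixedBlock j′ _) (cong (us₁ ++_)
        (trans (applyUpTo-++ f₂ gap _) (cong (λ us → us₂ ++ u ∷ us)
          (trans (applyUpTo-++ f₃ i₁ _) (cong (us₃ ++_) (applyUpTo-++ f₄ j₁ (suc j′))))))))
      right≡ : rightBlocks ≡ vs₁ ++ v ∷ vs₂
      right≡ = trans (cong (applyUpTo rightBlock) n≡j) (applyUpTo-++ rightBlock j′ (suc j₁))
      x c : ℕ
      x = lookup A i ∙ lookup B j
      c = d + 2 * x
      position : j′ + (gap + 0) ≡ n + i′
      position = trans (regroup j′ j₁ i′) (cong (_+ i′) (sym n≡j))
        where
        regroup : ∀ j j₁ i → j + (suc j₁ + i + 0) ≡ j + suc j₁ + i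
        regroup = solve-∀
      matched : Walk≤ u v c
      matched = subst₂ (λ u v → Walk≤ u v c)
        (sym (trans (cong mixedBlock position) (block-cong (C.mixed (n + i′)) (bitsOf leftCode (rowA i′)) (C.mixed-middle (toℕ<n i)))))
        (cong rightBlock (sym (+-identityʳ j′)))
        (subst (Walk≤ (block (bitsOf leftCode (rowA i′))) (rightBlock j′)) (left-distance i j) (walk-block (left-bit i′) (right-bit j′)))
      tuned-walk : ∀ j → Walk≤ tunedBlock (rightBlock j) E
      tuned-walk j = subst (Walk≤ tunedBlock (rightBlock j)) (tuned-distance j) (walk-block tuned-bit (right-bit j))
      before : ∀ {t} → t < j′ → mixedBlock t ≡ tunedBlock
      before {t} t<j = block-cong (C.mixed t) (tunedBits r) (C.mixed-before (<-trans t<j (toℕ<n j)))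
      after : ∀ t → f₄ t ≡ tunedBlock
      after t = block-cong (C.mixed (j′ + (gap + suc (i₁ + t)))) (tunedBits r) (C.mixed-after
        (subst (n + n ≤_) (trans (cong (_+ t) (cong₂ _+_ n≡j n≡i)) (regroup j′ j₁ i′ i₁ t)) (m≤m+n (n + n) t)))
        where
        regroup : ∀ j j₁ i i₁ t → j + suc j₁ + (i + suc i₁) + t ≡ j + (suc j₁ + i + suc (i₁ + t))
        regroup = solve-∀
      short : ∀ g k → All (λ u → length u ≤ U) (applyUpTo (mixedBlock ∘ g) k)
      short g k = AllP.applyUpTo⁺₂ (mixedBlock ∘ g) k (λ t → ≤-reflexive (length-block (C.mixed (g t))))
      build : ∀ L → 0 < L → Walk≤ (frame L (us₁ ++ us₂ ++ u ∷ us₃ ++ us₄ ++ us₅)) (replicate P hash ++ frame L (vs₁ ++ v ∷ vs₂) ++ replicate (P + P) hash)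
        (length us₁ * E + (length us₂ * U + (c + (length us₃ * U + (length us₄ * E + length us₅ * U)))))
      build (suc l) _ = frame-walk hash {U} {l} {P + P} us₁ us₂ us₃ us₄ us₅ vs₁ vs₂ {tunedBlock} {E} {c} P
        (trans (length-applyUpTo mixedBlock j′) (sym (length-applyUpTo rightBlock j′)))
        (trans (length-applyUpTo f₄ j₁) (sym (length-applyUpTo (rightBlock ∘ (j′ +_) ∘ suc) j₁)))
        (AllP.applyUpTo⁺₁ mixedBlock j′ before) (AllP.applyUpTo⁺₂ f₄ j₁ after)
        (AllP.applyUpTo⁺₂ rightBlock j′ tuned-walk) (AllP.applyUpTo⁺₂ (rightBlock ∘ (j′ +_) ∘ suc) j₁ (λ t → tuned-walk (j′ + suc t)))
        matched (short (j′ +_) gap) (short (λ t → j′ + (gap + suc t)) i₁) (short (λ t → j′ + (gap + suc (i₁ + (j₁ + t)))) (suc j′))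
      cost< : length us₁ * E + (length us₂ * U + (c + (length us₃ * U + (length us₄ * E + length us₅ * U)))) < threshold n d r
      cost< = begin-strict
        length us₁ * E + (length us₂ * U + (c + (length us₃ * U + (length us₄ * E + length us₅ * U))))
          ≡⟨ cong₂ _+_ (cong (_* E) (length-applyUpTo mixedBlock j′)) (cong₂ _+_ (cong (_* U) (length-applyUpTo f₂ gap))
              (cong (c +_) (cong₂ _+_ (cong (_* U) (length-applyUpTo f₃ i₁)) (cong₂ _+_ (cong (_* E) (length-applyUpTo f₄ j₁)) (cong (_* U) (length-applyUpTo f₅ (suc j′))))))) ⟩
        j′ * E + (gap * U + (c + (i₁ * U + (j₁ * E + suc j′ * U))))
          <⟨ +-monoʳ-< (j′ * E) (+-monoʳ-< (gap * U) (+-monoˡ-< (i₁ * U + (j₁ * E + suc j′ * U)) c<E)) ⟩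
        j′ * E + (gap * U + (E + (i₁ * U + (j₁ * E + suc j′ * U))))
          ≡⟨ regroup j′ j₁ i′ i₁ E U ⟩
        (i′ + suc i₁ + (j′ + suc j₁)) * U + (j′ + suc j₁) * E
          ≡⟨ cong₂ (λ a b → (a + b) * U + b * E) (sym n≡i) (sym n≡j) ⟩
        threshold n d r ∎
        where
        open ≤-Reasoning
        c<E : c < E
        c<E = +-monoʳ-< d (*-monoʳ-< 2 (s≤s ≤r))
        regroup : ∀ j j₁ i i₁ e u → j * e + ((suc j₁ + i) * u + (e + (i₁ * u + (j₁ * e + suc j * u)))) ≡
          (i + suc i₁ + (j + suc j₁)) * u + (j + suc j₁) * e
        regroup = solve-∀

    decides : ∀ {N} (x y : Vec (Fin 5) N) ℓ → toList x ≡ xFrame → toList y ≡ yFrame →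
      IsDTWD x y ℓ → Decides I (verdict false (threshold n d r) ℓ)
    decides x y ℓ x≡ y≡ (attained , least) with pair? I
    ... | inj₁ ((i , j , ≤r) , pair) =
      let c , c< , w = good-pair-walk i j ≤r in
      inj₁ (cong bit (<ᵇ-true (≤-<-trans (least c (walk⇒traversal x y
        (subst₂ (λ s t → Walk s t c) (sym x≡) (sym y≡) w))) c<)) , pair)
    ... | inj₂ (far , no-pair) =
      inj₂ (cong bit (<ᵇ-false (no-pair-bound far
        (subst₂ (λ s t → Walk s t ℓ) x≡ y≡ (traversal⇒walk x y attained)))) , no-pair)

  reduction : Reduction 5 (λ I → IsDTWD (SequencePair.x I) (SequencePair.y I))
  reduction = assemble
    (λ I t → core′ (VectorSets.d I * 4)
      (Spec.mixed (Rows.cells I) (VectorSets.n I) (VectorSets.d I) (VectorSets.r I) t) (VectorSets.d I * 4))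
    (λ I j → core′ (VectorSets.d I * 4) (bitsOf rightCode (Rows.rowB I j)) (VectorSets.d I * 4))
    OnInstance.left-block OnInstance.right-block thresholdE threshold (λ _ → refl) false
    (λ I r<d S ℓ → OnInstance.decides I r<d (SequencePair.x S) (SequencePair.y S) ℓ)

theorem1 :
    (∃[ ε ] 0ℚ ℚ.< ε × (LCS-Subquadratic 7 ε ⊎ DTWD-Subquadratic 5 ε)) →
    ∃[ ε′ ] 0ℚ ℚ.< ε′ × MostOrthogonalVectors-Subquadratic ε′
theorem1 (ε , 0<ε , inj₁ lcs)  = transfer LcsReduction.reduction 0<ε lcs
theorem1 (ε , 0<ε , inj₂ dtwd) = transfer DtwReduction.reduction 0<ε dtwd
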